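{- Let $n\ge 48$. Every $n$-vertex caterpillar $G$ having at least four vertices of maximum degree is reconstructible from its deck $\mathcal D(G)$: every graph $H$ with $\mathcal D(H)=\mathcal D(G)$ is isomorphic to $G$.
   Context: A caterpillar is a tree in which the subgraph induced by the non-leaf vertices is a path (the spine). For an $n$-vertex graph $G$, the deck $\mathcal D(G)$ is the multiset of all induced subgraphs of $G$ (each up to isomorphism) having at most $(n+2)/2$ vertices. -}

module Defs where

open import Data.Nat using (ℕ; zero; suc; _+_; _*_; _≤_)
open import Data.Bool using (Bool; true; false; if_then_else_)
open import Data.Fin using (Fin; toℕ; inject₁; fromℕ)
open import Data.Fin.Subset using (Subset; _∈_; ∣_∣)
open import Data.List using (List; map; allFin)
open import Data.Nat.ListAction using (sum)
open import Data.Product using (Σ; _×_; ∃; proj₁)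
open import Data.Sum using (_⊎_)
open import Relation.Binary.PropositionalEquality using (_≡_)
open import Function.Bundles using (_↔_; _⇔_; Inverse)
open import Function.Definitions using (Injective)

record Graph (n : ℕ) : Set where
  field
    adj    : Fin n → Fin n → Bool
    sym    : ∀ i j → adj i j ≡ adj j i
    irrefl : ∀ i → adj i i ≡ false
open Graph public

deg : ∀ {n} → Graph n → Fin n → ℕ
deg {n} G i = sum (map (λ j → if adj G i j then 1 else 0) (allFin n))

HasMaxDegree : ∀ {n} → Graph n → Fin n → Set
HasMaxDegree G v = ∀ u → deg G u ≤ deg G v

data Walk {n} (G : Graph n) : Fin n → Fin n → Set where
  here : ∀ {i} → Walk G i i
  step : ∀ {i j k} → adj G i j ≡ true → Walk G j k → Walk G i k

Connected : ∀ {n} → Graph n → Set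
Connected G = ∀ i j → Walk G i j

IsCycle : ∀ {n} → Graph n → (k : ℕ) → (Fin (suc (suc (suc k))) → Fin n) → Set
IsCycle G k e =
  Injective _≡_ _≡_ e
  × (∀ (i : Fin (suc (suc k))) → adj G (e (inject₁ i)) (e (Fin.suc i)) ≡ true)
  × adj G (e (fromℕ (suc (suc k)))) (e Fin.zero) ≡ true

Acyclic : ∀ {n} → Graph n → Set
Acyclic {n} G = ∀ k (e : Fin (suc (suc (suc k))) → Fin n) → IsCycle G k e → Data.Empty.⊥
  where import Data.Empty

IsTree : ∀ {n} → Graph n → Set
IsTree G = Connected G × Acyclic G

NonLeaf : ∀ {n} → Graph n → Fin n → Set
NonLeaf G v = 2 ≤ deg G v

SpineIsPath : ∀ {n} → Graph n → Set
SpineIsPath {n} G =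
  Σ ℕ λ k → Σ (Fin k → Fin n) λ e →
    Injective _≡_ _≡_ e
    × (∀ v → NonLeaf G v ⇔ ∃ λ p → e p ≡ v)
    × (∀ p q → (adj G (e p) (e q) ≡ true)
                 ⇔ (toℕ p ≡ suc (toℕ q) ⊎ toℕ q ≡ suc (toℕ p)))

IsCaterpillar : ∀ {n} → Graph n → Set
IsCaterpillar G = IsTree G × SpineIsPath G

_≅_ : ∀ {n m} → Graph n → Graph m → Set
_≅_ {n} {m} G H = Σ (Fin n ↔ Fin m) λ f →
  ∀ i j → adj G i j ≡ adj H (Inverse.to f i) (Inverse.to f j)

Elem : ∀ {n} → Subset n → Set
Elem {n} S = Σ (Fin n) λ i → i ∈ S

InducedIso : ∀ {n m} → Graph n → Subset n → Graph m → Subset m → Set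
InducedIso G S H T = Σ (Elem S ↔ Elem T) λ f →
  ∀ a b → adj G (proj₁ a) (proj₁ b)
          ≡ adj H (proj₁ (Inverse.to f a)) (proj₁ (Inverse.to f b))

Card : ℕ → Set
Card n = Σ (Subset n) λ S → ∣ S ∣ * 2 ≤ n + 2

-- D(G) = D(H) as multisets of isomorphism classes: a bijection between
-- cards matching isomorphic induced subgraphs.
SameDeck : ∀ {n m} → Graph n → Graph m → Set
SameDeck {n} {m} G H = Σ (Card n ↔ Card m) λ σ →
  ∀ c → InducedIso G (proj₁ c) H (proj₁ (Inverse.to σ c))

{-# OPTIONS --safe #-}

-- The deck determines every sum, over r-tuples of vertices with r ≤ (n + 2) / 2, of a
-- quantity that depends only on the adjacencies and equalities within the tuple.  Let F + 1
-- be the maximum degree of G.  For a vertex v of degree at most F + 1 with a neighbour w, the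
-- product over j = 1, …, F of (j - number of neighbours of v other than w) is F! if v is a
-- leaf and 0 otherwise, so such sums can recognize leaves at the cost of F further vertices.
-- The four vertices of maximum degree give q + 4F ≤ n + 2, where q is the number of spine
-- vertices, so this cost is affordable.
--
-- Count nonbacktracking walks that start at a nonleaf vertex, weighted by powers of deg - 1,
-- and subtract the count of the walks that are one vertex longer: what remains are the walks
-- starting at an end of the spine.  As this difference is positive in G, the other graph H
-- contains a long path of nonleaf vertices beginning at an end.  The nonleaf vertices of H
-- outside this path (continued as far as possible) induce a 2-regular graph that is small
-- enough to be copied into G, so there are none, and H is a caterpillar with q spine
-- vertices.  Let aᵢ be deg - 1 at the i-th spine vertex and a* the reversed word.  The
-- differences of walk counts are a_c + a*_c and a_c a_d + a*_c a*_d, and they determine the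
-- word a up to reversal, except when F = 2, where the orientation of one pair of letters near
-- the middle may remain open; it is settled by the autocorrelations Σ aᵢ aᵢ₊ₗ.
module Submission where

open import Defs renaming (sym to adj-sym)
open import Algebra.Bundles using (CommutativeSemiring)
open import Data.Bool as Bool using (Bool; true; false; if_then_else_; _∧_; not)
open import Data.Empty using (⊥; ⊥-elim)
open import Data.Fin as Fin using (Fin; toℕ; inject₁; fromℕ<)
import Data.Fin.Permutation as Perm
import Data.Fin.Properties as Finₚ
open import Data.Fin.Subset as Subset using (Subset; ∣_∣; _∪_; ⁅_⁆; inside; outside) renaming (_∈_ to _∈ˢ_)
import Data.Fin.Subset.Properties as Subsetₚ
open import Data.Integer as ℤ using (ℤ; +_; -[1+_]; 0ℤ; 1ℤ; _+_; _*_; _-_; -_; _≤_; _<_; _^_; +≤+; +<+)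
import Data.Integer.Properties as ℤₚ
open import Data.Integer.Tactic.RingSolver using (solve-∀)
open import Data.List as List using (List; []; _∷_)
import Data.List.Properties as Listₚ
import Data.Nat as ℕ
open import Data.Nat using (ℕ; zero; suc; z≤n; s≤s)
open import Data.Nat.ListAction using () renaming (sum to sumᴸ)
import Data.Nat.Properties as ℕₚ
open import Data.Nat.Tactic.RingSolver using () renaming (solve-∀ to solveℕ-∀)
import Data.Product.Properties as Productₚ
open import Data.Product using (Σ; ∃; _×_; _,_; proj₁; proj₂)
open import Data.Sum using (_⊎_; inj₁; inj₂; [_,_]′)
open import Data.Vec as Vec using (Vec; []; _∷_; lookup; take; drop; _++_)
open import Data.Vec.Properties using (≡-dec; lookup∘tabulate; []=⇒lookup; lookup⇒[]=)
open import Data.Vec.Properties.WithK using ([]=-irrelevant)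
open import Function using (_∘_; id; Inverse; Equivalence; case_of_)
open import Function.Definitions using (Injective)
open import Relation.Binary.PropositionalEquality
open import Relation.Binary.Definitions using (tri<; tri≈; tri>)
open import Relation.Nullary using (¬_; Dec; yes; no; does; contradiction)
open import Relation.Nullary.Decidable using (dec-true; dec-false; _×-dec_; ¬?)
open import Algebra.Properties.Semiring.Sum (CommutativeSemiring.semiring ℤₚ.+-*-commutativeSemiring) using (sum; sum-cong-≗; ∑-distrib-+; ∑-comm; *-distribˡ-sum; sum-permute; sum-remove; sum-replicate-zero)

-- Finite sums of integers

-- The cost of reading letters decides the shape of the proof. A detector is spent only once per
-- walk, at its first vertex: the positive power of deg - 1 at the last vertex already keeps the
-- rest of a nonbacktracking walk off the leaves. So the letters at distances c ≤ d from an end cost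
-- 4 + F + d vertices. Half of n + 2 is at least q / 2 + 2F, hence d may go up to about q / 2 + F -
-- 4. What stays hidden between the two ends is a block of κ + 1 letters with κ + 2F ≤ 6. It is a
-- single letter unless F ≤ 2; for F = 1 every letter is 1, so only F = 2 makes trouble.
-- Autocorrelations need no detector at all, which is why they reach far enough to settle that case.
-- The walk that finds an end of H is a compromise as well: it has to fit on the cards, yet be so
-- long that whatever it misses fits on one card.

𝟙 : Bool → ℤ
𝟙 b = if b then 1ℤ else 0ℤ

_==_ : ∀ {n} → Fin n → Fin n → Bool
u == v = does (u Fin.≟ v)

opaque
  ∑ : ∀ {n} → (Fin n → ℤ) → ℤ
  ∑ = sum

  ∑-[] : (φ : Fin 0 → ℤ) → ∑ φ ≡ 0ℤ
  ∑-[] φ = refl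

  ∑-∷ : ∀ {n} (φ : Fin (suc n) → ℤ) → ∑ φ ≡ φ Fin.zero + ∑ (φ ∘ Fin.suc)
  ∑-∷ φ = refl

  ∑-+ : ∀ {n} (φ ψ : Fin n → ℤ) → ∑ (λ v → φ v + ψ v) ≡ ∑ φ + ∑ ψ
  ∑-+ = ∑-distrib-+

  ∑-*ˡ : ∀ {n} c (φ : Fin n → ℤ) → ∑ (λ v → c * φ v) ≡ c * ∑ φ
  ∑-*ˡ c φ = sym (*-distribˡ-sum c φ)

  ∑-cong : ∀ {n} {φ ψ : Fin n → ℤ} → (∀ v → φ v ≡ ψ v) → ∑ φ ≡ ∑ ψ
  ∑-cong = sum-cong-≗

  ∑-swap : ∀ {m n} (φ : Fin m → Fin n → ℤ) → ∑ (λ u → ∑ (φ u)) ≡ ∑ (λ v → ∑ (λ u → φ u v))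
  ∑-swap φ = ∑-comm φ

  ∑-zero : ∀ {n} {φ : Fin n → ℤ} → (∀ v → φ v ≡ 0ℤ) → ∑ φ ≡ 0ℤ
  ∑-zero {n} φ≡0 = trans (sum-cong-≗ φ≡0) (sum-replicate-zero n)

  ∑-remove : ∀ {n} (i : Fin (suc n)) (φ : Fin (suc n) → ℤ) → ∑ φ ≡ φ i + ∑ (φ ∘ Fin.punchIn i)
  ∑-remove i φ = sum-remove {i = i} φ

  ∑-reverse : ∀ {n} (φ : Fin n → ℤ) → ∑ φ ≡ ∑ (φ ∘ Fin.opposite)
  ∑-reverse φ = sum-permute φ Perm.reverse

∑-δ : ∀ {n} (v : Fin n) (φ : Fin n → ℤ) → ∑ (λ u → 𝟙 (u == v) * φ u) ≡ φ v
∑-δ Fin.zero φ = trans (∑-∷ _) (trans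
  (cong₂ _+_ (ℤₚ.*-identityˡ (φ Fin.zero)) (∑-zero (λ u → refl))) (ℤₚ.+-identityʳ (φ Fin.zero)))
∑-δ (Fin.suc v) φ = trans (∑-∷ _) (trans (ℤₚ.+-identityˡ _) (∑-δ v (φ ∘ Fin.suc)))

∑-mono : ∀ {n} {φ ψ : Fin n → ℤ} → (∀ v → φ v ≤ ψ v) → ∑ φ ≤ ∑ ψ
∑-mono {zero} {φ} {ψ} _ = ℤₚ.≤-reflexive (trans (∑-[] φ) (sym (∑-[] ψ)))
∑-mono {suc n} {φ} {ψ} φ≤ψ = subst₂ _≤_ (sym (∑-∷ φ)) (sym (∑-∷ ψ))
  (ℤₚ.+-mono-≤ (φ≤ψ Fin.zero) (∑-mono (φ≤ψ ∘ Fin.suc)))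

∑-pos : ∀ {n} (φ : Fin n → ℤ) → 0ℤ < ∑ φ → ∃ λ v → 0ℤ < φ v
∑-pos {zero} φ 0<∑ = contradiction (subst (0ℤ <_) (∑-[] φ) 0<∑) λ { (+<+ ()) }
∑-pos {suc n} φ 0<∑ with 0ℤ ℤ.<? φ Fin.zero
... | yes 0<φ = Fin.zero , 0<φ
... | no 0≮φ with v , 0<φ ← ∑-pos (φ ∘ Fin.suc) (ℤₚ.<-≤-trans (subst (0ℤ <_) (∑-∷ φ) 0<∑)
                   (subst (φ Fin.zero + ∑ (φ ∘ Fin.suc) ≤_) (ℤₚ.+-identityˡ _) (ℤₚ.+-monoˡ-≤ _ (ℤₚ.≮⇒≥ 0≮φ))))
  = Fin.suc v , 0<φ

==-refl : ∀ {n} (u : Fin n) → u == u ≡ true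
==-refl u = dec-true (u Fin.≟ u) refl

==-≢ : ∀ {n} {u v : Fin n} → u ≢ v → u == v ≡ false
==-≢ {u = u} {v} u≢v = dec-false (u Fin.≟ v) u≢v

==-comm : ∀ {n} (u v : Fin n) → u == v ≡ v == u
==-comm u v with u Fin.≟ v
... | yes refl = sym (==-refl u)
... | no u≢v = sym (==-≢ (u≢v ∘ sym))

𝟙-nonneg : ∀ b → 0ℤ ≤ 𝟙 b
𝟙-nonneg true  = +≤+ z≤n
𝟙-nonneg false = +≤+ z≤n

𝟙-≤1 : ∀ b → 𝟙 b ≤ 1ℤ
𝟙-≤1 true  = ℤₚ.≤-refl
𝟙-≤1 false = +≤+ z≤n

𝟙-pos : ∀ b → 0ℤ < 𝟙 b → b ≡ true
𝟙-pos true _ = refl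
𝟙-pos false (+<+ ())

*-nonneg : ∀ {x y} → 0ℤ ≤ x → 0ℤ ≤ y → 0ℤ ≤ x * y
*-nonneg {+ x} {+ y} _ _ = subst (0ℤ ≤_) (ℤₚ.pos-* x y) (+≤+ z≤n)

*-pos : ∀ {x y} → 0ℤ < x → 0ℤ < y → 0ℤ < x * y
*-pos {+ suc x} {+ suc y} _ _ = +<+ (s≤s z≤n)
*-pos {+ zero} (+<+ ()) _
*-pos {+ suc x} {+ zero} _ (+<+ ())

*-posˡ : ∀ {x y} → 0ℤ ≤ x → 0ℤ ≤ y → 0ℤ < x * y → 0ℤ < x
*-posˡ {+ zero} {y} _ _ 0<0 = 0<0
*-posˡ {+ suc x} _ _ _ = +<+ (s≤s z≤n)

*-posʳ : ∀ {x y} → 0ℤ ≤ x → 0ℤ ≤ y → 0ℤ < x * y → 0ℤ < y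
*-posʳ {x} {y} p q r = *-posˡ q p (subst (0ℤ <_) (ℤₚ.*-comm x y) r)

≡⇒≤ : ∀ {x y : ℤ} → x ≡ y → x ≤ y
≡⇒≤ = ℤₚ.≤-reflexive

0≤y-x : ∀ {x y} → x ≤ y → 0ℤ ≤ y - x
0≤y-x = ℤₚ.i≤j⇒0≤j-i

∑-*ʳ : ∀ {n} c (φ : Fin n → ℤ) → ∑ (λ v → φ v * c) ≡ ∑ φ * c
∑-*ʳ c φ = trans (∑-cong (λ v → ℤₚ.*-comm (φ v) c)) (trans (∑-*ˡ c φ) (ℤₚ.*-comm c (∑ φ)))

∑-- : ∀ {n} (φ ψ : Fin n → ℤ) → ∑ (λ v → φ v - ψ v) ≡ ∑ φ - ∑ ψ
∑-- φ ψ = trans (∑-+ φ (λ v → - ψ v)) (cong (λ t → ∑ φ + t)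
  (trans (∑-cong (λ v → sym (ℤₚ.-1*i≡-i (ψ v)))) (trans (∑-*ˡ (- 1ℤ) ψ) (ℤₚ.-1*i≡-i (∑ ψ)))))

∑-nonneg : ∀ {n} {φ : Fin n → ℤ} → (∀ v → 0ℤ ≤ φ v) → 0ℤ ≤ ∑ φ
∑-nonneg {φ = φ} 0≤φ = subst (_≤ ∑ φ) (∑-zero {φ = λ _ → 0ℤ} (λ v → refl)) (∑-mono {φ = λ _ → 0ℤ} 0≤φ)

private
  hits : ∀ {k n} → (Fin k → Fin n) → Fin n → ℤ
  hits g v = ∑ (λ i → 𝟙 (v == g i))

  hits-image : ∀ {k n} (g : Fin k → Fin n) → Injective _≡_ _≡_ g → ∀ i → hits g (g i) ≡ 1ℤ
  hits-image g inj i = trans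
    (∑-cong (λ j → trans (cong 𝟙 (agree j)) (sym (ℤₚ.*-identityʳ _))))
    (∑-δ i (λ _ → 1ℤ))
    where
    agree : ∀ j → (g i == g j) ≡ (j == i)
    agree j with j Fin.≟ i
    ... | yes refl = ==-refl (g j)
    ... | no j≢i = ==-≢ (λ eq → j≢i (sym (inj eq)))

  ∑-hits : ∀ {k n} (g : Fin k → Fin n) (φ : Fin n → ℤ) → ∑ (φ ∘ g) ≡ ∑ (λ v → hits g v * φ v)
  ∑-hits g φ = trans (∑-cong (λ i → sym (∑-δ (g i) φ)))
    (trans (∑-swap (λ i v → 𝟙 (v == g i) * φ v)) (∑-cong (λ v → ∑-*ʳ (φ v) (λ i → 𝟙 (v == g i)))))

  hits-miss : ∀ {k n} (g : Fin k → Fin n) v → ¬ (∃ λ i → v ≡ g i) → hits g v ≡ 0ℤ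
  hits-miss g v miss = ∑-zero (λ i → cong 𝟙 (==-≢ (λ eq → miss (i , eq))))

-- Weighting each vertex by the number of its preimages turns the sum over indices into a sum over
-- vertices; injectivity makes this weight 1 on the image.
∑-image : ∀ {k n} (g : Fin k → Fin n) → Injective _≡_ _≡_ g → (φ : Fin n → ℤ) →
          (∀ v → ¬ (∃ λ i → v ≡ g i) → φ v ≡ 0ℤ) → ∑ φ ≡ ∑ (φ ∘ g)
∑-image g inj φ off = trans (∑-cong term) (sym (∑-hits g φ))
  where
  term : ∀ v → φ v ≡ hits g v * φ v
  term v with Finₚ.any? (λ i → v Fin.≟ g i)
  ... | yes (i , refl) = sym (trans (cong (_* φ (g i)) (hits-image g inj i)) (ℤₚ.*-identityˡ _))
  ... | no miss = trans (off v miss) (sym (trans (cong (hits g v *_) (off v miss)) (ℤₚ.*-zeroʳ (hits g v))))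

∑-image-≤ : ∀ {k n} (g : Fin k → Fin n) → Injective _≡_ _≡_ g → (φ : Fin n → ℤ) →
            (∀ v → 0ℤ ≤ φ v) → ∑ (φ ∘ g) ≤ ∑ φ
∑-image-≤ g inj φ 0≤φ = ℤₚ.≤-trans (≡⇒≤ (∑-hits g φ)) (∑-mono term)
  where
  term : ∀ v → hits g v * φ v ≤ φ v
  term v with Finₚ.any? (λ i → v Fin.≟ g i)
  ... | yes (i , refl) = ≡⇒≤ (trans (cong (_* φ (g i)) (hits-image g inj i)) (ℤₚ.*-identityˡ _))
  ... | no miss = ℤₚ.≤-trans (≡⇒≤ (cong (_* φ v) (hits-miss g v miss))) (0≤φ v)

≤-∑ : ∀ {n} (φ : Fin n → ℤ) → (∀ v → 0ℤ ≤ φ v) → ∀ v → φ v ≤ ∑ φ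
≤-∑ φ 0≤φ v = subst (_≤ ∑ φ) (trans (∑-∷ _) (trans (cong (_+_ (φ v)) (∑-[] _)) (ℤₚ.+-identityʳ _)))
  (∑-image-≤ {1} (λ _ → v) (λ { {Fin.zero} {Fin.zero} _ → refl }) φ 0≤φ)

∑-zero⁻ : ∀ {n} (φ : Fin n → ℤ) → (∀ v → 0ℤ ≤ φ v) → ∑ φ ≡ 0ℤ → ∀ v → φ v ≡ 0ℤ
∑-zero⁻ φ 0≤φ ∑≡0 v = ℤₚ.≤-antisym (subst (φ v ≤_) ∑≡0 (≤-∑ φ 0≤φ v)) (0≤φ v)

-- Sums over tuples of vertices

∑V : ∀ {n} r → (Vec (Fin n) r → ℤ) → ℤ
∑V zero    φ = φ []
∑V (suc r) φ = ∑ (λ u → ∑V r (λ y → φ (u ∷ y)))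

∑V-cong : ∀ {n} r {φ ψ : Vec (Fin n) r → ℤ} → (∀ y → φ y ≡ ψ y) → ∑V r φ ≡ ∑V r ψ
∑V-cong zero    eq = eq []
∑V-cong (suc r) eq = ∑-cong (λ u → ∑V-cong r (λ y → eq (u ∷ y)))

∑V-+ : ∀ {n} r (φ ψ : Vec (Fin n) r → ℤ) → ∑V r (λ y → φ y + ψ y) ≡ ∑V r φ + ∑V r ψ
∑V-+ zero    φ ψ = refl
∑V-+ (suc r) φ ψ = trans (∑-cong (λ u → ∑V-+ r _ _)) (∑-+ _ _)

∑V-*ˡ : ∀ {n} r c (φ : Vec (Fin n) r → ℤ) → ∑V r (λ y → c * φ y) ≡ c * ∑V r φ
∑V-*ˡ zero    c φ = refl
∑V-*ˡ (suc r) c φ = trans (∑-cong (λ u → ∑V-*ˡ r c _)) (∑-*ˡ c _)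

∑V-*ʳ : ∀ {n} r c (φ : Vec (Fin n) r → ℤ) → ∑V r (λ y → φ y * c) ≡ ∑V r φ * c
∑V-*ʳ r c φ = trans (∑V-cong r (λ y → ℤₚ.*-comm (φ y) c)) (trans (∑V-*ˡ r c φ) (ℤₚ.*-comm c (∑V r φ)))

∑V-zero : ∀ {n} r {φ : Vec (Fin n) r → ℤ} → (∀ y → φ y ≡ 0ℤ) → ∑V r φ ≡ 0ℤ
∑V-zero zero    eq = eq []
∑V-zero (suc r) eq = ∑-zero (λ u → ∑V-zero r (λ y → eq (u ∷ y)))

∑-∑V-swap : ∀ {m n} r (φ : Fin m → Vec (Fin n) r → ℤ) →
            ∑ (λ u → ∑V r (φ u)) ≡ ∑V r (λ y → ∑ (λ u → φ u y))
∑-∑V-swap zero    φ = refl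
∑-∑V-swap (suc r) φ = trans (∑-swap (λ u v → ∑V r (λ y → φ u (v ∷ y))))
  (∑-cong (λ v → ∑-∑V-swap r (λ u y → φ u (v ∷ y))))

∑V-swap : ∀ {m n} s r (φ : Vec (Fin m) s → Vec (Fin n) r → ℤ) →
          ∑V s (λ x → ∑V r (φ x)) ≡ ∑V r (λ y → ∑V s (λ x → φ x y))
∑V-swap zero    r φ = refl
∑V-swap (suc s) r φ = trans (∑-cong (λ u → ∑V-swap s r (λ x → φ (u ∷ x)))) (∑-∑V-swap r _)

_==ⱽ_ : ∀ {n r} → Vec (Fin n) r → Vec (Fin n) r → Bool
x ==ⱽ y = does (≡-dec Fin._≟_ x y)

𝟙-∧ : ∀ a b → 𝟙 (a ∧ b) ≡ 𝟙 a * 𝟙 b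
𝟙-∧ true  b = sym (ℤₚ.*-identityˡ _)
𝟙-∧ false b = refl

∑V-δ : ∀ {n} r (z : Vec (Fin n) r) (φ : Vec (Fin n) r → ℤ) → ∑V r (λ y → 𝟙 (y ==ⱽ z) * φ y) ≡ φ z
∑V-δ zero    []      φ = ℤₚ.*-identityˡ _
∑V-δ (suc r) (w ∷ z) φ = trans
  (∑-cong (λ u → trans (∑V-cong r (λ y → trans (cong (_* φ (u ∷ y)) (𝟙-∧ (u == w) (y ==ⱽ z)))
                                            (ℤₚ.*-assoc (𝟙 (u == w)) (𝟙 (y ==ⱽ z)) (φ (u ∷ y)))))
                (trans (∑V-*ˡ r (𝟙 (u == w)) _) (cong (𝟙 (u == w) *_) (∑V-δ r z (λ y → φ (u ∷ y)))))))
  (∑-δ w (λ u → φ (u ∷ z)))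

∑V-++ : ∀ {n} r s (φ : Vec (Fin n) (r ℕ.+ s) → ℤ) → ∑V (r ℕ.+ s) φ ≡ ∑V r (λ y → ∑V s (λ z → φ (y ++ z)))
∑V-++ zero    s φ = refl
∑V-++ (suc r) s φ = ∑-cong (λ u → ∑V-++ r s (λ y → φ (u ∷ y)))

-- Both sides equal the double sum over the pairs with y = `to x`, a condition that can also be read
-- as x = `from y`.
∑V-bijection : ∀ {m n} r (to : Vec (Fin m) r → Vec (Fin n) r) (from : Vec (Fin n) r → Vec (Fin m) r) →
               (∀ x → from (to x) ≡ x) → (∀ y → to (from y) ≡ y) →
               (φ : Vec (Fin n) r → ℤ) → ∑V r (φ ∘ to) ≡ ∑V r φ
∑V-bijection r to from ft tf φ = begin
  ∑V r (φ ∘ to)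
    ≡⟨ ∑V-cong r (λ x → sym (∑V-δ r (to x) φ)) ⟩
  ∑V r (λ x → ∑V r (λ y → 𝟙 (y ==ⱽ to x) * φ y))
    ≡⟨ ∑V-swap r r (λ x y → 𝟙 (y ==ⱽ to x) * φ y) ⟩
  ∑V r (λ y → ∑V r (λ x → 𝟙 (y ==ⱽ to x) * φ y))
    ≡⟨ ∑V-cong r (λ y → ∑V-cong r (λ x → cong (λ b → 𝟙 b * φ y) (agree x y))) ⟩
  ∑V r (λ y → ∑V r (λ x → 𝟙 (x ==ⱽ from y) * φ y))
    ≡⟨ ∑V-cong r (λ y → ∑V-δ r (from y) (λ _ → φ y)) ⟩
  ∑V r φ ∎
  where
  open ≡-Reasoning
  agree : ∀ x y → (y ==ⱽ to x) ≡ (x ==ⱽ from y)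
  agree x y with ≡-dec Fin._≟_ x (from y)
  ... | yes refl = dec-true (≡-dec Fin._≟_ y (to (from y))) (sym (tf y))
  ... | no x≢ = dec-false (≡-dec Fin._≟_ y (to x)) (λ { refl → x≢ (sym (ft x)) })

-- Sums determined by the deck

-- Expr k r: quantities attached to k vertices of a graph, computed from the
-- graph by looking at r further vertices at a time.
data Expr (k : ℕ) : ℕ → Set where
  cst      : ℤ → Expr k 0
  adjE eqE : Fin k → Fin k → Expr k 0
  _⊕_      : ∀ {r} → Expr k r → Expr k r → Expr k r
  _⊗_      : ∀ {r s} → Expr k r → Expr k s → Expr k (r ℕ.+ s)
  sumE     : ∀ {r} → Expr (suc k) r → Expr k (suc r)

infixl 6 _⊕_
infixl 7 _⊗_

eval : ∀ {n k r} → Graph n → Expr k r → Vec (Fin n) k → ℤ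
eval G (cst c) x    = c
eval G (adjE i j) x = 𝟙 (adj G (lookup x i) (lookup x j))
eval G (eqE i j) x  = 𝟙 (lookup x i == lookup x j)
eval G (e ⊕ e′) x   = eval G e x + eval G e′ x
eval G (e ⊗ e′) x   = eval G e x * eval G e′ x
eval G (sumE e) x   = ∑ (λ u → eval G e (u ∷ x))

private
  -- The summand once all sums are pulled to the front: an expression becomes one sum over r-tuples,
  -- the form in which the deck can be applied.
  flat : ∀ {n k r} → Graph n → Expr k r → Vec (Fin n) k → Vec (Fin n) r → ℤ
  flat G (cst c) x y         = c
  flat G (adjE i j) x y      = 𝟙 (adj G (lookup x i) (lookup x j))
  flat G (eqE i j) x y       = 𝟙 (lookup x i == lookup x j)
  flat G (e ⊕ e′) x y        = flat G e x y + flat G e′ x y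
  flat G (_⊗_ {r} e e′) x y  = flat G e x (take r y) * flat G e′ x (drop r y)
  flat G (sumE e) x (u ∷ y)  = flat G e (u ∷ x) y

  take-++ : ∀ {A : Set} r {s} (y : Vec A r) (z : Vec A s) → take r (y ++ z) ≡ y
  take-++ zero    []      z = refl
  take-++ (suc r) (u ∷ y) z = cong (u ∷_) (take-++ r y z)

  drop-++ : ∀ {A : Set} r {s} (y : Vec A r) (z : Vec A s) → drop r (y ++ z) ≡ z
  drop-++ zero    []      z = refl
  drop-++ (suc r) (u ∷ y) z = drop-++ r y z

  eval-flat : ∀ {n k r} (G : Graph n) (e : Expr k r) x → eval G e x ≡ ∑V r (flat G e x)
  eval-flat G (cst c) x    = refl
  eval-flat G (adjE i j) x = refl
  eval-flat G (eqE i j) x  = refl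
  eval-flat G (_⊕_ {r} e e′) x = trans (cong₂ _+_ (eval-flat G e x) (eval-flat G e′ x))
    (sym (∑V-+ r (flat G e x) (flat G e′ x)))
  eval-flat G (_⊗_ {r} {s} e e′) x = sym (begin
    ∑V (r ℕ.+ s) (λ y → flat G e x (take r y) * flat G e′ x (drop r y))
      ≡⟨ ∑V-++ r s _ ⟩
    ∑V r (λ y → ∑V s (λ z → flat G e x (take r (y ++ z)) * flat G e′ x (drop r (y ++ z))))
      ≡⟨ ∑V-cong r (λ y → ∑V-cong s (λ z → cong₂ (λ a b → flat G e x a * flat G e′ x b) (take-++ r y z) (drop-++ r y z))) ⟩
    ∑V r (λ y → ∑V s (λ z → flat G e x y * flat G e′ x z))
      ≡⟨ ∑V-cong r (λ y → ∑V-*ˡ s (flat G e x y) (flat G e′ x)) ⟩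
    ∑V r (λ y → flat G e x y * ∑V s (flat G e′ x))
      ≡⟨ ∑V-*ʳ r (∑V s (flat G e′ x)) (flat G e x) ⟩
    ∑V r (flat G e x) * ∑V s (flat G e′ x)
      ≡⟨ cong₂ _*_ (eval-flat G e x) (eval-flat G e′ x) ⟨
    eval G e x * eval G e′ x ∎)
    where open ≡-Reasoning
  eval-flat G (sumE e) x = ∑-cong (λ u → eval-flat G e (u ∷ x))

-- A relation rather than a map, because an isomorphism of cards acts only on the members of one
-- card. Membership proofs thus stay out of the statements about tuples.
record PartialIso {m n} (H : Graph m) (G : Graph n) (R : Fin m → Fin n → Set) : Set where
  field
    adj-≡ : ∀ {u v u′ v′} → R u u′ → R v v′ → adj H u v ≡ adj G u′ v′
    func  : ∀ {u u′ v′} → R u u′ → R u v′ → u′ ≡ v′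
    inj   : ∀ {u v u′} → R u u′ → R v u′ → u ≡ v

data Pw {A B : Set} (R : A → B → Set) : ∀ {r} → Vec A r → Vec B r → Set where
  []  : Pw R [] []
  _∷_ : ∀ {r a b} {x : Vec A r} {y : Vec B r} → R a b → Pw R x y → Pw R (a ∷ x) (b ∷ y)

module _ {A B : Set} {R : A → B → Set} where
  Pw-lookup : ∀ {r} {x : Vec A r} {y : Vec B r} → Pw R x y → ∀ i → R (lookup x i) (lookup y i)
  Pw-lookup (p ∷ ps) Fin.zero    = p
  Pw-lookup (p ∷ ps) (Fin.suc i) = Pw-lookup ps i

  Pw-take : ∀ r {s} {x : Vec A (r ℕ.+ s)} {y : Vec B (r ℕ.+ s)} → Pw R x y → Pw R (take r x) (take r y)
  Pw-take zero    ps       = []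
  Pw-take (suc r) (p ∷ ps) = p ∷ Pw-take r ps

  Pw-drop : ∀ r {s} {x : Vec A (r ℕ.+ s)} {y : Vec B (r ℕ.+ s)} → Pw R x y → Pw R (drop r x) (drop r y)
  Pw-drop zero    ps       = ps
  Pw-drop (suc r) (p ∷ ps) = Pw-drop r ps

==-invariant : ∀ {m n} {H : Graph m} {G : Graph n} {R} → PartialIso H G R →
               ∀ {u v u′ v′} → R u u′ → R v v′ → (u == v) ≡ (u′ == v′)
==-invariant iso {u} {v} {u′} {v′} ru rv with u Fin.≟ v
... | yes refl = sym (dec-true (u′ Fin.≟ v′) (PartialIso.func iso ru rv))
... | no u≢v = sym (==-≢ {u = u′} {v′} λ { refl → u≢v (PartialIso.inj iso ru rv) })

private
  flat-invariant : ∀ {m n} {H : Graph m} {G : Graph n} {R} → PartialIso H G R →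
                   ∀ {k r} (e : Expr k r) {x x′ y y′} → Pw R x x′ → Pw R y y′ → flat H e x y ≡ flat G e x′ y′
  flat-invariant iso (cst c) px py = refl
  flat-invariant iso (adjE i j) px py = cong 𝟙 (PartialIso.adj-≡ iso (Pw-lookup px i) (Pw-lookup px j))
  flat-invariant iso (eqE i j) px py = cong 𝟙 (==-invariant iso (Pw-lookup px i) (Pw-lookup px j))
  flat-invariant iso (e ⊕ e′) px py = cong₂ _+_ (flat-invariant iso e px py) (flat-invariant iso e′ px py)
  flat-invariant iso (_⊗_ {r} e e′) px py =
    cong₂ _*_ (flat-invariant iso e px (Pw-take r py)) (flat-invariant iso e′ px (Pw-drop r py))
  flat-invariant iso (sumE e) px (p ∷ py) = flat-invariant iso e (p ∷ px) py

-- Transfer of tuple sums along the bijection of cards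

private
  imageˢ : ∀ {n r} → Vec (Fin n) r → Subset n
  imageˢ []      = Subset.⊥
  imageˢ (u ∷ x) = ⁅ u ⁆ ∪ imageˢ x

  ∣∪∣≤ : ∀ {n} (p q : Subset n) → ∣ p ∪ q ∣ ℕ.≤ ∣ p ∣ ℕ.+ ∣ q ∣
  ∣∪∣≤ [] [] = z≤n
  ∣∪∣≤ (inside  ∷ p) (inside  ∷ q) = s≤s (ℕₚ.≤-trans (∣∪∣≤ p q) (ℕₚ.+-monoʳ-≤ ∣ p ∣ (ℕₚ.n≤1+n ∣ q ∣)))
  ∣∪∣≤ (inside  ∷ p) (outside ∷ q) = s≤s (∣∪∣≤ p q)
  ∣∪∣≤ (outside ∷ p) (inside  ∷ q) = subst (suc ∣ p ∪ q ∣ ℕ.≤_) (sym (ℕₚ.+-suc ∣ p ∣ ∣ q ∣)) (s≤s (∣∪∣≤ p q))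
  ∣∪∣≤ (outside ∷ p) (outside ∷ q) = ∣∪∣≤ p q

  ∣imageˢ∣≤ : ∀ {n r} (x : Vec (Fin n) r) → ∣ imageˢ x ∣ ℕ.≤ r
  ∣imageˢ∣≤ {n} [] = ℕₚ.≤-reflexive (Subsetₚ.∣⊥∣≡0 n)
  ∣imageˢ∣≤ (u ∷ x) = ℕₚ.≤-trans (∣∪∣≤ ⁅ u ⁆ (imageˢ x)) (subst (λ t → t ℕ.+ _ ℕ.≤ _) (sym (Subsetₚ.∣⁅x⁆∣≡1 u)) (s≤s (∣imageˢ∣≤ x)))

  ∈imageˢ : ∀ {n r} (x : Vec (Fin n) r) i → lookup x i ∈ˢ imageˢ x
  ∈imageˢ (u ∷ x) Fin.zero    = Subsetₚ.x∈p∪q⁺ (inj₁ (Subsetₚ.x∈⁅x⁆ u))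
  ∈imageˢ (u ∷ x) (Fin.suc i) = Subsetₚ.x∈p∪q⁺ (inj₂ (∈imageˢ x i))

  imageˢ⁻ : ∀ {n r} (x : Vec (Fin n) r) {v} → v ∈ˢ imageˢ x → ∃ λ i → lookup x i ≡ v
  imageˢ⁻ [] v∈ = contradiction v∈ Subsetₚ.∉⊥
  imageˢ⁻ (u ∷ x) v∈ with Subsetₚ.x∈p∪q⁻ ⁅ u ⁆ (imageˢ x) v∈
  ... | inj₁ v∈u = Fin.zero , sym (Subsetₚ.x∈⁅y⁆⇒x≡y u v∈u)
  ... | inj₂ v∈x with i , eq ← imageˢ⁻ x v∈x = Fin.suc i , eq

  Covers : ∀ {n r} → Vec (Fin n) r → Subset n → Set
  Covers x S = (∀ i → lookup x i ∈ˢ S) × (∀ {v} → v ∈ˢ S → ∃ λ i → lookup x i ≡ v)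

  Covers-unique : ∀ {n r} (x : Vec (Fin n) r) {S T} → Covers x S → Covers x T → S ≡ T
  Covers-unique x {S} {T} (p , q) (p′ , q′) = Subsetₚ.⊆-antisym
    (λ {v} v∈S → subst (_∈ˢ T) (proj₂ (q v∈S)) (p′ (proj₁ (q v∈S))))
    (λ {v} v∈T → subst (_∈ˢ S) (proj₂ (q′ v∈T)) (p (proj₁ (q′ v∈T))))

  Card-≡ : ∀ {n} {c d : Card n} → proj₁ c ≡ proj₁ d → c ≡ d
  Card-≡ {c = S , p} {.S , q} refl = cong (S ,_) (ℕₚ.≤-irrelevant p q)

  Elem-≡ : ∀ {n} {S : Subset n} {a b : Elem S} → proj₁ a ≡ proj₁ b → a ≡ b
  Elem-≡ {a = u , p} {.u , q} refl = cong (u ,_) ([]=-irrelevant p q)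

module Deck {m n : ℕ} (H : Graph m) (G : Graph n) (same : SameDeck H G) where
  private
    σ : Card m → Card n
    σ = Inverse.to (proj₁ same)

    σ⁻ : Card n → Card m
    σ⁻ = Inverse.from (proj₁ same)

    to : ∀ c → Elem (proj₁ c) → Elem (proj₁ (σ c))
    to c = Inverse.to (proj₁ (proj₂ same c))

    from : ∀ c → Elem (proj₁ (σ c)) → Elem (proj₁ c)
    from c = Inverse.from (proj₁ (proj₂ same c))

    to-from : ∀ c b → to c (from c b) ≡ b
    to-from c b = Inverse.strictlyInverseˡ (proj₁ (proj₂ same c)) b

    from-to : ∀ c a → from c (to c a) ≡ a
    from-to c a = Inverse.strictlyInverseʳ (proj₁ (proj₂ same c)) a

  R : Card m → Fin m → Fin n → Set
  R c u u′ = Σ (u ∈ˢ proj₁ c) λ u∈ → proj₁ (to c (u , u∈)) ≡ u′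

  R-iso : ∀ c → PartialIso H G (R c)
  R-iso c = record
    { adj-≡ = λ { {u} {v} (u∈ , refl) (v∈ , refl) → proj₂ (proj₂ same c) (u , u∈) (v , v∈) }
    ; func  = λ { {u} (u∈ , refl) (u∈′ , refl) → cong (λ p → proj₁ (to c (u , p))) ([]=-irrelevant u∈ u∈′) }
    ; inj   = λ { {u} {v} (u∈ , refl) (v∈ , eq) → cong proj₁ (trans (sym (from-to c (u , u∈)))
                  (trans (cong (from c) (Elem-≡ (sym eq))) (from-to c (v , v∈)))) }
    }

  R-total : ∀ c {u} → u ∈ˢ proj₁ c → ∃ λ u′ → R c u u′
  R-total c u∈ = _ , u∈ , refl

  R-image : ∀ c {u u′} → R c u u′ → u′ ∈ˢ proj₁ (σ c)
  R-image c (u∈ , refl) = proj₂ (to c (_ , u∈))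

  R-onto : ∀ c {u′} → u′ ∈ˢ proj₁ (σ c) → ∃ λ u → R c u u′
  R-onto c u′∈ = proj₁ (from c (_ , u′∈)) , proj₂ (from c (_ , u′∈)) , cong proj₁ (to-from c (_ , u′∈))

  private
    -- The card has to consist of exactly the entries of the tuple, so either tuple determines it.
    -- This makes the relation a bijection although the isomorphisms chosen on different cards are
    -- unrelated.
    Matched : ∀ {r} → Vec (Fin m) r → Vec (Fin n) r → Set
    Matched x y = Σ (Card m) λ c → Covers x (proj₁ c) × Pw (R c) x y

    map-R : ∀ c {r} (x : Vec (Fin m) r) → (∀ i → lookup x i ∈ˢ proj₁ c) → ∃ λ y → Pw (R c) x y
    map-R c [] _ = [] , []
    map-R c (u ∷ x) x∈ with y , ps ← map-R c x (x∈ ∘ Fin.suc) = _ , proj₂ (R-total c (x∈ Fin.zero)) ∷ ps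

    comap-R : ∀ c {r} (y : Vec (Fin n) r) → (∀ i → lookup y i ∈ˢ proj₁ (σ c)) → ∃ λ x → Pw (R c) x y
    comap-R c [] _ = [] , []
    comap-R c (u ∷ y) y∈ with x , ps ← comap-R c y (y∈ ∘ Fin.suc) = _ , proj₂ (R-onto c (y∈ Fin.zero)) ∷ ps

    Pw-func : ∀ {R : Fin m → Fin n → Set} → PartialIso H G R → ∀ {r} {x : Vec (Fin m) r} {y y′} → Pw R x y → Pw R x y′ → y ≡ y′
    Pw-func iso [] [] = refl
    Pw-func iso (p ∷ ps) (q ∷ qs) = cong₂ _∷_ (PartialIso.func iso p q) (Pw-func iso ps qs)

    Pw-inj : ∀ {R : Fin m → Fin n → Set} → PartialIso H G R → ∀ {r} {x x′ : Vec (Fin m) r} {y} → Pw R x y → Pw R x′ y → x ≡ x′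
    Pw-inj iso [] [] = refl
    Pw-inj iso (p ∷ ps) (q ∷ qs) = cong₂ _∷_ (PartialIso.inj iso p q) (Pw-inj iso ps qs)

    covers-σ : ∀ c {r} {x : Vec (Fin m) r} {y} → Covers x (proj₁ c) → Pw (R c) x y → Covers y (proj₁ (σ c))
    covers-σ c {x = x} {y} (x∈ , ∈x) ps = (λ i → R-image c (Pw-lookup ps i)) , onto
      where
      onto : ∀ {v} → v ∈ˢ proj₁ (σ c) → ∃ λ i → lookup y i ≡ v
      onto v∈ with u , ruv@(u∈ , _) ← R-onto c v∈ with i , refl ← ∈x u∈ =
        i , PartialIso.func (R-iso c) (Pw-lookup ps i) ruv

    covers-σ⁻ : ∀ c {r} {x : Vec (Fin m) r} {y} → Covers y (proj₁ (σ c)) → Pw (R c) x y → Covers x (proj₁ c)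
    covers-σ⁻ c {x = x} {y} (y∈ , ∈y) ps = (λ i → proj₁ (Pw-lookup ps i)) , onto
      where
      onto : ∀ {v} → v ∈ˢ proj₁ c → ∃ λ i → lookup x i ≡ v
      onto v∈ with v′ , rvv ← R-total c v∈ with i , refl ← ∈y (R-image c rvv) =
        i , PartialIso.inj (R-iso c) (Pw-lookup ps i) rvv

    Matched-func : ∀ {r} {x : Vec (Fin m) r} {y y′} → Matched x y → Matched x y′ → y ≡ y′
    Matched-func {x = x} (c , cov , ps) (c′ , cov′ , ps′) with refl ← Card-≡ {c = c} {c′} (Covers-unique x cov cov′) =
      Pw-func (R-iso c) ps ps′

    Matched-inj : ∀ {r} {x x′ : Vec (Fin m) r} {y} → Matched x y → Matched x′ y → x ≡ x′
    Matched-inj {y = y} (c , cov , ps) (c′ , cov′ , ps′)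
      with refl ← trans (sym (Inverse.strictlyInverseʳ (proj₁ same) c))
                  (trans (cong σ⁻ (Card-≡ {c = σ c} {σ c′} (Covers-unique y (covers-σ c cov ps) (covers-σ c′ cov′ ps′))))
                         (Inverse.strictlyInverseʳ (proj₁ same) c′)) =
      Pw-inj (R-iso c) ps ps′

  module _ {r : ℕ} (r≤m : r ℕ.* 2 ℕ.≤ m ℕ.+ 2) (r≤n : r ℕ.* 2 ℕ.≤ n ℕ.+ 2) where
    private
      Matched-total : (x : Vec (Fin m) r) → ∃ λ y → Matched x y
      Matched-total x = let y , ps = map-R c x (∈imageˢ x) in y , c , (∈imageˢ x , imageˢ⁻ x) , ps
        where
        c : Card m
        c = imageˢ x , ℕₚ.≤-trans (ℕₚ.*-monoˡ-≤ 2 (∣imageˢ∣≤ x)) r≤m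

      Matched-onto : (y : Vec (Fin n) r) → ∃ λ x → Matched x y
      Matched-onto y = onto (σ⁻ d) (Inverse.strictlyInverseˡ (proj₁ same) d)
        where
        d : Card n
        d = imageˢ y , ℕₚ.≤-trans (ℕₚ.*-monoˡ-≤ 2 (∣imageˢ∣≤ y)) r≤n
        onto : ∀ c → σ c ≡ d → ∃ λ x → Matched x y
        onto c eq with cov ← subst (Covers y) (cong proj₁ (sym eq)) (∈imageˢ y , imageˢ⁻ y)
          with x , ps ← comap-R c y (proj₁ cov) = x , c , covers-σ⁻ c cov ps , ps

    -- Repeated entries do no harm: the entries of an r-tuple form a set of at most r vertices,
    -- which is still a card.
    tupleTransfer : (φ : Vec (Fin m) r → ℤ) (ψ : Vec (Fin n) r → ℤ) →
                    (∀ {R x y} → PartialIso H G R → Pw R x y → φ x ≡ ψ y) → ∑V r φ ≡ ∑V r ψ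
    tupleTransfer φ ψ inv = trans
      (∑V-cong r (λ x → let c , _ , ps = proj₂ (Matched-total x) in inv (R-iso c) ps))
      (∑V-bijection r (proj₁ ∘ Matched-total) (proj₁ ∘ Matched-onto)
        (λ x → Matched-inj (proj₂ (Matched-onto _)) (proj₂ (Matched-total x)))
        (λ y → Matched-func (proj₂ (Matched-total _)) (proj₂ (Matched-onto y))) ψ)

    transfer : (e : Expr 0 r) → eval H e [] ≡ eval G e []
    transfer e = trans (eval-flat H e []) (trans
      (tupleTransfer (flat H e []) (flat G e []) (λ iso ps → flat-invariant iso e [] ps))
      (sym (eval-flat G e [])))

  -- A single vertex fits on a card of any graph, so the vertices can be counted before the two
  -- orders are known to agree.
  sameOrder : m ≡ n
  sameOrder = ℤₚ.+-injective (trans (sym (∑-1 m)) (trans (transfer (s≤s-2 m) (s≤s-2 n) (sumE (cst 1ℤ))) (∑-1 n)))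
    where
    s≤s-2 : ∀ k → 2 ℕ.≤ k ℕ.+ 2
    s≤s-2 k = ℕₚ.m≤n+m 2 k
    ∑-1 : ∀ k → ∑ {k} (λ _ → 1ℤ) ≡ + k
    ∑-1 zero = ∑-[] _
    ∑-1 (suc k) = trans (∑-∷ _) (cong (λ t → 1ℤ + t) (∑-1 k))

-- Degrees, leaf detectors and weighted walk counts

+sum-tabulate : ∀ {n} (g : Fin n → ℕ) → + sumᴸ (List.tabulate g) ≡ ∑ (λ i → + g i)
+sum-tabulate {zero}  g = sym (∑-[] _)
+sum-tabulate {suc n} g = trans (cong (λ t → + g Fin.zero + t) (+sum-tabulate (g ∘ Fin.suc))) (sym (∑-∷ _))

away : ∀ {n} → Fin n → Fin n → ℤ
away v u = 1ℤ - 𝟙 (u == v)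

away-nonneg : ∀ {n} (v u : Fin n) → 0ℤ ≤ away v u
away-nonneg v u = 0≤y-x (𝟙-≤1 (u == v))

away-≢ : ∀ {n} {v u : Fin n} → u ≢ v → away v u ≡ 1ℤ
away-≢ u≢v = cong (λ b → 1ℤ - 𝟙 b) (==-≢ u≢v)

away-refl : ∀ {n} (v : Fin n) → away v v ≡ 0ℤ
away-refl v = cong (λ b → 1ℤ - 𝟙 b) (==-refl v)

away-pos : ∀ {n} {v u : Fin n} → 0ℤ < away v u → u ≢ v
away-pos {v = v} p refl = contradiction (subst (0ℤ <_) (away-refl v) p) λ { (+<+ ()) }

-- falling m x = (1 - x)(2 - x)⋯(m - x); it vanishes for x = 1, …, m and is
-- positive for x ≤ 0, so it detects 0 among 0, …, m.
falling : ℕ → ℤ → ℤ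
falling zero    x = 1ℤ
falling (suc m) x = (+ suc m - x) * falling m x

falling-zero : ∀ m k → k ℕ.< m → falling m (+ suc k) ≡ 0ℤ
falling-zero (suc m) k (s≤s k≤m) with ℕₚ.m≤n⇒m<n∨m≡n k≤m
... | inj₁ k<m = trans (cong (λ t → (+ suc m - + suc k) * t) (falling-zero m k k<m)) (ℤₚ.*-zeroʳ (+ suc m - + suc k))
... | inj₂ refl = cong (_* falling m (+ suc m)) (ℤₚ.+-inverseʳ (+ suc m))

falling-pos : ∀ m {x} → x ≤ 0ℤ → 0ℤ < falling m x
falling-pos zero    _ = +<+ (s≤s z≤n)
falling-pos (suc m) {x} x≤0 = *-pos (ℤₚ.<-≤-trans (+<+ (s≤s z≤n)) m+1≤) (falling-pos m x≤0)
  where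
  m+1≤ : + suc m ≤ + suc m - x
  m+1≤ = subst (_≤ + suc m - x) (ℤₚ.+-identityʳ (+ suc m)) (ℤₚ.+-monoʳ-≤ (+ suc m) (ℤₚ.neg-mono-≤ x≤0))

falling-nonneg : ∀ m {x} → x ≤ + m → 0ℤ ≤ falling m x
falling-nonneg m {+ zero}    _ = ℤₚ.<⇒≤ (falling-pos m ℤₚ.≤-refl)
falling-nonneg m {+ suc k}   (+≤+ k<m) = ≡⇒≤ (sym (falling-zero m k k<m))
falling-nonneg m { -[1+ k ]} _ = ℤₚ.<⇒≤ (falling-pos m ℤ.-≤+)

-- `_⊕_` wants equally many vertices on both sides, so the constant of each factor is written under
-- the sum, on a vertex forced to equal vertex i. Each factor costs one vertex.
polyE : ∀ {k} m → Fin k → Expr (suc k) 0 → Expr k m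
polyE zero    i b = cst 1ℤ
polyE (suc m) i b = sumE (cst (+ suc m) ⊗ eqE Fin.zero (Fin.suc i) ⊕ cst (- 1ℤ) ⊗ b) ⊗ polyE m i b

eval-polyE : ∀ {n k} (G : Graph n) m i (b : Expr (suc k) 0) x →
             eval G (polyE m i b) x ≡ falling m (∑ (λ u → eval G b (u ∷ x)))
eval-polyE G zero    i b x = refl
eval-polyE G (suc m) i b x = cong₂ _*_ linear (eval-polyE G m i b x)
  where
  c = + suc m
  v = lookup x i
  β = λ u → eval G b (u ∷ x)
  linear : ∑ (λ u → c * 𝟙 (u == v) + - 1ℤ * β u) ≡ c - ∑ β
  linear = begin
    ∑ (λ u → c * 𝟙 (u == v) + - 1ℤ * β u)
      ≡⟨ ∑-+ _ _ ⟩
    ∑ (λ u → c * 𝟙 (u == v)) + ∑ (λ u → - 1ℤ * β u)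
      ≡⟨ cong₂ _+_ (trans (∑-cong (λ u → ℤₚ.*-comm c (𝟙 (u == v)))) (∑-δ v (λ _ → c)))
                   (trans (∑-*ˡ (- 1ℤ) β) (ℤₚ.-1*i≡-i (∑ β))) ⟩
    c - ∑ β ∎
    where open ≡-Reasoning

isNonLeaf : ∀ {n} → Graph n → Fin n → Bool
isNonLeaf G v = does (2 ℕ.≤? deg G v)

-- The exponent list ks, e stands for weights on a walk: the i-th vertex is
-- weighted by (deg - 1) ^ kᵢ, the last one by (deg - 1) ^ suc e.
rank : List ℕ → ℕ → ℕ
rank []       e = suc e
rank (k ∷ ks) e = k ℕ.+ suc (rank ks e)

module _ {n : ℕ} (G : Graph n) where
  dg f nl : Fin n → ℤ
  dg v = ∑ (λ u → 𝟙 (adj G v u))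
  f v  = dg v - 1ℤ
  nl v = 𝟙 (isNonLeaf G v)

  others : Fin n → Fin n → ℤ
  others v w = ∑ (λ u → 𝟙 (adj G v u) * away w u)

  -- Nonbacktracking walks continuing v, w, with the weights given by ks, e
  -- on w and its successors.
  ext : List ℕ → ℕ → Fin n → Fin n → ℤ
  ext []       e v w = f w ^ suc e
  ext (k ∷ ks) e v w = f w ^ k * ∑ (λ u → 𝟙 (adj G w u) * (away v u * ext ks e w u))

  -- `f v ^ k` does not exclude leaves when k = 0, and the two ends of the spine are found with k =
  -- 0; hence the factor `nl v`, paid for with F vertices.
  walks : ℕ → List ℕ → ℕ → ℤ
  walks k ks e = ∑ (λ v → ∑ (λ w → 𝟙 (adj G v w) * (f v ^ k * (nl v * ext ks e v w))))

  -- The factor `f v` vanishes at leaves by itself, so no detector is spent here.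
  correlation : List ℕ → ℤ
  correlation ks = ∑ (λ v → ∑ (λ w → 𝟙 (adj G v w) * (f v * ext ks 0 v w)))

  deg≡dg : ∀ v → + deg G v ≡ dg v
  deg≡dg v = trans (cong (λ l → + sumᴸ l) (Listₚ.map-tabulate id (λ j → if adj G v j then 1 else 0)))
    (trans (+sum-tabulate _) (∑-cong (λ u → lemma (adj G v u))))
    where
    lemma : ∀ b → + (if b then 1 else 0) ≡ 𝟙 b
    lemma true  = refl
    lemma false = refl

  f≡ : ∀ v → f v ≡ + deg G v - 1ℤ
  f≡ v = cong (_- 1ℤ) (sym (deg≡dg v))

  others-adj : ∀ {v w} → adj G v w ≡ true → others v w ≡ f v
  others-adj {v} {w} vw = begin
    ∑ (λ u → 𝟙 (adj G v u) * (1ℤ - 𝟙 (u == w)))  ≡⟨ ∑-cong (λ u → expand (𝟙 (adj G v u)) (𝟙 (u == w))) ⟩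
    ∑ (λ u → 𝟙 (adj G v u) - 𝟙 (u == w) * 𝟙 (adj G v u)) ≡⟨ ∑-- _ _ ⟩
    dg v - ∑ (λ u → 𝟙 (u == w) * 𝟙 (adj G v u)) ≡⟨ cong (λ t → dg v - t) (trans (∑-δ w (λ u → 𝟙 (adj G v u))) (cong 𝟙 vw)) ⟩
    f v ∎
    where
    open ≡-Reasoning
    expand : ∀ a b → a * (1ℤ - b) ≡ a - b * a
    expand = solve-∀

-- The summand -1 is placed where the summation vertex is vertex i itself, so that deg - 1 costs one
-- vertex and not two.
fE : ∀ {k} → Fin k → Expr k 1
fE i = sumE (adjE (Fin.suc i) Fin.zero ⊕ cst (- 1ℤ) ⊗ eqE Fin.zero (Fin.suc i))

powE : ∀ {k} m → Fin k → Expr k m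
powE zero    i = cst 1ℤ
powE (suc m) i = fE i ⊗ powE m i

awayE : ∀ {k} → Fin k → Fin k → Expr k 0
awayE i j = cst 1ℤ ⊕ cst (- 1ℤ) ⊗ eqE j i

extE : ∀ {k} ks e → Fin k → Fin k → Expr k (rank ks e)
extE []       e i j = powE (suc e) j
extE (k ∷ ks) e i j = powE k j ⊗ sumE (adjE (Fin.suc j) Fin.zero ⊗ (awayE (Fin.suc i) Fin.zero ⊗ extE ks e (Fin.suc j) Fin.zero))

-- On adjacent vertices, the first of degree at most m + 1: falling m 0 if that vertex is a leaf,
-- 0 otherwise.
leafE : ∀ {k} m → Fin k → Fin k → Expr k m
leafE m i j = polyE m i (adjE (Fin.suc i) Fin.zero ⊗ awayE (Fin.suc j) Fin.zero)

-- `polyE m i (cst 0ℤ)` is the constant `falling m 0ℤ` spread over m vertices, as the subtraction of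
-- `leafE` requires.
nonLeafE : ∀ {k} m → Fin k → Fin k → Expr k m
nonLeafE m i j = polyE m i (cst 0ℤ) ⊕ cst (- 1ℤ) ⊗ leafE m i j

#0 : ∀ {k} → Fin (suc k)
#0 = Fin.zero

#1 : ∀ {k} → Fin (suc (suc k))
#1 = Fin.suc #0

walksE : ∀ m k ks e → Expr 0 (suc (suc (k ℕ.+ (m ℕ.+ rank ks e))))
walksE m k ks e = sumE (sumE (adjE #1 #0 ⊗ (powE k #1 ⊗ (nonLeafE m #1 #0 ⊗ extE ks e #1 #0))))

correlationE : ∀ ks → Expr 0 (suc (suc (suc (rank ks 0))))
correlationE ks = sumE (sumE (adjE #1 #0 ⊗ (fE #1 ⊗ extE ks 0 #1 #0)))

record DegreesWithin (F : ℕ) {n} (G : Graph n) : Set where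
  field
    deg≥1 : ∀ v → 1 ℕ.≤ deg G v
    deg≤  : ∀ v → deg G v ℕ.≤ suc F

module _ {n : ℕ} (G : Graph n) where
  eval-fE : ∀ {k} (i : Fin k) x → eval G (fE i) x ≡ f G (lookup x i)
  eval-fE i x = trans (∑-+ _ _) (cong (_+_ (dg G v)) (trans (∑-*ˡ (- 1ℤ) (λ u → 𝟙 (u == v)))
    (cong (- 1ℤ *_) (trans (∑-cong (λ u → sym (ℤₚ.*-identityʳ (𝟙 (u == v))))) (∑-δ v (λ _ → 1ℤ))))))
    where v = lookup x i

  eval-powE : ∀ {k} m (i : Fin k) x → eval G (powE m i) x ≡ f G (lookup x i) ^ m
  eval-powE zero    i x = refl
  eval-powE (suc m) i x = cong₂ _*_ (eval-fE i x) (eval-powE m i x)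

  eval-awayE : ∀ {k} (i j : Fin k) x → eval G (awayE i j) x ≡ away (lookup x i) (lookup x j)
  eval-awayE i j x = cong (_+_ 1ℤ) (ℤₚ.-1*i≡-i (𝟙 (lookup x j == lookup x i)))

  eval-extE : ∀ {k} ks e (i j : Fin k) x → eval G (extE ks e i j) x ≡ ext G ks e (lookup x i) (lookup x j)
  eval-extE []       e i j x = eval-powE (suc e) j x
  eval-extE (k ∷ ks) e i j x = cong₂ _*_ (eval-powE k j x) (∑-cong (λ u → cong (𝟙 (adj G (lookup x j) u) *_)
    (cong₂ _*_ (eval-awayE (Fin.suc i) Fin.zero (u ∷ x)) (eval-extE ks e (Fin.suc j) Fin.zero (u ∷ x)))))

  eval-leafE : ∀ {k} m (i j : Fin k) x → eval G (leafE m i j) x ≡ falling m (others G (lookup x i) (lookup x j))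
  eval-leafE m i j x = trans (eval-polyE G m i _ x) (cong (falling m) (∑-cong (λ u →
    cong (𝟙 (adj G (lookup x i) u) *_) (eval-awayE (Fin.suc j) Fin.zero (u ∷ x)))))

  eval-correlationE : ∀ ks → eval G (correlationE ks) [] ≡ correlation G ks
  eval-correlationE ks = ∑-cong (λ v → ∑-cong (λ w → cong (𝟙 (adj G v w) *_)
    (cong₂ _*_ (eval-fE #1 (w ∷ v ∷ [])) (eval-extE ks 0 #1 #0 (w ∷ v ∷ [])))))

  module _ {F : ℕ} (within : DegreesWithin F G) where
    open DegreesWithin within

    f-ℕ : ∀ v → ∃ λ d → (deg G v ≡ suc d) × (d ℕ.≤ F) × (f G v ≡ + d)
    f-ℕ v with deg G v in eq | deg≥1 v | deg≤ v
    ... | suc d | _ | s≤s d≤F = d , refl , d≤F , trans (f≡ G v) (cong (λ t → + t - 1ℤ) eq)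

    f-nonneg : ∀ v → 0ℤ ≤ f G v
    f-nonneg v with d , _ , _ , eq ← f-ℕ v = subst (0ℤ ≤_) (sym eq) (+≤+ z≤n)

    f≤F : ∀ v → f G v ≤ + F
    f≤F v with d , _ , d≤F , eq ← f-ℕ v = subst (_≤ + F) (sym eq) (+≤+ d≤F)

    f-leaf : ∀ {v} → nl G v ≡ 0ℤ → f G v ≡ 0ℤ
    f-leaf {v} leaf with deg G v in deg-eq | f-ℕ v
    f-leaf {v} () | _ | suc d , refl , _ , _
    ... | _ | zero , refl , _ , eq = eq

    falling-f : ∀ v → falling F (f G v) ≡ falling F 0ℤ * (1ℤ - nl G v)
    falling-f v with f-ℕ v
    ... | zero , d≡ , _ , eq rewrite eq | d≡ = sym (ℤₚ.*-identityʳ _)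
    ... | suc d , d≡ , d<F , eq rewrite eq | d≡ = trans (falling-zero F d d<F) (sym (ℤₚ.*-zeroʳ (falling F 0ℤ)))

    ^-nonneg : ∀ {x} k → 0ℤ ≤ x → 0ℤ ≤ x ^ k
    ^-nonneg zero    _   = +≤+ z≤n
    ^-nonneg (suc k) 0≤x = *-nonneg 0≤x (^-nonneg k 0≤x)

    ext-nonneg : ∀ ks e v w → 0ℤ ≤ ext G ks e v w
    ext-nonneg []       e v w = ^-nonneg (suc e) (f-nonneg w)
    ext-nonneg (k ∷ ks) e v w = *-nonneg (^-nonneg k (f-nonneg w)) (∑-nonneg (λ u →
      *-nonneg (𝟙-nonneg (adj G w u)) (*-nonneg (away-nonneg v u) (ext-nonneg ks e w u))))

    eval-leafE-adj : ∀ {k} (i j : Fin k) x → adj G (lookup x i) (lookup x j) ≡ true →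
                     eval G (leafE F i j) x ≡ falling F 0ℤ * (1ℤ - nl G (lookup x i))
    eval-leafE-adj i j x vw = trans (eval-leafE F i j x)
      (trans (cong (falling F) (others-adj G vw)) (falling-f (lookup x i)))

    eval-nonLeafE : ∀ {k} (i j : Fin k) x → adj G (lookup x i) (lookup x j) ≡ true →
                    eval G (nonLeafE F i j) x ≡ falling F 0ℤ * nl G (lookup x i)
    eval-nonLeafE i j x vw = trans (cong₂ (λ a b → a + - 1ℤ * b)
      (trans (eval-polyE G F i (cst 0ℤ) x) (cong (falling F) (∑-zero (λ u → refl)))) (eval-leafE-adj i j x vw))
      (collect (falling F 0ℤ) (nl G (lookup x i)))
      where
      collect : ∀ a b → a + - 1ℤ * (a * (1ℤ - b)) ≡ a * b
      collect = solve-∀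

    -- The detectors have their intended value only on adjacent vertices; the adjacency factor in
    -- front of them makes all other pairs irrelevant.
    guarded : ∀ b {x y : ℤ} → (b ≡ true → x ≡ y) → 𝟙 b * x ≡ 𝟙 b * y
    guarded true  eq = cong (1ℤ *_) (eq refl)
    guarded false eq = refl

    eval-walksE : ∀ k ks e → eval G (walksE F k ks e) [] ≡ falling F 0ℤ * walks G k ks e
    eval-walksE k ks e = trans (∑-cong (λ v → trans (∑-cong (λ w → trans
        (guarded (adj G v w) (λ vw → cong₂ _*_ (eval-powE k #1 (w ∷ v ∷ []))
          (cong₂ _*_ (eval-nonLeafE #1 #0 (w ∷ v ∷ []) vw) (eval-extE ks e #1 #0 (w ∷ v ∷ [])))))
        (factor (𝟙 (adj G v w)) (f G v ^ k) (falling F 0ℤ) (nl G v) (ext G ks e v w))))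
      (∑-*ˡ (falling F 0ℤ) _))) (∑-*ˡ (falling F 0ℤ) _)
      where
      factor : ∀ a b c d x → a * (b * (c * d * x)) ≡ c * (a * (b * (d * x)))
      factor = solve-∀

-- Caterpillars with an indexed spine

-- Positions are natural numbers, so that successors and mirror images are plain arithmetic. Values
-- of `ê` from q on are junk, and every law is restricted to positions below q.
record Spine {n} (G : Graph n) (q : ℕ) : Set where
  field
    ê         : ℕ → Fin n
    ê-inj     : ∀ {i j} → i ℕ.< q → j ℕ.< q → ê i ≡ ê j → i ≡ j
    nonleaf⇒ê : ∀ v → isNonLeaf G v ≡ true → ∃ λ i → i ℕ.< q × ê i ≡ v
    ê-nonleaf : ∀ {i} → i ℕ.< q → isNonLeaf G (ê i) ≡ true
    consec    : ∀ {i} → suc i ℕ.< q → adj G (ê i) (ê (suc i)) ≡ true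
    consec⁻   : ∀ {i j} → i ℕ.< q → j ℕ.< q → adj G (ê i) (ê j) ≡ true → j ≡ suc i ⊎ i ≡ suc j

suc-∸-suc : ∀ {q i} → i ℕ.< q → suc (q ℕ.∸ suc i) ≡ q ℕ.∸ i
suc-∸-suc {suc q} {i} (s≤s i≤q) = sym (ℕₚ.+-∸-assoc 1 i≤q)

∸-suc-< : ∀ {q i} → i ℕ.< q → q ℕ.∸ suc i ℕ.< q
∸-suc-< {suc q} {i} _ = s≤s (ℕₚ.m∸n≤m q i)

mirror-mirror : ∀ {q i} → i ℕ.< q → q ℕ.∸ suc (q ℕ.∸ suc i) ≡ i
mirror-mirror {q} {i} i<q = trans (cong (q ℕ.∸_) (suc-∸-suc i<q)) (ℕₚ.m∸[m∸n]≡n (ℕₚ.<⇒≤ i<q))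

reverse : ∀ {n q} {G : Graph n} → Spine G q → Spine G q
reverse {q = q} {G} S = record
  { ê = λ i → ê (q ℕ.∸ suc i)
  ; ê-inj = λ i<q j<q eq → ℕₚ.suc-injective (ℕₚ.∸-cancelˡ-≡ i<q j<q (ê-inj (∸-suc-< i<q) (∸-suc-< j<q) eq))
  ; nonleaf⇒ê = λ v nl → let i , i<q , eq = nonleaf⇒ê v nl in
      q ℕ.∸ suc i , ∸-suc-< i<q , trans (cong ê (mirror-mirror i<q)) eq
  ; ê-nonleaf = λ i<q → ê-nonleaf (∸-suc-< i<q)
  ; consec = λ {i} 1+i<q → trans (adj-sym G _ _) (subst (λ j → adj G (ê (q ℕ.∸ suc (suc i))) (ê j) ≡ true)
      (suc-∸-suc 1+i<q) (consec (subst (ℕ._< q) (sym (suc-∸-suc 1+i<q)) (∸-suc-< (ℕₚ.<-trans (ℕₚ.n<1+n i) 1+i<q)))))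
  ; consec⁻ = λ i<q j<q a → case consec⁻ (∸-suc-< i<q) (∸-suc-< j<q) a of λ
      { (inj₁ eq) → inj₂ (sym (ℕₚ.∸-cancelˡ-≡ j<q (ℕₚ.<⇒≤ i<q) (trans eq (suc-∸-suc i<q))))
      ; (inj₂ eq) → inj₁ (sym (ℕₚ.∸-cancelˡ-≡ i<q (ℕₚ.<⇒≤ j<q) (trans eq (suc-∸-suc j<q)))) }
  }
  where open Spine S

-- With zeros past the end, a window that runs off the spine has value 0 and needs no separate
-- treatment.
zeroExtend : ℕ → (ℕ → ℤ) → ℕ → ℤ
zeroExtend q ψ i = if does (i ℕ.<? q) then ψ i else 0ℤ

zeroExtend-< : ∀ {q i} ψ → i ℕ.< q → zeroExtend q ψ i ≡ ψ i
zeroExtend-< {q} {i} ψ i<q = cong (if_then ψ i else 0ℤ) (dec-true (i ℕ.<? q) i<q)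

zeroExtend-≥ : ∀ {q i} ψ → ¬ i ℕ.< q → zeroExtend q ψ i ≡ 0ℤ
zeroExtend-≥ {q} {i} ψ i≮q = cong (if_then ψ i else 0ℤ) (dec-false (i ℕ.<? q) i≮q)

zeroExtend-cong : ∀ {q} {ψ χ : ℕ → ℤ} i → (i ℕ.< q → ψ i ≡ χ i) → zeroExtend q ψ i ≡ zeroExtend q χ i
zeroExtend-cong {q} {ψ} {χ} i eq with i ℕ.<? q
... | yes i<q = trans (zeroExtend-< ψ i<q) (trans (eq i<q) (sym (zeroExtend-< χ i<q)))
... | no i≮q = trans (zeroExtend-≥ ψ i≮q) (sym (zeroExtend-≥ χ i≮q))

∑-δℕ : ∀ q k (ψ : ℕ → ℤ) → ∑ {q} (λ j → 𝟙 (does (toℕ j ℕ.≟ k)) * ψ (toℕ j)) ≡ zeroExtend q ψ k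
∑-δℕ q k ψ with k ℕ.<? q
... | no k≮q = trans (∑-zero (λ j → cong (λ b → 𝟙 b * ψ (toℕ j))
        (dec-false (toℕ j ℕ.≟ k) (λ { refl → k≮q (Finₚ.toℕ<n j) })))) (sym (zeroExtend-≥ ψ k≮q))
... | yes k<q = trans (∑-cong (λ j → cong (λ b → 𝟙 b * ψ (toℕ j)) (agree j)))
        (trans (∑-δ (fromℕ< k<q) (ψ ∘ toℕ)) (trans (cong ψ (Finₚ.toℕ-fromℕ< k<q)) (sym (zeroExtend-< ψ k<q))))
  where
  agree : ∀ j → does (toℕ j ℕ.≟ k) ≡ (j == fromℕ< k<q)
  agree j with j Fin.≟ fromℕ< k<q
  ... | yes refl = dec-true (toℕ j ℕ.≟ k) (Finₚ.toℕ-fromℕ< k<q)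
  ... | no j≢ = dec-false (toℕ j ℕ.≟ k) (λ { refl → j≢ (sym (Finₚ.fromℕ<-toℕ j k<q)) })

telescope : ∀ q (w : ℕ → ℤ) → ∑ {q} (λ i → w (toℕ i)) - ∑ {q} (λ i → w (suc (toℕ i))) ≡ w 0 - w q
telescope zero    w = trans (cong₂ _-_ (∑-[] _) (∑-[] _)) (sym (ℤₚ.+-inverseʳ (w 0)))
telescope (suc q) w = trans (cong₂ _-_ (∑-∷ _) (∑-∷ _))
  (trans (regroup (w 0) (w 1) _ _) (trans (cong (λ t → w 0 - w 1 + t) (telescope q (w ∘ suc))) (cancel (w 0) (w 1) (w (suc q)))))
  where
  regroup : ∀ a b c d → (a + c) - (b + d) ≡ (a - b) + (c - d)
  regroup = solve-∀
  cancel : ∀ a b c → (a - b) + (b - c) ≡ a - c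
  cancel = solve-∀

∑-mirror : ∀ q (w : ℕ → ℤ) → ∑ {q} (λ i → w (toℕ i)) ≡ ∑ {q} (λ i → w (q ℕ.∸ suc (toℕ i)))
∑-mirror q w = trans (∑-reverse (λ (i : Fin q) → w (toℕ i))) (∑-cong (λ i → cong w (Finₚ.opposite-prop i)))

window : (ℕ → ℤ) → List ℕ → ℕ → ℕ → ℤ
window w []       e i = w i ^ suc e
window w (k ∷ ks) e i = w i ^ k * window w ks e (suc i)

window-beyond : ∀ {q w} → (∀ i → ¬ i ℕ.< q → w i ≡ 0ℤ) → ∀ ks e i → ¬ i ℕ.< q → window w ks e i ≡ 0ℤ
window-beyond {w = w} w0 []       e i i≮q rewrite w0 i i≮q = refl
window-beyond {w = w} w0 (k ∷ ks) e i i≮q = trans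
  (cong (_*_ (w i ^ k)) (window-beyond w0 ks e (suc i) (i≮q ∘ ℕₚ.<-trans (ℕₚ.n<1+n i)))) (ℤₚ.*-zeroʳ (w i ^ k))

module _ {n : ℕ} (G : Graph n) where
  -- These are the walks with no further vertex in front. A walk of one vertex has no direction
  -- although the spine is read in both, hence the factor 2.
  start : List ℕ → ℕ → ℤ
  start []       e = + 2 * ∑ (λ v → f G v ^ suc e)
  start (k ∷ ks) e = walks G k ks e

module _ {n q : ℕ} {G : Graph n} where
  read : Spine G q → (Fin n → ℤ) → ℕ → ℤ
  read S φ = zeroExtend q (λ i → φ (Spine.ê S i))

  word : Spine G q → ℕ → ℤ
  word S = read S (f G)

  VanishesOnLeaves : (Fin n → ℤ) → Set
  VanishesOnLeaves φ = ∀ v → isNonLeaf G v ≡ false → φ v ≡ 0ℤ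

  ∑-spine : ∀ S φ → VanishesOnLeaves φ → ∑ φ ≡ ∑ {q} (λ i → read S φ (toℕ i))
  ∑-spine S φ vanish = trans (∑-image (ê ∘ toℕ) inj φ off)
    (∑-cong (λ i → sym (zeroExtend-< (φ ∘ ê) (Finₚ.toℕ<n i))))
    where
    open Spine S
    inj : Injective _≡_ _≡_ (ê ∘ toℕ {q})
    inj {i} {j} eq = Finₚ.toℕ-injective (ê-inj (Finₚ.toℕ<n i) (Finₚ.toℕ<n j) eq)
    off : ∀ v → ¬ (∃ λ i → v ≡ ê (toℕ {q} i)) → φ v ≡ 0ℤ
    off v miss with isNonLeaf G v in eq
    ... | false = vanish v eq
    ... | true with i , i<q , refl ← nonleaf⇒ê v eq =
      contradiction (fromℕ< i<q , cong ê (sym (Finₚ.toℕ-fromℕ< i<q))) miss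

  -- The neighbour before position i is written as the successor of the mirrored position in
  -- `reverse S`. Both directions then have the same shape, and at the two ends `zeroExtend`
  -- supplies the missing term.
  ∑-nbrs : ∀ S φ {i} → (∀ w → adj G (Spine.ê S i) w ≡ true → isNonLeaf G w ≡ false → φ w ≡ 0ℤ) → i ℕ.< q →
           ∑ (λ w → 𝟙 (adj G (Spine.ê S i) w) * φ w) ≡ read S φ (suc i) + read (reverse S) φ (suc (q ℕ.∸ suc i))
  ∑-nbrs S φ {i} vanish i<q = begin
    ∑ (λ w → 𝟙 (adj G (ê i) w) * φ w)
      ≡⟨ ∑-spine S _ vanish′ ⟩
    ∑ {q} (λ j → read S (λ w → 𝟙 (adj G (ê i) w) * φ w) (toℕ j))
      ≡⟨ ∑-cong (λ j → trans (zeroExtend-< (λ j → 𝟙 (adj G (ê i) (ê j)) * φ (ê j)) (Finₚ.toℕ<n j)) (trans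
           (cong (_* φ (ê (toℕ j))) (split (Finₚ.toℕ<n j)))
           (ℤₚ.*-distribʳ-+ (φ (ê (toℕ j))) (𝟙 (does (toℕ j ℕ.≟ suc i))) (𝟙 (does (suc (toℕ j) ℕ.≟ i)))))) ⟩
    ∑ {q} (λ j → 𝟙 (does (toℕ j ℕ.≟ suc i)) * φ (ê (toℕ j)) + 𝟙 (does (suc (toℕ j) ℕ.≟ i)) * φ (ê (toℕ j)))
      ≡⟨ ∑-+ _ _ ⟩
    ∑ {q} (λ j → 𝟙 (does (toℕ j ℕ.≟ suc i)) * φ (ê (toℕ j))) + ∑ {q} (λ j → 𝟙 (does (suc (toℕ j) ℕ.≟ i)) * φ (ê (toℕ j)))
      ≡⟨ cong₂ _+_ (∑-δℕ q (suc i) (φ ∘ ê)) (lower i i<q) ⟩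
    read S φ (suc i) + read (reverse S) φ (suc (q ℕ.∸ suc i)) ∎
    where
    open Spine S
    open ≡-Reasoning
    vanish′ : VanishesOnLeaves (λ w → 𝟙 (adj G (ê i) w) * φ w)
    vanish′ w leaf with adj G (ê i) w in vw
    ... | false = refl
    ... | true = trans (ℤₚ.*-identityˡ (φ w)) (vanish w vw leaf)
    split : ∀ {j} → j ℕ.< q → 𝟙 (adj G (ê i) (ê j)) ≡ 𝟙 (does (j ℕ.≟ suc i)) + 𝟙 (does (suc j ℕ.≟ i))
    split {j} j<q with j ℕ.≟ suc i | suc j ℕ.≟ i
    ... | yes refl | yes eq = contradiction (subst (i ℕ.<_) eq (ℕₚ.<-trans (ℕₚ.n<1+n i) (ℕₚ.n<1+n (suc i)))) (ℕₚ.<-irrefl refl)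
    ... | yes refl | no ≢i = trans (cong 𝟙 (consec j<q))
      (cong₂ (λ a b → 𝟙 a + 𝟙 b) (sym (dec-true (suc i ℕ.≟ suc i) refl)) (sym (dec-false (suc (suc i) ℕ.≟ i) ≢i)))
    ... | no ≢j | yes refl = trans (cong 𝟙 (trans (adj-sym G _ _) (consec i<q)))
      (cong₂ (λ a b → 𝟙 a + 𝟙 b) (sym (dec-false (j ℕ.≟ suc (suc j)) ≢j)) (sym (dec-true (suc j ℕ.≟ suc j) refl)))
    ... | no ≢j | no ≢i = trans (cong 𝟙 nonadjacent)
      (cong₂ (λ a b → 𝟙 a + 𝟙 b) (sym (dec-false (j ℕ.≟ suc i) ≢j)) (sym (dec-false (suc j ℕ.≟ i) ≢i)))
      where
      nonadjacent : adj G (ê i) (ê j) ≡ false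
      nonadjacent with adj G (ê i) (ê j) in eq
      ... | false = refl
      ... | true with consec⁻ i<q j<q eq
      ...   | inj₁ p = contradiction p ≢j
      ...   | inj₂ p = contradiction (sym p) ≢i
    lower : ∀ i → i ℕ.< q → ∑ {q} (λ j → 𝟙 (does (suc (toℕ j) ℕ.≟ i)) * φ (ê (toℕ j))) ≡ read (reverse S) φ (suc (q ℕ.∸ suc i))
    lower zero 0<q = trans (∑-zero (λ j → refl)) (sym (zeroExtend-≥ (λ i → φ (ê (q ℕ.∸ suc i)))
      (λ lt → ℕₚ.<-irrefl (suc-∸-suc 0<q) lt)))
    lower (suc h) 1+h<q = trans (∑-δℕ q h (φ ∘ ê)) (trans (zeroExtend-< (φ ∘ ê) h<q) (sym (trans
      (zeroExtend-< (λ i → φ (ê (q ℕ.∸ suc i))) (subst (ℕ._< q) (sym (suc-∸-suc 1+h<q)) (∸-suc-< h<q)))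
      (cong (φ ∘ ê) (trans (cong (λ t → q ℕ.∸ suc t) (suc-∸-suc 1+h<q)) (mirror-mirror h<q))))))
      where
      h<q : h ℕ.< q
      h<q = ℕₚ.<-trans (ℕₚ.n<1+n h) 1+h<q

  nl-vanishes : VanishesOnLeaves (nl G)
  nl-vanishes v = cong 𝟙

  read-nl : ∀ S {i} → i ℕ.< q → read S (nl G) i ≡ 1ℤ
  read-nl S i<q = trans (zeroExtend-< (λ i → nl G (Spine.ê S i)) i<q) (cong 𝟙 (Spine.ê-nonleaf S i<q))

  module _ {F : ℕ} (within : DegreesWithin F G) where
    f-vanishes : VanishesOnLeaves (f G)
    f-vanishes v leaf = f-leaf G within (cong 𝟙 leaf)

    -- The last exponent is positive, so a walk that stops at a leaf weighs 0; and a leaf has no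
    -- second neighbour through which a nonbacktracking walk could go on.
    ext-leaf : ∀ ks e {v w} → adj G v w ≡ true → isNonLeaf G w ≡ false → ext G ks e v w ≡ 0ℤ
    ext-leaf [] e {v} {w} vw leaf = cong (_* f G w ^ e) (f-vanishes w leaf)
    ext-leaf (k ∷ ks) e {v} {w} vw leaf = trans (cong (_*_ (f G w ^ k)) (∑-zero (λ u →
        trans (sym (ℤₚ.*-assoc (𝟙 (adj G w u)) (away v u) (ext G ks e w u)))
              (cong (_* ext G ks e w u) (no-others u)))))
      (ℤₚ.*-zeroʳ (f G w ^ k))
      where
      no-others : ∀ u → 𝟙 (adj G w u) * away v u ≡ 0ℤ
      no-others = ∑-zero⁻ _ (λ u → *-nonneg (𝟙-nonneg (adj G w u)) (away-nonneg v u))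
        (trans (others-adj G (trans (adj-sym G w v) vw)) (f-vanishes w leaf))

    word-beyond : ∀ S i → ¬ i ℕ.< q → word S i ≡ 0ℤ
    word-beyond S i = zeroExtend-≥ (λ i → f G (Spine.ê S i))

    -- Of the two neighbours on the spine, `away` removes the one that the walk came from, so the
    -- walk moves along the spine in a fixed direction.
    ext-spine : ∀ S ks e {i} → suc i ℕ.< q →
                ext G ks e (Spine.ê S i) (Spine.ê S (suc i)) ≡ window (word S) ks e (suc i)
    ext-spine S [] e 1+i<q = cong (_^ suc e) (sym (zeroExtend-< (λ i → f G (Spine.ê S i)) 1+i<q))
    ext-spine S (k ∷ ks) e {i} 1+i<q = cong₂ _*_
      (cong (_^ k) (sym (zeroExtend-< (λ i → f G (ê i)) 1+i<q)))
      (trans (∑-nbrs S φ (λ u wu leaf → trans (cong (_*_ (away v u)) (ext-leaf ks e wu leaf)) (ℤₚ.*-zeroʳ (away v u))) 1+i<q)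
        (trans (cong₂ _+_ forward backward) (ℤₚ.+-identityʳ (window (word S) ks e (suc (suc i))))))
      where
      open Spine S
      v = ê i
      φ : Fin n → ℤ
      φ u = away v u * ext G ks e (ê (suc i)) u
      i<q : i ℕ.< q
      i<q = ℕₚ.<-trans (ℕₚ.n<1+n i) 1+i<q
      backward : read (reverse S) φ (suc (q ℕ.∸ suc (suc i))) ≡ 0ℤ
      backward rewrite suc-∸-suc 1+i<q = trans (zeroExtend-< (λ j → φ (ê (q ℕ.∸ suc j))) (∸-suc-< i<q))
        (trans (cong (φ ∘ ê) (mirror-mirror i<q)) (cong (_* ext G ks e (ê (suc i)) v) (away-refl v)))
      forward : read S φ (suc (suc i)) ≡ window (word S) ks e (suc (suc i))
      forward with suc (suc i) ℕ.<? q
      ... | no ≮q = trans (zeroExtend-≥ (φ ∘ ê) ≮q) (sym (window-beyond (word-beyond S) ks e _ ≮q))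
      ... | yes 2+i<q = trans (zeroExtend-< (φ ∘ ê) 2+i<q) (trans (cong (_* ext G ks e (ê (suc i)) (ê (suc (suc i))))
          (away-≢ (λ eq → ℕₚ.<-irrefl (sym (ê-inj 2+i<q i<q eq)) (ℕₚ.<-trans (ℕₚ.n<1+n i) (ℕₚ.n<1+n (suc i))))))
        (trans (ℤₚ.*-identityˡ _) (ext-spine S ks e 2+i<q)))

    read-ext : ∀ S ks e {i} → i ℕ.< q → read S (ext G ks e (Spine.ê S i)) (suc i) ≡ window (word S) ks e (suc i)
    read-ext S ks e {i} i<q with suc i ℕ.<? q
    ... | yes 1+i<q = trans (zeroExtend-< (λ j → ext G ks e (Spine.ê S i) (Spine.ê S j)) 1+i<q) (ext-spine S ks e 1+i<q)
    ... | no ≮q = trans (zeroExtend-≥ (λ j → ext G ks e (Spine.ê S i) (Spine.ê S j)) ≮q) (sym (window-beyond (word-beyond S) ks e _ ≮q))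

    -- Every walk that counts runs up or down the spine, and one that runs down runs up the reversed
    -- spine.
    headSum : ∀ S A ks e → VanishesOnLeaves A →
      ∑ (λ v → ∑ (λ w → 𝟙 (adj G v w) * (A v * ext G ks e v w)))
      ≡ ∑ {q} (λ i → read S A (toℕ i) * window (word S) ks e (suc (toℕ i)))
      + ∑ {q} (λ i → read (reverse S) A (toℕ i) * window (word (reverse S)) ks e (suc (toℕ i)))
    headSum S A ks e vanish = begin
      ∑ (λ v → ∑ (λ w → 𝟙 (adj G v w) * (A v * ext G ks e v w)))
        ≡⟨ ∑-cong (λ v → trans (∑-cong (λ w → exchange (𝟙 (adj G v w)) (A v) (ext G ks e v w))) (∑-*ˡ (A v) _)) ⟩
      ∑ (λ v → A v * B v)
        ≡⟨ ∑-spine S _ (λ v leaf → cong (_* B v) (vanish v leaf)) ⟩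
      ∑ {q} (λ i → read S (λ v → A v * B v) (toℕ i))
        ≡⟨ ∑-cong (λ i → term (Finₚ.toℕ<n i)) ⟩
      ∑ {q} (λ i → up (toℕ i) + down (q ℕ.∸ suc (toℕ i)))
        ≡⟨ ∑-+ _ _ ⟩
      ∑ {q} (λ i → up (toℕ i)) + ∑ {q} (λ i → down (q ℕ.∸ suc (toℕ i)))
        ≡⟨ cong (_+_ (∑ {q} (λ i → up (toℕ i)))) (∑-mirror q down) ⟨
      ∑ {q} (λ i → up (toℕ i)) + ∑ {q} (λ i → down (toℕ i)) ∎
      where
      open ≡-Reasoning
      open Spine S
      exchange : ∀ a b c → a * (b * c) ≡ b * (a * c)
      exchange = solve-∀
      B : Fin n → ℤ
      B v = ∑ (λ w → 𝟙 (adj G v w) * ext G ks e v w)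
      up down : ℕ → ℤ
      up i = read S A i * window (word S) ks e (suc i)
      down i = read (reverse S) A i * window (word (reverse S)) ks e (suc i)
      mirrored : ∀ {i} → i ℕ.< q → ê (q ℕ.∸ suc (q ℕ.∸ suc i)) ≡ ê i
      mirrored i<q = cong ê (mirror-mirror i<q)
      term : ∀ {i} → i ℕ.< q → read S (λ v → A v * B v) i ≡ up i + down (q ℕ.∸ suc i)
      term {i} i<q = begin
        read S (λ v → A v * B v) i
          ≡⟨ zeroExtend-< (λ i → A (ê i) * B (ê i)) i<q ⟩
        A (ê i) * B (ê i)
          ≡⟨ cong (_*_ (A (ê i))) (∑-nbrs S (ext G ks e (ê i)) (λ w → ext-leaf ks e) i<q) ⟩
        A (ê i) * (read S (ext G ks e (ê i)) (suc i) + read (reverse S) (ext G ks e (ê i)) (suc (q ℕ.∸ suc i)))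
          ≡⟨ ℤₚ.*-distribˡ-+ (A (ê i)) _ _ ⟩
        A (ê i) * read S (ext G ks e (ê i)) (suc i) + A (ê i) * read (reverse S) (ext G ks e (ê i)) (suc (q ℕ.∸ suc i))
          ≡⟨ cong₂ _+_
               (cong₂ _*_ (sym (zeroExtend-< (A ∘ ê) i<q)) (read-ext S ks e i<q))
               (cong₂ _*_
                 (sym (trans (zeroExtend-< (λ j → A (ê (q ℕ.∸ suc j))) (∸-suc-< i<q)) (cong A (mirrored i<q))))
                 (trans (cong (λ v → read (reverse S) (ext G ks e v) (suc (q ℕ.∸ suc i))) (sym (mirrored i<q)))
                        (read-ext (reverse S) ks e (∸-suc-< i<q)))) ⟩
        up i + down (q ℕ.∸ suc i) ∎

    total : Spine G q → List ℕ → ℕ → ℤ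
    total S ks e = ∑ {q} (λ i → window (word S) ks e (toℕ i))

    walks-spine : ∀ S k ks e → walks G k ks e ≡ total S (k ∷ ks) e + total (reverse S) (k ∷ ks) e
    walks-spine S k ks e = trans
      (∑-cong (λ v → ∑-cong (λ w → cong (_*_ (𝟙 (adj G v w))) (sym (ℤₚ.*-assoc (f G v ^ k) (nl G v) _)))))
      (trans (headSum S (λ v → f G v ^ k * nl G v) ks e
               (λ v leaf → trans (cong (_*_ (f G v ^ k)) (cong 𝟙 leaf)) (ℤₚ.*-zeroʳ (f G v ^ k))))
             (cong₂ _+_ (side S) (side (reverse S))))
      where
      side : ∀ S → ∑ {q} (λ i → read S (λ v → f G v ^ k * nl G v) (toℕ i) * window (word S) ks e (suc (toℕ i))) ≡ total S (k ∷ ks) e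
      side S = ∑-cong (λ i → cong (_* window (word S) ks e (suc (toℕ i))) (letter (Finₚ.toℕ<n i)))
        where
        open Spine S
        letter : ∀ {i} → i ℕ.< q → read S (λ v → f G v ^ k * nl G v) i ≡ word S i ^ k
        letter {i} i<q = trans (zeroExtend-< (λ i → f G (ê i) ^ k * nl G (ê i)) i<q) (trans
          (trans (cong (_*_ (f G (ê i) ^ k)) (cong 𝟙 (ê-nonleaf i<q))) (ℤₚ.*-identityʳ _))
          (cong (_^ k) (sym (zeroExtend-< (λ i → f G (ê i)) i<q))))

    correlation-spine : ∀ S ks → correlation G ks ≡ total S (1 ∷ ks) 0 + total (reverse S) (1 ∷ ks) 0
    correlation-spine S ks = trans (headSum S (f G) ks 0 f-vanishes) (cong₂ _+_ (side S) (side (reverse S)))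
      where
      side : ∀ S → ∑ {q} (λ i → word S (toℕ i) * window (word S) ks 0 (suc (toℕ i))) ≡ total S (1 ∷ ks) 0
      side S = ∑-cong (λ i → cong (_* window (word S) ks 0 (suc (toℕ i))) (sym (ℤₚ.*-identityʳ (word S (toℕ i)))))

    start-spine : ∀ S ks e → start G ks e ≡ total S ks e + total (reverse S) ks e
    start-spine S []       e = trans (double (∑ (λ v → f G v ^ suc e))) (cong₂ _+_ (side S) (side (reverse S)))
      where
      double : ∀ x → + 2 * x ≡ x + x
      double = solve-∀
      side : ∀ S → ∑ (λ v → f G v ^ suc e) ≡ total S [] e
      side S = trans (∑-spine S _ (λ v leaf → cong (_* f G v ^ e) (f-vanishes v leaf)))
        (∑-cong (λ i → trans (zeroExtend-< (λ i → f G (Spine.ê S i) ^ suc e) (Finₚ.toℕ<n i))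
          (cong (_^ suc e) (sym (zeroExtend-< (λ i → f G (Spine.ê S i)) (Finₚ.toℕ<n i))))))
    start-spine S (k ∷ ks) e = walks-spine S k ks e

    -- A window that cannot be extended backwards starts at an end of the spine.
    anchored : ∀ S ks e → start G ks e - walks G 0 ks e ≡ window (word S) ks e 0 + window (word (reverse S)) ks e 0
    anchored S ks e = begin
      start G ks e - walks G 0 ks e
        ≡⟨ cong₂ _-_ (start-spine S ks e) (walks-spine S 0 ks e) ⟩
      (total S ks e + total (reverse S) ks e) - (total S (0 ∷ ks) e + total (reverse S) (0 ∷ ks) e)
        ≡⟨ regroup (total S ks e) (total (reverse S) ks e) (total S (0 ∷ ks) e) (total (reverse S) (0 ∷ ks) e) ⟩
      (total S ks e - total S (0 ∷ ks) e) + (total (reverse S) ks e - total (reverse S) (0 ∷ ks) e)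
        ≡⟨ cong₂ _+_ (side S) (side (reverse S)) ⟩
      window (word S) ks e 0 + window (word (reverse S)) ks e 0 ∎
      where
      open ≡-Reasoning
      regroup : ∀ a b c d → (a + b) - (c + d) ≡ (a - c) + (b - d)
      regroup = solve-∀
      side : ∀ S → total S ks e - total S (0 ∷ ks) e ≡ window (word S) ks e 0
      side S = begin
        total S ks e - total S (0 ∷ ks) e
          ≡⟨ cong (λ t → total S ks e - t) (∑-cong (λ i → ℤₚ.*-identityˡ (window (word S) ks e (suc (toℕ i))))) ⟩
        total S ks e - ∑ {q} (λ i → window (word S) ks e (suc (toℕ i)))
          ≡⟨ telescope q (window (word S) ks e) ⟩
        window (word S) ks e 0 - window (word S) ks e q
          ≡⟨ cong (λ t → window (word S) ks e 0 - t) (window-beyond (word-beyond S) ks e q (ℕₚ.<-irrefl refl)) ⟩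
        window (word S) ks e 0 - 0ℤ
          ≡⟨ ℤₚ.+-identityʳ _ ⟩
        window (word S) ks e 0 ∎

-- Counting edges at nonleaf vertices

isNonLeaf⇒ : ∀ {n} (G : Graph n) v → isNonLeaf G v ≡ true → NonLeaf G v
isNonLeaf⇒ G v eq with 2 ℕ.≤? deg G v
... | yes p = p
... | no ¬p with () ← trans (sym eq) (dec-false (2 ℕ.≤? deg G v) ¬p)

isNonLeaf⇐ : ∀ {n} (G : Graph n) v → NonLeaf G v → isNonLeaf G v ≡ true
isNonLeaf⇐ G v = dec-true (2 ℕ.≤? deg G v)

isLeaf⇒ : ∀ {n} (G : Graph n) v → isNonLeaf G v ≡ false → deg G v ℕ.≤ 1
isLeaf⇒ G v eq with 2 ℕ.≤? deg G v
... | no ¬p = ℕₚ.≤-pred (ℕₚ.≰⇒> ¬p)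
... | yes p with () ← trans (sym (dec-true (2 ℕ.≤? deg G v) p)) eq

-- What can be said about leaves before a spine is known; for the other graph this is obtained long
-- before its spine.
record Pruned (F : ℕ) {n} (G : Graph n) : Set where
  field
    within     : DegreesWithin F G
    noLeafEdge : ∀ u v → adj G u v ≡ true → isNonLeaf G u ≡ false → isNonLeaf G v ≡ true

∑-const : ∀ n c → ∑ {n} (λ _ → c) ≡ + n * c
∑-const zero    c = ∑-[] _
∑-const (suc n) c = trans (∑-∷ _) (trans (cong (_+_ c) (∑-const n c)) (sym (ℤₚ.suc-* (+ n) c)))

module _ {n : ℕ} (G : Graph n) where
  innerDeg : Fin n → ℤ
  innerDeg v = ∑ (λ w → 𝟙 (adj G v w) * nl G w)

  deg-pos : ∀ {v w} → adj G v w ≡ true → 1 ℕ.≤ deg G v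
  deg-pos {v} {w} vw = ℤₚ.drop‿+≤+ (subst₂ _≤_ (cong 𝟙 vw) (sym (deg≡dg G v))
    (≤-∑ (λ u → 𝟙 (adj G v u)) (λ u → 𝟙-nonneg (adj G v u)) w))

  two-nbrs : ∀ {v a b} → adj G v a ≡ true → adj G v b ≡ true → b ≢ a → NonLeaf G v
  two-nbrs {v} {a} {b} va vb b≢a = ℤₚ.drop‿+≤+ (subst (+ 2 ≤_) (sym d≡) (ℤₚ.+-monoˡ-≤ 1ℤ 1≤f))
    where
    1≤f : 1ℤ ≤ f G v
    1≤f = subst₂ _≤_ (cong₂ _*_ (cong 𝟙 vb) (away-≢ b≢a)) (others-adj G va)
      (≤-∑ (λ u → 𝟙 (adj G v u) * away a u) (λ u → *-nonneg (𝟙-nonneg (adj G v u)) (away-nonneg a u)) b)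
    d≡ : + deg G v ≡ f G v + 1ℤ
    d≡ = trans (deg≡dg G v) (back (dg G v))
      where
      back : ∀ x → x ≡ x - 1ℤ + 1ℤ
      back = solve-∀

  leaf-nbr : ∀ {v a b} → isNonLeaf G v ≡ false → adj G v a ≡ true → adj G v b ≡ true → b ≡ a
  leaf-nbr {v} {a} {b} leaf va vb with b Fin.≟ a
  ... | yes eq = eq
  ... | no b≢a with () ← trans (sym leaf) (isNonLeaf⇐ G v (two-nbrs va vb b≢a))

  module _ {q : ℕ} (S : Spine G q) where
    ∑-nl : ∑ (nl G) ≡ + q
    ∑-nl = trans (∑-spine S (nl G) (nl-vanishes {q = q} {G})) (trans (∑-cong (λ i → read-nl S (Finₚ.toℕ<n i)))
      (trans (∑-const q 1ℤ) (ℤₚ.*-identityʳ (+ q))))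

    -- The q - 1 edges of a path are each counted from both ends: looking forward misses one letter,
    -- and so does looking backward.
    ∑-innerDeg : 1 ℕ.≤ q → ∑ (λ v → nl G v * innerDeg v) ≡ + q + + q - + 2
    ∑-innerDeg 1≤q = begin
      ∑ (λ v → nl G v * innerDeg v)
        ≡⟨ ∑-spine S _ (λ v leaf → cong (λ b → 𝟙 b * innerDeg v) leaf) ⟩
      ∑ {q} (λ i → read S (λ v → nl G v * innerDeg v) (toℕ i))
        ≡⟨ ∑-cong (λ i → term (Finₚ.toℕ<n i)) ⟩
      ∑ {q} (λ i → up S (toℕ i) + up (reverse S) (q ℕ.∸ suc (toℕ i)))
        ≡⟨ ∑-+ _ _ ⟩
      ∑ {q} (λ i → up S (toℕ i)) + ∑ {q} (λ i → up (reverse S) (q ℕ.∸ suc (toℕ i)))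
        ≡⟨ cong (_+_ (∑ {q} (λ i → up S (toℕ i)))) (∑-mirror q (up (reverse S))) ⟨
      ∑ {q} (λ i → up S (toℕ i)) + ∑ {q} (λ i → up (reverse S) (toℕ i))
        ≡⟨ cong₂ _+_ (side S) (side (reverse S)) ⟩
      (+ q - 1ℤ) + (+ q - 1ℤ)
        ≡⟨ collect (+ q) ⟩
      + q + + q - + 2 ∎
      where
      open ≡-Reasoning
      open Spine S
      collect : ∀ x → (x - 1ℤ) + (x - 1ℤ) ≡ x + x - + 2
      collect = solve-∀
      up : Spine G q → ℕ → ℤ
      up S i = read S (nl G) (suc i)
      term : ∀ {i} → i ℕ.< q → read S (λ v → nl G v * innerDeg v) i ≡ up S i + up (reverse S) (q ℕ.∸ suc i)
      term {i} i<q = trans (zeroExtend-< (λ i → nl G (ê i) * innerDeg (ê i)) i<q)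
        (trans (cong (λ b → 𝟙 b * innerDeg (ê i)) (ê-nonleaf i<q)) (trans (ℤₚ.*-identityˡ (innerDeg (ê i)))
          (∑-nbrs S (nl G) (λ w _ → nl-vanishes {q = q} {G} w) i<q)))
      solveFor : ∀ a b → a - b ≡ 1ℤ - 0ℤ → b ≡ a - 1ℤ
      solveFor a b eq = trans (rearrange a b) (cong (λ t → a - t) eq)
        where
        rearrange : ∀ a b → b ≡ a - (a - b)
        rearrange = solve-∀
      side : ∀ S → ∑ {q} (λ i → up S (toℕ i)) ≡ + q - 1ℤ
      side S = trans (solveFor (∑ {q} (λ i → read S (nl G) (toℕ i))) (∑ {q} (λ i → up S (toℕ i))) (trans (telescope q (read S (nl G)))
          (cong₂ _-_ (read-nl S 1≤q) (zeroExtend-≥ {q} {q} (λ i → nl G (Spine.ê S i)) (ℕₚ.<-irrefl refl)))))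
        (cong (_- 1ℤ) (trans (sym (∑-spine S (nl G) (nl-vanishes {q = q} {G}))) (∑-nl′ S)))
        where
        ∑-nl′ : Spine G q → ∑ (nl G) ≡ + q
        ∑-nl′ _ = ∑-nl

    module _ {F : ℕ} (pruned : Pruned F G) where
      open Pruned pruned

      -- Of the edge ends at nonleaf vertices, 2q - 2 belong to edges of the spine and n - q to
      -- edges towards leaves, one for each leaf. Subtracting 1 for each of the q nonleaf vertices
      -- leaves n - 2.
      ∑-f : 1 ℕ.≤ q → ∑ (f G) ≡ + n - + 2
      ∑-f 1≤q = begin
        ∑ (f G)                                    ≡⟨ isolate (∑ (f G)) (∑ (nl G)) ⟩
        (∑ (f G) + ∑ (nl G)) - ∑ (nl G)            ≡⟨ cong (_- ∑ (nl G)) (trans (sym (∑-+ (f G) (nl G))) (∑-cong nl-dg)) ⟩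
        ∑ (λ v → nl G v * dg G v) - ∑ (nl G)       ≡⟨ cong (_- ∑ (nl G)) split ⟩
        ∑ (λ v → nl G v * innerDeg v) + (+ n - ∑ (nl G)) - ∑ (nl G)
          ≡⟨ cong₂ (λ a b → a + (+ n - b) - b) (∑-innerDeg 1≤q) ∑-nl ⟩
        + q + + q - + 2 + (+ n - + q) - + q        ≡⟨ collect (+ q) (+ n) ⟩
        + n - + 2 ∎
        where
        open ≡-Reasoning
        isolate : ∀ a b → a ≡ (a + b) - b
        isolate = solve-∀
        collect : ∀ q n → q + q - + 2 + (n - q) - q ≡ n - + 2
        collect = solve-∀
        nl-dg : ∀ v → f G v + nl G v ≡ nl G v * dg G v
        nl-dg v with isNonLeaf G v in eq
        ... | false = trans (ℤₚ.+-identityʳ (f G v)) (f-leaf G within (cong 𝟙 eq))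
        ... | true = back (dg G v)
          where
          back : ∀ x → x - 1ℤ + 1ℤ ≡ 1ℤ * x
          back = solve-∀
        leaf-inner : ∀ w → (1ℤ - nl G w) * innerDeg w ≡ 1ℤ - nl G w
        leaf-inner w with isNonLeaf G w in leaf
        ... | true = refl
        ... | false = trans (ℤₚ.*-identityˡ (innerDeg w)) (trans (∑-cong inner) one)
          where
          inner : ∀ v → 𝟙 (adj G w v) * nl G v ≡ 𝟙 (adj G w v)
          inner v with adj G w v in wv
          ... | false = refl
          ... | true = cong (λ b → 1ℤ * 𝟙 b) (noLeafEdge w v wv leaf)
          one : dg G w ≡ 1ℤ
          one = trans (sym (deg≡dg G w)) (cong +_ (ℕₚ.≤-antisym (isLeaf⇒ G w leaf) (DegreesWithin.deg≥1 within w)))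
        split : ∑ (λ v → nl G v * dg G v) ≡ ∑ (λ v → nl G v * innerDeg v) + (+ n - ∑ (nl G))
        split = begin
          ∑ (λ v → nl G v * dg G v)
            ≡⟨ ∑-cong (λ v → trans (cong (_*_ (nl G v)) (trans (∑-cong (λ w → parts (𝟙 (adj G v w)) (nl G w))) (∑-+ _ _)))
                        (ℤₚ.*-distribˡ-+ (nl G v) (innerDeg v) _)) ⟩
          ∑ (λ v → nl G v * innerDeg v + nl G v * ∑ (λ w → 𝟙 (adj G v w) * (1ℤ - nl G w)))
            ≡⟨ ∑-+ _ _ ⟩
          ∑ (λ v → nl G v * innerDeg v) + ∑ (λ v → nl G v * ∑ (λ w → 𝟙 (adj G v w) * (1ℤ - nl G w)))
            ≡⟨ cong (_+_ (∑ (λ v → nl G v * innerDeg v))) leaves ⟩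
          ∑ (λ v → nl G v * innerDeg v) + (+ n - ∑ (nl G)) ∎
          where
          parts : ∀ a b → a ≡ a * b + a * (1ℤ - b)
          parts = solve-∀
          exchange : ∀ a b c → a * (b * c) ≡ c * (b * a)
          exchange = solve-∀
          leaves : ∑ (λ v → nl G v * ∑ (λ w → 𝟙 (adj G v w) * (1ℤ - nl G w))) ≡ + n - ∑ (nl G)
          leaves = begin
            ∑ (λ v → nl G v * ∑ (λ w → 𝟙 (adj G v w) * (1ℤ - nl G w)))
              ≡⟨ ∑-cong (λ v → sym (∑-*ˡ (nl G v) _)) ⟩
            ∑ (λ v → ∑ (λ w → nl G v * (𝟙 (adj G v w) * (1ℤ - nl G w))))
              ≡⟨ ∑-swap _ ⟩
            ∑ (λ w → ∑ (λ v → nl G v * (𝟙 (adj G v w) * (1ℤ - nl G w))))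
              ≡⟨ ∑-cong (λ w → trans (∑-cong (λ v → trans (exchange (nl G v) (𝟙 (adj G v w)) (1ℤ - nl G w))
                   (cong (λ b → (1ℤ - nl G w) * (𝟙 b * nl G v)) (adj-sym G v w)))) (∑-*ˡ (1ℤ - nl G w) _)) ⟩
            ∑ (λ w → (1ℤ - nl G w) * innerDeg w)
              ≡⟨ ∑-cong leaf-inner ⟩
            ∑ (λ w → 1ℤ - nl G w)
              ≡⟨ trans (∑-- (λ _ → 1ℤ) (nl G)) (cong (_- ∑ (nl G)) (trans (∑-const n 1ℤ) (ℤₚ.*-identityʳ (+ n)))) ⟩
            + n - ∑ (nl G) ∎

-- The hypotheses on G in the form used by the proof

record Caterpillar {n} (G : Graph n) : Set where
  field
    F q     : ℕ
    1≤F     : 1 ℕ.≤ F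
    4≤q     : 4 ℕ.≤ q
    pruned  : Pruned F G
    spine   : Spine G q
    q+4F≤   : q ℕ.+ 4 ℕ.* F ℕ.≤ n ℕ.+ 2

module FromDefs {n : ℕ} (48≤n : 48 ℕ.≤ n) (G : Graph n) (cat : IsCaterpillar G)
                (big : Σ (Fin 4 → Fin n) (λ g → Injective _≡_ _≡_ g × (∀ i → HasMaxDegree G (g i)))) where
  private
    connected : Connected G
    connected = proj₁ (proj₁ cat)

    g = proj₁ big

    vertex : (i : ℕ) → {i ℕ.< 48} → Fin n
    vertex i {i<48} = fromℕ< (ℕₚ.<-≤-trans i<48 48≤n)

    -- Three distinct vertices cannot all be among `u` and `v`; otherwise two of them would coincide
    -- by the pigeonhole principle.
    third : ∀ u v → ∃ λ w → w ≢ u × w ≢ v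
    third u v = pick (Finₚ.any? (λ i → ¬? (h i Fin.≟ u) ×-dec ¬? (h i Fin.≟ v)))
      where
      h : Fin 3 → Fin n
      h = g ∘ Fin.inject₁
      h-inj : Injective _≡_ _≡_ h
      h-inj eq = Finₚ.inject₁-injective (proj₁ (proj₂ big) eq)
      pick : Dec (∃ λ i → h i ≢ u × h i ≢ v) → ∃ λ w → w ≢ u × w ≢ v
      pick (yes (i , p)) = h i , p
      pick (no none) = contradiction (Finₚ.pigeonhole (ℕₚ.≤-refl {3}) side) clash
        where
        side : Fin 3 → Fin 2
        side i with h i Fin.≟ u
        ... | yes _ = Fin.zero
        ... | no _ = Fin.suc Fin.zero
        clash : ¬ (∃ λ i → ∃ λ j → i Fin.< j × side i ≡ side j)
        clash (i , j , i<j , eq) with h i Fin.≟ u | h j Fin.≟ u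
        ... | yes p | yes p′ = Finₚ.<⇒≢ i<j (h-inj (trans p (sym p′)))
        ... | no p | no p′ with h i Fin.≟ v | h j Fin.≟ v
        ...   | yes r | yes r′ = Finₚ.<⇒≢ i<j (h-inj (trans r (sym r′)))
        ...   | no r | _ = none (i , p , r)
        ...   | _ | no r′ = none (j , p′ , r′)

    firstStep : ∀ {u v} → Walk G u v → u ≢ v → ∃ λ w → adj G u w ≡ true
    firstStep here u≢u = contradiction refl u≢u
    firstStep (step a _) _ = _ , a

    hasNbr : ∀ v → ∃ λ w → adj G v w ≡ true
    hasNbr v = let u , u≢v , _ = third v v in firstStep (connected v u) (u≢v ∘ sym)

    -- Two adjacent leaves form a component of their own: a walk that starts there alternates
    -- between them and never reaches a third vertex.
    noLeafEdge : ∀ u v → adj G u v ≡ true → isNonLeaf G u ≡ false → isNonLeaf G v ≡ true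
    noLeafEdge u v uv leaf-u with isNonLeaf G v in leaf-v
    ... | true = refl
    ... | false = contradiction (stuck (connected u (proj₁ far)) (inj₁ refl)) [ proj₁ (proj₂ far) , proj₂ (proj₂ far) ]′
      where
      far = third u v
      stuck : ∀ {x y} → Walk G x y → x ≡ u ⊎ x ≡ v → y ≡ u ⊎ y ≡ v
      stuck here xs = xs
      stuck (step a w) (inj₁ refl) = stuck w (inj₂ (leaf-nbr G leaf-u uv a))
      stuck (step a w) (inj₂ refl) = stuck w (inj₁ (leaf-nbr G leaf-v (trans (adj-sym G v u) uv) a))

    k = proj₁ (proj₂ cat)
    e = proj₁ (proj₂ (proj₂ cat))
    e-inj = proj₁ (proj₂ (proj₂ (proj₂ cat)))
    e-nonleaf = proj₁ (proj₂ (proj₂ (proj₂ (proj₂ cat))))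
    e-adj = proj₂ (proj₂ (proj₂ (proj₂ (proj₂ cat))))

    ê : ℕ → Fin n
    ê i with i ℕ.<? k
    ... | yes i<k = e (fromℕ< i<k)
    ... | no _ = g Fin.zero

    ê-fin : ∀ {i} (i<k : i ℕ.< k) → ê i ≡ e (fromℕ< i<k)
    ê-fin {i} i<k with i ℕ.<? k
    ... | yes i<k′ = cong (λ p → e (fromℕ< p)) (ℕₚ.<-irrelevant i<k′ i<k)
    ... | no i≮k = contradiction i<k i≮k

  spine : Spine G k
  spine = record
    { ê = ê
    ; ê-inj = λ {i} {j} i<k j<k eq → Finₚ.fromℕ<-injective i j i<k j<k (e-inj (trans (sym (ê-fin i<k)) (trans eq (ê-fin j<k))))
    ; nonleaf⇒ê = λ v nl → let p , eq = Equivalence.to (e-nonleaf v) (isNonLeaf⇒ G v nl) in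
        toℕ p , Finₚ.toℕ<n p , trans (ê-fin (Finₚ.toℕ<n p)) (trans (cong e (Finₚ.fromℕ<-toℕ p _)) eq)
    ; ê-nonleaf = λ i<k → isNonLeaf⇐ G _ (Equivalence.from (e-nonleaf _) (_ , sym (ê-fin i<k)))
    ; consec = λ {i} 1+i<k → let i<k = ℕₚ.<-trans (ℕₚ.n<1+n i) 1+i<k in
        trans (cong₂ (adj G) (ê-fin i<k) (ê-fin 1+i<k)) (Equivalence.from (e-adj _ _)
          (inj₂ (trans (Finₚ.toℕ-fromℕ< 1+i<k) (cong suc (sym (Finₚ.toℕ-fromℕ< i<k))))))
    ; consec⁻ = λ i<k j<k a → case Equivalence.to (e-adj _ _) (trans (sym (cong₂ (adj G) (ê-fin i<k) (ê-fin j<k))) a) of λ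
        { (inj₁ eq) → inj₂ (trans (sym (Finₚ.toℕ-fromℕ< i<k)) (trans eq (cong suc (Finₚ.toℕ-fromℕ< j<k))))
        ; (inj₂ eq) → inj₁ (trans (sym (Finₚ.toℕ-fromℕ< j<k)) (trans eq (cong suc (Finₚ.toℕ-fromℕ< i<k)))) }
    }

  private
    F : ℕ
    F = ℕ.pred (deg G (g Fin.zero))

    deg≥1 : ∀ v → 1 ℕ.≤ deg G v
    deg≥1 v = deg-pos G (proj₂ (hasNbr v))

    deg-g : deg G (g Fin.zero) ≡ suc F
    deg-g = sym (ℕₚ.suc-pred _ {{ℕ.>-nonZero (deg≥1 (g Fin.zero))}})

    pruned : Pruned F G
    pruned = record
      { within = record { deg≥1 = deg≥1 ; deg≤ = λ v → subst (deg G v ℕ.≤_) deg-g (proj₂ (proj₂ big) Fin.zero v) }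
      ; noLeafEdge = noLeafEdge }

    someNonLeaf : ∃ λ v → isNonLeaf G v ≡ true
    someNonLeaf with isNonLeaf G (g Fin.zero) in eq
    ... | true = g Fin.zero , eq
    ... | false = let w , a = hasNbr (g Fin.zero) in w , noLeafEdge _ w a eq

    1≤F : 1 ℕ.≤ F
    1≤F = ℕₚ.≤-pred (ℕₚ.≤-trans (isNonLeaf⇒ G _ (proj₂ someNonLeaf))
      (DegreesWithin.deg≤ (Pruned.within pruned) (proj₁ someNonLeaf)))

    1≤k : 1 ℕ.≤ k
    1≤k = let _ , i<k , _ = Spine.nonleaf⇒ê spine _ (proj₂ someNonLeaf) in ℕₚ.≤-trans (s≤s z≤n) i<k

    -- The part of deg - 1 above the 1 that every nonleaf vertex contributes; at leaves it is 0.
    excess : Fin n → ℤ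
    excess v = f G v - nl G v

    excess-nonneg : ∀ v → 0ℤ ≤ excess v
    excess-nonneg v with isNonLeaf G v in eq
    ... | false = subst (0ℤ ≤_) (sym (ℤₚ.+-identityʳ (f G v))) (f-nonneg G (Pruned.within pruned) v)
    ... | true = 0≤y-x (subst (1ℤ ≤_) (sym (f≡ G v)) (ℤₚ.+-monoˡ-≤ (- 1ℤ) (+≤+ (isNonLeaf⇒ G v eq))))

    deg-g-all : ∀ i → deg G (g i) ≡ suc F
    deg-g-all i = trans (ℕₚ.≤-antisym (proj₂ (proj₂ big) Fin.zero (g i)) (proj₂ (proj₂ big) i (g Fin.zero))) deg-g

    nonleaf-g : ∀ i → isNonLeaf G (g i) ≡ true
    nonleaf-g i = isNonLeaf⇐ G (g i) (subst (2 ℕ.≤_) (sym (deg-g-all i)) (s≤s 1≤F))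

    excess-g : ∀ i → excess (g i) ≡ + F - 1ℤ
    excess-g i = cong₂ _-_ (trans (f≡ G (g i)) (cong (λ d → + d - 1ℤ) (deg-g-all i))) (cong 𝟙 (nonleaf-g i))

    -- The excesses add up to n - 2 - k, and each of the four vertices of maximum degree has excess
    -- F - 1.
    bound : k ℕ.+ 4 ℕ.* F ℕ.≤ n ℕ.+ 2
    bound = ℤₚ.drop‿+≤+ (subst₂ _≤_
      (trans (lhs (+ k) (+ F)) (trans (cong (_+_ (+ k)) (sym (ℤₚ.pos-* 4 F))) (sym (ℤₚ.pos-+ k (4 ℕ.* F)))))
      (trans (rhs (+ k) (+ n)) (sym (ℤₚ.pos-+ n 2)))
      (ℤₚ.+-monoʳ-≤ (+ k + + 4)
        (subst₂ _≤_ (trans (∑-cong excess-g) (∑-const 4 (+ F - 1ℤ)))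
          (trans (∑-- (f G) (nl G)) (cong₂ _-_ (∑-f G spine pruned 1≤k) (∑-nl G spine)))
          (∑-image-≤ g (proj₁ (proj₂ big)) excess excess-nonneg))))
      where
      lhs : ∀ k F → k + + 4 + + 4 * (F - 1ℤ) ≡ k + + 4 * F
      lhs = solve-∀
      rhs : ∀ k n → k + + 4 + (n - + 2 - k) ≡ n + + 2
      rhs = solve-∀

    4≤k : 4 ℕ.≤ k
    4≤k = ℤₚ.drop‿+≤+ (subst₂ _≤_ (trans (∑-cong (λ i → cong 𝟙 (nonleaf-g i))) (∑-const 4 1ℤ)) (∑-nl G spine)
      (∑-image-≤ g (proj₁ (proj₂ big)) (nl G) (λ v → 𝟙-nonneg (isNonLeaf G v))))

  caterpillar : Caterpillar G
  caterpillar = record { F = F ; q = k ; 1≤F = 1≤F ; 4≤q = 4≤k ; pruned = pruned ; spine = spine ; q+4F≤ = bound }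

-- The graph with the same deck

#2 : ∀ {k} → Fin (3 ℕ.+ k)
#2 = Fin.suc #1

#3 : ∀ {k} → Fin (4 ℕ.+ k)
#3 = Fin.suc #2

pick : ∀ {n} (B : Fin n → Bool) {c} → + suc c ≤ ∑ (λ v → 𝟙 (B v)) →
       ∃ λ a → B a ≡ true × + c ≤ ∑ (λ v → 𝟙 (B v ∧ not (v == a)))
pick {n} B {c} c<∑ with a , 0<Ba ← ∑-pos (λ v → 𝟙 (B v)) (ℤₚ.<-≤-trans (+<+ (s≤s z≤n)) c<∑) = a , Ba , rest
  where
  Ba : B a ≡ true
  Ba = 𝟙-pos (B a) 0<Ba
  drop-one : ∀ v → 𝟙 (B v) ≡ 𝟙 (v == a) * 1ℤ + 𝟙 (B v ∧ not (v == a))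
  drop-one v with v Fin.≟ a
  ... | yes refl rewrite Ba = refl
  ... | no _ with B v
  ...   | true = refl
  ...   | false = refl
  rest : + c ≤ ∑ (λ v → 𝟙 (B v ∧ not (v == a)))
  rest = subst₂ _≤_ (cancel (+ c)) (cancel _) (ℤₚ.+-monoʳ-≤ (- 1ℤ) (subst (+ suc c ≤_)
    (trans (∑-cong drop-one) (trans (∑-+ (λ v → 𝟙 (v == a) * 1ℤ) _) (cong (_+ ∑ (λ v → 𝟙 (B v ∧ not (v == a)))) (∑-δ a (λ _ → 1ℤ))))) c<∑))
    where
    cancel : ∀ x → - 1ℤ + (1ℤ + x) ≡ x
    cancel = solve-∀

∧-true : ∀ {a b} → a ∧ b ≡ true → a ≡ true × b ≡ true
∧-true {true} eq = refl , eq
∧-true {false} ()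

not-== : ∀ {n} {u v : Fin n} → not (u == v) ≡ true → u ≢ v
not-== {u = u} eq refl with () ← trans (sym eq) (cong not (==-refl u))

pickTwo : ∀ {n} (B : Fin n → Bool) → + 2 ≤ ∑ (λ v → 𝟙 (B v)) →
          ∃ λ a → ∃ λ b → B a ≡ true × B b ≡ true × b ≢ a
pickTwo B 2≤ with a , Ba , 1≤ ← pick B 2≤ with b , Bb , _ ← pick _ 1≤ =
  a , b , Ba , proj₁ (∧-true Bb) , not-== (proj₂ (∧-true Bb))

pickThree : ∀ {n} (B : Fin n → Bool) → + 3 ≤ ∑ (λ v → 𝟙 (B v)) →
            ∃ λ a → ∃ λ b → ∃ λ c → B a ≡ true × B b ≡ true × B c ≡ true × b ≢ a × c ≢ a × c ≢ b
pickThree B 3≤ with a , Ba , 2≤ ← pick B 3≤ with b , c , Bb , Bc , c≢b ← pickTwo _ 2≤ =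
  a , b , c , Ba , proj₁ (∧-true Bb) , proj₁ (∧-true Bc) , not-== (proj₂ (∧-true Bb)) , not-== (proj₂ (∧-true Bc)) , c≢b

0<1 : 0ℤ < 1ℤ
0<1 = +<+ (s≤s z≤n)

*-cancelˡ-pos : ∀ {c x y} → 0ℤ < c → c * x ≡ c * y → x ≡ y
*-cancelˡ-pos {c} {x} {y} 0<c eq = ℤₚ.*-cancelˡ-≡ c x y {{ℤ.>-nonZero 0<c}} eq

module Pair {n : ℕ} (H G : Graph n) (same : SameDeck H G) where
  Fits : ℕ → Set
  Fits r = r ℕ.* 2 ℕ.≤ n ℕ.+ 2

  transfer : ∀ {r} → Fits r → (e : Expr 0 r) → eval H e [] ≡ eval G e []
  transfer fits = Deck.transfer H G same fits fits

  -- Summing over the k free vertices too gives a closed expression, which the deck transfers; a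
  -- vanishing sum of nonnegative terms has only vanishing terms. This is how a configuration absent
  -- from G is excluded from H, at the price of k vertices.
  vanish : ∀ {k r} → Fits (k ℕ.+ r) → (e : Expr k r) → (∀ x → 0ℤ ≤ eval H e x) → (∀ x → eval G e x ≡ 0ℤ) →
           ∀ x → eval H e x ≡ 0ℤ
  vanish {zero} fits e _ zeroG [] = trans (transfer fits e) (zeroG [])
  vanish {suc k} {r} fits e nonnegH zeroG (u ∷ x) = ∑-zero⁻ (λ u → eval H e (u ∷ x)) (λ u → nonnegH (u ∷ x))
    (vanish (subst Fits (sym (ℕₚ.+-suc k r)) fits) (sumE e) (λ x → ∑-nonneg (λ u → nonnegH (u ∷ x)))
      (λ x → ∑-zero (λ u → zeroG (u ∷ x))) x) u

-- A position on a path has only two neighbouring positions, so two of the three neighbours would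
-- have the same index.
three-on-spine : ∀ {n q} {G : Graph n} → Spine G q → ∀ {v a b c} →
  adj G v a ≡ true → adj G v b ≡ true → adj G v c ≡ true →
  isNonLeaf G a ≡ true → isNonLeaf G b ≡ true → isNonLeaf G c ≡ true → b ≢ a → c ≢ a → c ≢ b → ⊥
three-on-spine {q = q} {G} S {v} va vb vc nla nlb nlc b≢a c≢a c≢b
  with i , i<q , refl ← Spine.nonleaf⇒ê S v (isNonLeaf⇐ G v (two-nbrs G va vb b≢a))
  with j , j<q , refl ← Spine.nonleaf⇒ê S _ nla
  with k , k<q , refl ← Spine.nonleaf⇒ê S _ nlb
  with l , l<q , refl ← Spine.nonleaf⇒ê S _ nlc
  = [ b≢a ∘ cong ê , [ c≢a ∘ cong ê , c≢b ∘ cong ê ]′ ]′ (clash (consec⁻ i<q j<q va) (consec⁻ i<q k<q vb) (consec⁻ i<q l<q vc))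
  where
  open Spine S
  clash : ∀ {i j k l} → (j ≡ suc i ⊎ i ≡ suc j) → (k ≡ suc i ⊎ i ≡ suc k) → (l ≡ suc i ⊎ i ≡ suc l) →
          k ≡ j ⊎ l ≡ j ⊎ l ≡ k
  clash (inj₁ p) (inj₁ r) _        = inj₁ (trans r (sym p))
  clash (inj₂ p) (inj₂ r) _        = inj₁ (ℕₚ.suc-injective (trans (sym r) p))
  clash (inj₁ p) (inj₂ _) (inj₁ r) = inj₂ (inj₁ (trans r (sym p)))
  clash (inj₂ p) (inj₁ _) (inj₂ r) = inj₂ (inj₁ (ℕₚ.suc-injective (trans (sym r) p)))
  clash (inj₁ _) (inj₂ p) (inj₂ r) = inj₂ (inj₂ (ℕₚ.suc-injective (trans (sym r) p)))
  clash (inj₂ _) (inj₁ p) (inj₁ r) = inj₂ (inj₂ (trans r (sym p)))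

-- Degrees and local structure of the other graph

module Recognition {n : ℕ} (48≤n : 48 ℕ.≤ n) (H G : Graph n) (same : SameDeck H G) (C : Caterpillar G) where
  open Pair H G same public
  open Caterpillar C
  private
    withinG = Pruned.within pruned
    c = falling F 0ℤ

    0<c : 0ℤ < c
    0<c = falling-pos F ℤₚ.≤-refl

  fits-≤ : ∀ {r s} → r ℕ.≤ s → Fits s → Fits r
  fits-≤ r≤s = ℕₚ.≤-trans (ℕₚ.*-monoˡ-≤ 2 r≤s)

  -- With 4 ≤ q the bound becomes 4 + 4F ≤ n + 2, which is exactly the room for an edge with a
  -- detector at each end.
  fits-2F : Fits (2 ℕ.+ (F ℕ.+ F))
  fits-2F = ℕₚ.≤-trans (ℕₚ.≤-reflexive eq) (ℕₚ.≤-trans (ℕₚ.+-monoˡ-≤ (4 ℕ.* F) 4≤q) q+4F≤)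
    where
    eq : (2 ℕ.+ (F ℕ.+ F)) ℕ.* 2 ≡ 4 ℕ.+ 4 ℕ.* F
    eq = trans (ℕₚ.*-distribʳ-+ 2 2 (F ℕ.+ F)) (cong (4 ℕ.+_) (trans (cong (λ t → (F ℕ.+ t) ℕ.* 2) (sym (ℕₚ.+-identityʳ F)))
      (trans (ℕₚ.*-comm (2 ℕ.* F) 2) (sym (ℕₚ.*-assoc 2 2 F)))))

  fits-3+F : Fits (3 ℕ.+ F)
  fits-3+F = fits-≤ (s≤s (s≤s (ℕₚ.+-monoˡ-≤ F 1≤F))) fits-2F

  fits-7 : Fits 7
  fits-7 = ℕₚ.≤-trans (ℕₚ.m≤m+n 14 36) (ℕₚ.+-monoˡ-≤ 2 48≤n)

  private
    -- `falling (2 ℕ.+ F)` is applied to F + 2 - deg: degrees up to F + 1 give a zero, larger ones a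
    -- positive value. It is nonnegative at every degree, as `vanish` demands of a graph about which
    -- nothing is known yet.
    deg≤H : ∀ v → deg H v ℕ.≤ suc F
    deg≤H v = ℕₚ.≮⇒≥ (λ big → ℤₚ.<-irrefl (sym (zeroH v)) (falling-pos (2 ℕ.+ F) (subst (λ t → + (2 ℕ.+ F) - t ≤ 0ℤ) (deg≡dg H v) (ℤₚ.i≤j⇒i-j≤0 (+≤+ big)))))
      where
      body : Expr 2 0
      body = cst (+ (2 ℕ.+ F)) ⊗ eqE #0 #1 ⊕ cst (- 1ℤ) ⊗ adjE #1 #0
      e : Expr 1 (2 ℕ.+ F)
      e = polyE (2 ℕ.+ F) #0 body
      value : ∀ (K : Graph n) v → eval K e (v ∷ []) ≡ falling (2 ℕ.+ F) (+ (2 ℕ.+ F) - dg K v)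
      value K v = trans (eval-polyE K (2 ℕ.+ F) #0 body (v ∷ [])) (cong (falling (2 ℕ.+ F)) (trans (∑-+ _ _)
        (cong₂ _+_ (trans (∑-cong (λ u → ℤₚ.*-comm (+ (2 ℕ.+ F)) (𝟙 (u == v)))) (∑-δ v (λ _ → + (2 ℕ.+ F))))
          (trans (∑-*ˡ (- 1ℤ) _) (ℤₚ.-1*i≡-i (dg K v))))))
      zeroH : ∀ v → falling (2 ℕ.+ F) (+ (2 ℕ.+ F) - dg H v) ≡ 0ℤ
      zeroH v = trans (sym (value H v)) (vanish fits-3+F e
        (λ { (v ∷ []) → subst (0ℤ ≤_) (sym (value H v)) (falling-nonneg (2 ℕ.+ F)
               (subst (_≤ + (2 ℕ.+ F)) (cong (λ t → + (2 ℕ.+ F) - t) (deg≡dg H v)) (ℤₚ.i-j≤i (+ (2 ℕ.+ F)) (+ deg H v)))) })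
        (λ { (v ∷ []) → trans (value G v) (small v) }) (v ∷ []))
        where
        small : ∀ v → falling (2 ℕ.+ F) (+ (2 ℕ.+ F) - dg G v) ≡ 0ℤ
        small v = trans (cong (falling (2 ℕ.+ F)) (begin
          + (2 ℕ.+ F) - dg G v               ≡⟨ cong (λ t → + (2 ℕ.+ F) - t) (deg≡dg G v) ⟨
          + (2 ℕ.+ F) - + deg G v            ≡⟨ ℤₚ.m-n≡m⊖n (2 ℕ.+ F) (deg G v) ⟩
          (2 ℕ.+ F) ℤ.⊖ deg G v              ≡⟨ ℤₚ.⊖-≥ (ℕₚ.≤-trans d≤ (ℕₚ.n≤1+n (suc F))) ⟩
          + (suc (suc F) ℕ.∸ deg G v)        ≡⟨ cong +_ (ℕₚ.+-∸-assoc 1 d≤) ⟩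
          + suc (suc F ℕ.∸ deg G v) ∎))
          (falling-zero (2 ℕ.+ F) (suc F ℕ.∸ deg G v) (s≤s (ℕₚ.m∸n≤m (suc F) (deg G v))))
          where
          open ≡-Reasoning
          d≤ : deg G v ℕ.≤ suc F
          d≤ = DegreesWithin.deg≤ withinG v

    -- The same method with deg itself as the argument; nonnegativity on H now rests on the upper
    -- bound just obtained.
    deg≥1H : ∀ v → 1 ℕ.≤ deg H v
    deg≥1H v = ℕₚ.≮⇒≥ (λ { (s≤s d≤0) → ℤₚ.<-irrefl (sym (zeroH v)) (falling-pos (1 ℕ.+ F) (subst (_≤ 0ℤ) (deg≡dg H v) (+≤+ d≤0))) })
      where
      e : Expr 1 (1 ℕ.+ F)
      e = polyE (1 ℕ.+ F) #0 (adjE #1 #0)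
      value : ∀ (K : Graph n) v → eval K e (v ∷ []) ≡ falling (1 ℕ.+ F) (dg K v)
      value K v = eval-polyE K (1 ℕ.+ F) #0 (adjE #1 #0) (v ∷ [])
      zeroH : ∀ v → falling (1 ℕ.+ F) (dg H v) ≡ 0ℤ
      zeroH v = trans (sym (value H v)) (vanish (fits-≤ (ℕₚ.n≤1+n (2 ℕ.+ F)) fits-3+F) e
        (λ { (v ∷ []) → subst (0ℤ ≤_) (sym (value H v)) (falling-nonneg (1 ℕ.+ F) (subst (_≤ + (1 ℕ.+ F)) (deg≡dg H v) (+≤+ (deg≤H v)))) })
        (λ { (v ∷ []) → trans (value G v) (small v) }) (v ∷ []))
        where
        small : ∀ v → falling (1 ℕ.+ F) (dg G v) ≡ 0ℤ
        small v with deg G v in eq | DegreesWithin.deg≥1 withinG v | DegreesWithin.deg≤ withinG v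
        ... | suc d | _ | d<F = trans (cong (falling (1 ℕ.+ F)) (trans (sym (deg≡dg G v)) (cong +_ eq))) (falling-zero (1 ℕ.+ F) d d<F)

    withinH : DegreesWithin F H
    withinH = record { deg≥1 = deg≥1H ; deg≤ = deg≤H }

    -- Detectors at both ends of an edge have a nonzero product exactly when both ends are leaves,
    -- which does not happen in G.
    noLeafEdgeH : ∀ u v → adj H u v ≡ true → isNonLeaf H u ≡ false → isNonLeaf H v ≡ true
    noLeafEdgeH u v uv leaf-u with isNonLeaf H v in leaf-v
    ... | true = refl
    ... | false = contradiction (trans (sym (value H withinH u v)) zeroH) (λ eq → ℤₚ.<-irrefl (sym eq) positive)
      where
      e : Expr 2 (F ℕ.+ F)
      e = adjE #1 #0 ⊗ (leafE F #1 #0 ⊗ leafE F #0 #1)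
      product : Graph n → Fin n → Fin n → ℤ
      product K v w = 𝟙 (adj K v w) * (c * (1ℤ - nl K v) * (c * (1ℤ - nl K w)))
      value : ∀ (K : Graph n) → DegreesWithin F K → ∀ v w → eval K e (w ∷ v ∷ []) ≡ product K v w
      value K wK v w = guarded K wK (adj K v w) (λ vw → cong₂ _*_ (eval-leafE-adj K wK #1 #0 (w ∷ v ∷ []) vw)
        (eval-leafE-adj K wK #0 #1 (w ∷ v ∷ []) (trans (adj-sym K w v) vw)))
      nonneg : ∀ K v w → 0ℤ ≤ product K v w
      nonneg K v w = *-nonneg (𝟙-nonneg (adj K v w)) (*-nonneg (*-nonneg (ℤₚ.<⇒≤ 0<c) (0≤y-x (𝟙-≤1 (isNonLeaf K v))))
        (*-nonneg (ℤₚ.<⇒≤ 0<c) (0≤y-x (𝟙-≤1 (isNonLeaf K w)))))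
      killˡ : ∀ a x y → a * (x * 0ℤ * y) ≡ 0ℤ
      killˡ = solve-∀
      killʳ : ∀ a x y → a * (x * (y * 0ℤ)) ≡ 0ℤ
      killʳ = solve-∀
      zeroG : ∀ v w → product G v w ≡ 0ℤ
      zeroG v w with adj G v w in vw
      ... | false = refl
      ... | true with isNonLeaf G v in nl-v
      ...   | true = killˡ 1ℤ c (c * (1ℤ - nl G w))
      ...   | false rewrite Pruned.noLeafEdge pruned v w vw nl-v = killʳ 1ℤ (c * 1ℤ) c
      zeroH : eval H e (v ∷ u ∷ []) ≡ 0ℤ
      zeroH = vanish fits-2F e (λ { (w ∷ v ∷ []) → subst (0ℤ ≤_) (sym (value H withinH v w)) (nonneg H v w) })
        (λ { (w ∷ v ∷ []) → trans (value G withinG v w) (zeroG v w) }) (v ∷ u ∷ [])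
      positive : 0ℤ < product H u v
      positive rewrite uv | leaf-u | leaf-v = *-pos 0<1 (*-pos 0<c1 0<c1)
        where
        0<c1 : 0ℤ < c * 1ℤ
        0<c1 = *-pos 0<c 0<1

  prunedH : Pruned F H
  prunedH = record { within = withinH ; noLeafEdge = noLeafEdgeH }

  private
    f-pos⇒ : ∀ (K : Graph n) → DegreesWithin F K → ∀ {v} → 0ℤ < f K v → isNonLeaf K v ≡ true
    f-pos⇒ K wK {v} 0<f with isNonLeaf K v in eq
    ... | true = refl
    ... | false = contradiction (f-leaf K wK (cong 𝟙 eq)) (λ eq → ℤₚ.<-irrefl (sym eq) 0<f)

    f-pos : ∀ (K : Graph n) {v} → isNonLeaf K v ≡ true → 0ℤ < f K v
    f-pos K {v} nl = ℤₚ.<-≤-trans (+<+ (s≤s z≤n)) (subst (1ℤ ≤_) (sym (f≡ K v)) (ℤₚ.+-monoˡ-≤ (- 1ℤ) (+≤+ (isNonLeaf⇒ K v nl))))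

  -- Nonleaf vertices are recognized here by deg - 1 > 0 instead of a detector. Four vertices and
  -- three degrees make seven, whatever F is.
  noThree : ∀ {v a b c} → adj H v a ≡ true → adj H v b ≡ true → adj H v c ≡ true →
            isNonLeaf H a ≡ true → isNonLeaf H b ≡ true → isNonLeaf H c ≡ true → b ≢ a → c ≢ a → c ≢ b → ⊥
  noThree {v} {a} {b} {c} va vb vc nla nlb nlc b≢a c≢a c≢b =
    ℤₚ.<-irrefl (sym (trans (sym (value H v a b c)) zeroH)) positive
    where
    e : Expr 4 3
    e = adjE #3 #2 ⊗ (adjE #3 #1 ⊗ (adjE #3 #0 ⊗ (awayE #2 #1 ⊗ (awayE #2 #0 ⊗ (awayE #1 #0 ⊗ (fE #2 ⊗ (fE #1 ⊗ fE #0)))))))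
    product : Graph n → Fin n → Fin n → Fin n → Fin n → ℤ
    product K v a b c = 𝟙 (adj K v a) * (𝟙 (adj K v b) * (𝟙 (adj K v c) *
      (away a b * (away a c * (away b c * (f K a * (f K b * f K c)))))))
    value : ∀ K v a b c → eval K e (c ∷ b ∷ a ∷ v ∷ []) ≡ product K v a b c
    value K v a b c = cong (_*_ (𝟙 (adj K v a))) (cong (_*_ (𝟙 (adj K v b))) (cong (_*_ (𝟙 (adj K v c)))
      (cong₂ _*_ (eval-awayE K #2 #1 x) (cong₂ _*_ (eval-awayE K #2 #0 x) (cong₂ _*_ (eval-awayE K #1 #0 x)
        (cong₂ _*_ (eval-fE K #2 x) (cong₂ _*_ (eval-fE K #1 x) (eval-fE K #0 x))))))))
      where
      x : Vec (Fin n) 4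
      x = c ∷ b ∷ a ∷ v ∷ []
    module _ (K : Graph n) (wK : DegreesWithin F K) (v a b c : Fin n) where
      n7 = *-nonneg (f-nonneg K wK a) (*-nonneg (f-nonneg K wK b) (f-nonneg K wK c))
      n6 = *-nonneg (away-nonneg b c) n7
      n5 = *-nonneg (away-nonneg a c) n6
      n4 = *-nonneg (away-nonneg a b) n5
      n3 = *-nonneg (𝟙-nonneg (adj K v c)) n4
      n2 = *-nonneg (𝟙-nonneg (adj K v b)) n3
      nonneg : 0ℤ ≤ product K v a b c
      nonneg = *-nonneg (𝟙-nonneg (adj K v a)) n2
    zeroG : ∀ v a b c → product G v a b c ≡ 0ℤ
    zeroG v a b c = ℤₚ.≤-antisym (ℤₚ.≮⇒≥ λ p1 →
      let w = withinG
          p2 = *-posʳ (𝟙-nonneg (adj G v a)) (n2 G w v a b c) p1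
          p3 = *-posʳ (𝟙-nonneg (adj G v b)) (n3 G w v a b c) p2
          p4 = *-posʳ (𝟙-nonneg (adj G v c)) (n4 G w v a b c) p3
          p5 = *-posʳ (away-nonneg a b) (n5 G w v a b c) p4
          p6 = *-posʳ (away-nonneg a c) (n6 G w v a b c) p5
          p7 = *-posʳ (away-nonneg b c) (n7 G w v a b c) p6
          n8 = *-nonneg (f-nonneg G w b) (f-nonneg G w c)
          p8 = *-posʳ (f-nonneg G w a) n8 p7
      in three-on-spine spine
        (𝟙-pos (adj G v a) (*-posˡ (𝟙-nonneg (adj G v a)) (n2 G w v a b c) p1)) (𝟙-pos (adj G v b) (*-posˡ (𝟙-nonneg (adj G v b)) (n3 G w v a b c) p2))
        (𝟙-pos (adj G v c) (*-posˡ (𝟙-nonneg (adj G v c)) (n4 G w v a b c) p3))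
        (f-pos⇒ G w (*-posˡ (f-nonneg G w a) n8 p7)) (f-pos⇒ G w (*-posˡ (f-nonneg G w b) (f-nonneg G w c) p8))
        (f-pos⇒ G w (*-posʳ (f-nonneg G w b) (f-nonneg G w c) p8))
        (away-pos (*-posˡ (away-nonneg a b) (n5 G w v a b c) p4)) (away-pos (*-posˡ (away-nonneg a c) (n6 G w v a b c) p5))
        (away-pos (*-posˡ (away-nonneg b c) (n7 G w v a b c) p6)))
      (nonneg G withinG v a b c)
    zeroH : eval H e (c ∷ b ∷ a ∷ v ∷ []) ≡ 0ℤ
    zeroH = vanish fits-7 e (λ { (c ∷ b ∷ a ∷ v ∷ []) → subst (0ℤ ≤_) (sym (value H v a b c)) (nonneg H withinH v a b c) })
      (λ { (c ∷ b ∷ a ∷ v ∷ []) → trans (value G v a b c) (zeroG v a b c) }) (c ∷ b ∷ a ∷ v ∷ [])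
    positive : 0ℤ < product H v a b c
    positive rewrite va | vb | vc | away-≢ b≢a | away-≢ c≢a | away-≢ c≢b =
      *-pos 0<1 (*-pos 0<1 (*-pos 0<1 (*-pos 0<1 (*-pos 0<1 (*-pos 0<1 (*-pos (f-pos H nla) (*-pos (f-pos H nlb) (f-pos H nlc))))))))

  -- Leaves are counted instead. The detector has to discount a given neighbour, and since a leaf
  -- has exactly one, summing over that neighbour counts each leaf once.
  ∑-nlH : ∑ (nl H) ≡ + q
  ∑-nlH = trans (fromLeaves H) (trans (cong (λ t → + n - t) leaves≡) (trans (sym (fromLeaves G)) (∑-nl G spine)))
    where
    e : Expr 0 (2 ℕ.+ F)
    e = sumE (sumE (adjE #1 #0 ⊗ leafE F #1 #0))
    leaves : Graph n → ℤ
    leaves K = ∑ (λ v → 1ℤ - nl K v)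
    fromLeaves : ∀ K → ∑ (nl K) ≡ + n - leaves K
    fromLeaves K = trans (back (∑ (nl K)) (+ n)) (cong (λ t → + n - t)
      (sym (trans (∑-- (λ _ → 1ℤ) (nl K)) (cong (_- ∑ (nl K)) (trans (∑-const n 1ℤ) (ℤₚ.*-identityʳ (+ n)))))))
      where
      back : ∀ x n → x ≡ n - (n - x)
      back = solve-∀
    value : ∀ K → DegreesWithin F K → eval K e [] ≡ c * leaves K
    value K wK = trans (∑-cong (λ v → trans (∑-cong (λ w → guarded K wK (adj K v w)
      (eval-leafE-adj K wK #1 #0 (w ∷ v ∷ [])))) (trans (∑-*ʳ (c * (1ℤ - nl K v)) (λ w → 𝟙 (adj K v w))) (one v)))) (∑-*ˡ c (λ v → 1ℤ - nl K v))
      where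
      one : ∀ v → dg K v * (c * (1ℤ - nl K v)) ≡ c * (1ℤ - nl K v)
      one v with isNonLeaf K v in eq
      ... | true = trans (cong (_*_ (dg K v)) (ℤₚ.*-zeroʳ c)) (trans (ℤₚ.*-zeroʳ (dg K v)) (sym (ℤₚ.*-zeroʳ c)))
      ... | false = trans (cong (_* (c * 1ℤ)) (trans (sym (deg≡dg K v))
        (cong +_ (ℕₚ.≤-antisym (isLeaf⇒ K v eq) (DegreesWithin.deg≥1 wK v))))) (ℤₚ.*-identityˡ (c * 1ℤ))
    leaves≡ : leaves H ≡ leaves G
    leaves≡ = *-cancelˡ-pos 0<c (trans (sym (value H withinH))
      (trans (transfer (fits-≤ (ℕₚ.n≤1+n (2 ℕ.+ F)) fits-3+F) e) (value G withinG)))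

  ∑-innerDegH : ∑ (λ v → nl H v * innerDeg H v) ≡ + q + + q - + 2
  ∑-innerDegH = trans
    (*-cancelˡ-pos 0<c (*-cancelˡ-pos 0<c (trans (sym (value H withinH)) (trans (transfer fits-2F e) (value G withinG)))))
    (∑-innerDeg G spine (ℕₚ.≤-trans (s≤s z≤n) 4≤q))
    where
    e : Expr 0 (2 ℕ.+ (F ℕ.+ F))
    e = sumE (sumE (adjE #1 #0 ⊗ (nonLeafE F #1 #0 ⊗ nonLeafE F #0 #1)))
    value : ∀ K → DegreesWithin F K → eval K e [] ≡ c * (c * ∑ (λ v → nl K v * innerDeg K v))
    value K wK = trans (∑-cong (λ v → trans (∑-cong (λ w → trans (guarded K wK (adj K v w) (λ vw →
        cong₂ _*_ (eval-nonLeafE K wK #1 #0 (w ∷ v ∷ []) vw) (eval-nonLeafE K wK #0 #1 (w ∷ v ∷ []) (trans (adj-sym K w v) vw))))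
        (factor c (𝟙 (adj K v w)) (nl K v) (nl K w)))) (trans (∑-*ˡ (c * c * nl K v) (λ w → 𝟙 (adj K v w) * nl K w))
          (ℤₚ.*-assoc (c * c) (nl K v) (innerDeg K v)))))
      (trans (∑-*ˡ (c * c) (λ v → nl K v * innerDeg K v)) (ℤₚ.*-assoc c c _))
      where
      factor : ∀ c a x y → a * (c * x * (c * y)) ≡ c * c * x * (a * y)
      factor = solve-∀

  walks-≡ : ∀ k ks e → Fits (suc (suc (k ℕ.+ (F ℕ.+ rank ks e)))) → walks H k ks e ≡ walks G k ks e
  walks-≡ k ks e fits = *-cancelˡ-pos 0<c (trans (sym (eval-walksE H withinH k ks e))
    (trans (transfer fits (walksE F k ks e)) (eval-walksE G withinG k ks e)))

  start-≡ : ∀ ks e → Fits (2 ℕ.+ (F ℕ.+ rank ks e)) → start H ks e ≡ start G ks e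
  start-≡ []       e fits = cong (_*_ (+ 2)) (trans (sym (value H)) (trans
      (transfer (fits-≤ (s≤s (ℕₚ.≤-trans (ℕₚ.m≤n+m (suc e) F) (ℕₚ.n≤1+n _))) fits) (sumE (powE (suc e) #0))) (value G)))
    where
    value : ∀ K → eval K (sumE (powE (suc e) #0)) [] ≡ ∑ (λ v → f K v ^ suc e)
    value K = ∑-cong (λ v → eval-powE K (suc e) #0 (v ∷ []))
  start-≡ (k ∷ ks) e fits = walks-≡ k ks e (fits-≤ (s≤s (s≤s (ℕₚ.≤-trans (ℕₚ.≤-reflexive eq) (ℕₚ.n≤1+n _)))) (subst Fits (cong (2 ℕ.+_) shift) fits))
    where
    eq : k ℕ.+ (F ℕ.+ rank ks e) ≡ F ℕ.+ (k ℕ.+ rank ks e)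
    eq = trans (sym (ℕₚ.+-assoc k F _)) (trans (cong (ℕ._+ rank ks e) (ℕₚ.+-comm k F)) (ℕₚ.+-assoc F k _))
    shift : F ℕ.+ (k ℕ.+ suc (rank ks e)) ≡ suc (F ℕ.+ (k ℕ.+ rank ks e))
    shift = trans (cong (F ℕ.+_) (ℕₚ.+-suc k _)) (ℕₚ.+-suc F _)

  start-walks-≡ : ∀ ks e → Fits (2 ℕ.+ (F ℕ.+ rank ks e)) →
                  start H ks e - walks H 0 ks e ≡ start G ks e - walks G 0 ks e
  start-walks-≡ ks e fits = cong₂ _-_ (start-≡ ks e fits) (walks-≡ 0 ks e fits)

  correlation-≡ : ∀ ks → Fits (3 ℕ.+ rank ks 0) → correlation H ks ≡ correlation G ks
  correlation-≡ ks fits = trans (sym (eval-correlationE H ks)) (trans (transfer fits (correlationE ks)) (eval-correlationE G ks))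

-- A long chain of nonleaf vertices that begins at an end

∣tabulate∣ : ∀ {n} (B : Fin n → Bool) → + ∣ Vec.tabulate B ∣ ≡ ∑ (λ v → 𝟙 (B v))
∣tabulate∣ {zero}  B = sym (∑-[] _)
∣tabulate∣ {suc n} B with B Fin.zero in eq
... | true  = trans (cong (λ t → 1ℤ + t) (∣tabulate∣ (B ∘ Fin.suc))) (sym (trans (∑-∷ _) (cong (λ b → 𝟙 b + ∑ (λ v → 𝟙 (B (Fin.suc v)))) eq)))
... | false = trans (∣tabulate∣ (B ∘ Fin.suc)) (sym (trans (∑-∷ _) (trans (cong (λ b → 𝟙 b + ∑ (λ v → 𝟙 (B (Fin.suc v)))) eq) (ℤₚ.+-identityˡ _))))

*-pos⁻ : ∀ {x y} → 0ℤ ≤ x → 0ℤ < x * y → 0ℤ < x × 0ℤ < y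
*-pos⁻ {+ zero} _ (+<+ ())
*-pos⁻ {+ suc a} {+ zero} _ p = contradiction (subst (0ℤ <_) (ℤₚ.*-zeroʳ (+ suc a)) p) (ℤₚ.<-irrefl refl)
*-pos⁻ {+ suc a} {+ suc b} _ p = +<+ (s≤s z≤n) , +<+ (s≤s z≤n)
*-pos⁻ {+ suc a} { -[1+ b ]} _ ()

∑-pos³ : ∀ {n} (a x y : Fin n → ℤ) → (∀ u → 0ℤ ≤ a u) → (∀ u → 0ℤ ≤ x u) → 0ℤ < ∑ (λ u → a u * (x u * y u)) →
         ∃ λ u → 0ℤ < a u × 0ℤ < x u × 0ℤ < y u
∑-pos³ a x y 0≤a 0≤x 0<∑ =
  let u , 0<axy = ∑-pos (λ u → a u * (x u * y u)) 0<∑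
      0<a , 0<xy = *-pos⁻ {a u} {x u * y u} (0≤a u) 0<axy
  in u , 0<a , *-pos⁻ {x u} {y u} (0≤x u) 0<xy

zeros : ℕ → List ℕ
zeros c = List.replicate c 0

module _ {n : ℕ} (G : Graph n) where
  private
    blocked : Fin n → Fin n → ℤ
    blocked v w = ∑ (λ u → 𝟙 (adj G v u) * (nl G u * away w u))

  -- The longer walks are grouped by their second and third vertices v and w. Their first vertex
  -- ranges over the nonleaf neighbours of v other than w, and `blocked v w` is the number of these.
  walks-difference : ∀ ks e → walks G 0 ks e - walks G 0 (0 ∷ ks) e ≡
    ∑ (λ v → ∑ (λ w → 𝟙 (adj G v w) * (ext G ks e v w * (nl G v - blocked v w))))
  walks-difference ks e = begin
    walks G 0 ks e - walks G 0 (0 ∷ ks) e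
      ≡⟨ cong (λ t → walks G 0 ks e - t) shifted ⟩
    walks G 0 ks e - ∑ (λ v → ∑ (λ w → 𝟙 (adj G v w) * (ext G ks e v w * blocked v w)))
      ≡⟨ trans (∑-cong (λ v → ∑-- _ _)) (∑-- _ _) ⟨
    ∑ (λ v → ∑ (λ w → 𝟙 (adj G v w) * (1ℤ * (nl G v * ext G ks e v w)) - 𝟙 (adj G v w) * (ext G ks e v w * blocked v w)))
      ≡⟨ ∑-cong (λ v → ∑-cong (λ w → collect (𝟙 (adj G v w)) (nl G v) (ext G ks e v w) (blocked v w))) ⟩
    ∑ (λ v → ∑ (λ w → 𝟙 (adj G v w) * (ext G ks e v w * (nl G v - blocked v w)))) ∎
    where
    open ≡-Reasoning
    collect : ∀ a b x y → a * (1ℤ * (b * x)) - a * (x * y) ≡ a * (x * (b - y))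
    collect = solve-∀
    spread : ∀ a b x → a * (1ℤ * (b * (1ℤ * x))) ≡ (a * b) * x
    spread = solve-∀
    regroup : ∀ a b c d x → (a * b) * (c * (d * x)) ≡ (c * x) * (a * (b * d))
    regroup = solve-∀
    away-comm : ∀ u w → away u w ≡ away w u
    away-comm u w = cong (λ b → 1ℤ - 𝟙 b) (==-comm w u)
    shifted : walks G 0 (0 ∷ ks) e ≡ ∑ (λ v → ∑ (λ w → 𝟙 (adj G v w) * (ext G ks e v w * blocked v w)))
    shifted = begin
      ∑ (λ u → ∑ (λ v → 𝟙 (adj G u v) * (1ℤ * (nl G u * (1ℤ * tail u v)))))
        ≡⟨ ∑-cong (λ u → ∑-cong (λ v → trans (spread (𝟙 (adj G u v)) (nl G u) (tail u v)) (sym (∑-*ˡ (𝟙 (adj G u v) * nl G u) _)))) ⟩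
      ∑ (λ u → ∑ (λ v → ∑ (λ w → (𝟙 (adj G u v) * nl G u) * (𝟙 (adj G v w) * (away u w * ext G ks e v w)))))
        ≡⟨ ∑-swap _ ⟩
      ∑ (λ v → ∑ (λ u → ∑ (λ w → (𝟙 (adj G u v) * nl G u) * (𝟙 (adj G v w) * (away u w * ext G ks e v w)))))
        ≡⟨ ∑-cong (λ v → ∑-swap _) ⟩
      ∑ (λ v → ∑ (λ w → ∑ (λ u → (𝟙 (adj G u v) * nl G u) * (𝟙 (adj G v w) * (away u w * ext G ks e v w)))))
        ≡⟨ ∑-cong (λ v → ∑-cong (λ w → trans (∑-cong (λ u → trans
             (regroup (𝟙 (adj G u v)) (nl G u) (𝟙 (adj G v w)) (away u w) (ext G ks e v w))
             (cong₂ (λ a b → (𝟙 (adj G v w) * ext G ks e v w) * (𝟙 a * (nl G u * b))) (adj-sym G u v) (away-comm u w))))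
             (trans (∑-*ˡ (𝟙 (adj G v w) * ext G ks e v w) (λ u → 𝟙 (adj G v u) * (nl G u * away w u)))
                    (ℤₚ.*-assoc (𝟙 (adj G v w)) (ext G ks e v w) (blocked v w))))) ⟩
      ∑ (λ v → ∑ (λ w → 𝟙 (adj G v w) * (ext G ks e v w * blocked v w))) ∎
      where
      tail : Fin n → Fin n → ℤ
      tail u v = ∑ (λ w → 𝟙 (adj G v w) * (away u w * ext G ks e v w))

  record Beginning (ks : List ℕ) (e : ℕ) : Set where
    field
      v₀ w₀  : Fin n
      v₀w₀   : adj G v₀ w₀ ≡ true
      nl-v₀  : isNonLeaf G v₀ ≡ true
      only   : ∀ u → adj G v₀ u ≡ true → isNonLeaf G u ≡ true → u ≡ w₀
      0<ext  : 0ℤ < ext G ks e v₀ w₀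

  -- A positive sum has a positive term, and `nl G v - blocked v w` is positive only if v is a
  -- nonleaf vertex without nonleaf neighbours besides w.
  beginning : ∀ {F} → DegreesWithin F G → ∀ ks e → 0ℤ < walks G 0 ks e - walks G 0 (0 ∷ ks) e → Beginning ks e
  beginning within ks e 0<D = locate (∑-pos (λ v → ∑ (λ w → 𝟙 (adj G v w) * (ext G ks e v w * (nl G v - blocked v w))))
    (subst (0ℤ <_) (walks-difference ks e) 0<D))
    where
    module _ (v w : Fin n) (0<gap : 0ℤ < nl G v - blocked v w) where
      blocked-nonneg : ∀ u → 0ℤ ≤ 𝟙 (adj G v u) * (nl G u * away w u)
      blocked-nonneg u = *-nonneg (𝟙-nonneg (adj G v u)) (*-nonneg (𝟙-nonneg (isNonLeaf G u)) (away-nonneg w u))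
      blocked<nl : blocked v w < nl G v
      blocked<nl = ℤₚ.≰⇒> (λ nl≤ → ℤₚ.<⇒≱ 0<gap (ℤₚ.i≤j⇒i-j≤0 nl≤))
      nonleaf : isNonLeaf G v ≡ true
      nonleaf = 𝟙-pos (isNonLeaf G v) (ℤₚ.≤-<-trans (∑-nonneg blocked-nonneg) blocked<nl)
      only : ∀ u → adj G v u ≡ true → isNonLeaf G u ≡ true → u ≡ w
      only u vu nlu with u Fin.≟ w
      ... | yes eq = eq
      ... | no u≢w = contradiction (ℤₚ.≤-<-trans
              (ℤₚ.≤-trans (≡⇒≤ (sym one)) (≤-∑ (λ u → 𝟙 (adj G v u) * (nl G u * away w u)) blocked-nonneg u)) blocked<nl)
              (ℤₚ.≤⇒≯ (𝟙-≤1 (isNonLeaf G v)))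
        where
        one : 𝟙 (adj G v u) * (nl G u * away w u) ≡ 1ℤ
        one = cong₂ _*_ (cong 𝟙 vu) (cong₂ _*_ (cong 𝟙 nlu) (away-≢ u≢w))
    locate : (∃ λ v → 0ℤ < ∑ (λ w → 𝟙 (adj G v w) * (ext G ks e v w * (nl G v - blocked v w)))) → Beginning ks e
    locate (v , 0<v) =
      let w , 0<adj , 0<ext , 0<gap = ∑-pos³ (λ w → 𝟙 (adj G v w)) (λ w → ext G ks e v w) (λ w → nl G v - blocked v w)
            (λ w → 𝟙-nonneg (adj G v w)) (λ w → ext-nonneg G within ks e v w) 0<v
      in record { v₀ = v ; w₀ = w ; v₀w₀ = 𝟙-pos (adj G v w) 0<adj ; nl-v₀ = nonleaf v w 0<gap ; only = only v w 0<gap ; 0<ext = 0<ext }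

-- The nonleaf vertices met by a nonbacktracking walk from v₀ through w₀, followed
-- until it stops; in a graph where no vertex has three nonleaf neighbours the
-- walk has no choice.
module Chain {n F : ℕ} (H : Graph n) (pruned : Pruned F H)
  (noThree : ∀ {v a b c} → adj H v a ≡ true → adj H v b ≡ true → adj H v c ≡ true →
             isNonLeaf H a ≡ true → isNonLeaf H b ≡ true → isNonLeaf H c ≡ true → b ≢ a → c ≢ a → c ≢ b → ⊥)
  {ks : List ℕ} {e : ℕ} (B : Beginning H ks e) where
  open Beginning B
  private within = Pruned.within pruned

  Step : Fin n → Fin n → Fin n → Set
  Step v w u = adj H w u ≡ true × isNonLeaf H u ≡ true × u ≢ v

  step? : ∀ v w → Dec (∃ (Step v w))
  step? v w = Finₚ.any? (λ u → (adj H w u Bool.≟ true) ×-dec ((isNonLeaf H u Bool.≟ true) ×-dec ¬? (u Fin.≟ v)))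

  chain : ℕ → Fin n × Fin n
  chain zero = v₀ , w₀
  chain (suc i) with step? (proj₁ (chain i)) (proj₂ (chain i))
  ... | yes (u , _) = proj₂ (chain i) , u
  -- A junk value: the walk has stopped, and nothing is claimed about later positions.
  ... | no _ = proj₂ (chain i) , v₀

  ĉ : ℕ → Fin n
  ĉ i = proj₁ (chain i)

  chain₂ : ∀ i → proj₂ (chain i) ≡ ĉ (suc i)
  chain₂ i with step? (proj₁ (chain i)) (proj₂ (chain i))
  ... | yes _ = refl
  ... | no _ = refl

  Alive : ℕ → Set
  Alive i = ∃ (Step (ĉ i) (ĉ (suc i)))

  alive? : ∀ i → Dec (Alive i)
  alive? i = step? (ĉ i) (ĉ (suc i))

  alive-step : ∀ i → Alive i → Step (ĉ i) (ĉ (suc i)) (ĉ (suc (suc i)))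
  alive-step i alive = subst₂ (λ w u → Step (ĉ i) w u) (chain₂ i) (chain₂ (suc i)) (stepped (subst (λ w → ∃ (Step (ĉ i) w)) (sym (chain₂ i)) alive))
    where
    stepped : ∃ (Step (ĉ i) (proj₂ (chain i))) → Step (ĉ i) (proj₂ (chain i)) (proj₂ (chain (suc i)))
    stepped alive with step? (proj₁ (chain i)) (proj₂ (chain i))
    ... | yes (_ , s) = s
    ... | no dead = contradiction alive dead

  nl-w₀ : isNonLeaf H w₀ ≡ true
  nl-w₀ with isNonLeaf H w₀ in eq
  ... | true = refl
  ... | false = contradiction (ext-leaf {q = 0} within ks e v₀w₀ eq) (λ eq → ℤₚ.<-irrefl (sym eq) 0<ext)

  module UpTo (D : ℕ) (alive : ∀ {i} → i ℕ.< D → Alive i) where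
    -- The vertices `v₀` and `w₀`, and one more for each possible step.
    p : ℕ
    p = 2 ℕ.+ D

    ĉ-nonleaf : ∀ {i} → i ℕ.< p → isNonLeaf H (ĉ i) ≡ true
    ĉ-nonleaf {zero} _ = nl-v₀
    ĉ-nonleaf {suc zero} _ = subst (λ u → isNonLeaf H u ≡ true) (chain₂ 0) nl-w₀
    ĉ-nonleaf {suc (suc i)} (s≤s (s≤s i<D)) = proj₁ (proj₂ (alive-step i (alive i<D)))

    ĉ-adj : ∀ {i} → suc i ℕ.< p → adj H (ĉ i) (ĉ (suc i)) ≡ true
    ĉ-adj {zero} _ = subst (λ u → adj H v₀ u ≡ true) (chain₂ 0) v₀w₀
    ĉ-adj {suc i} (s≤s (s≤s i<D)) = proj₁ (alive-step i (alive i<D))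

    ĉ-straight : ∀ {i} → i ℕ.< D → ĉ (suc (suc i)) ≢ ĉ i
    ĉ-straight {i} i<D = proj₂ (proj₂ (alive-step i (alive i<D)))

    -- At `v₀` this is `only`. Elsewhere predecessor and successor are two nonleaf neighbours
    -- already, and `noThree` forbids another.
    nbrs : ∀ {i} → suc i ℕ.< p → ∀ u → adj H (ĉ i) u ≡ true → isNonLeaf H u ≡ true →
           u ≡ ĉ (suc i) ⊎ ∃ λ j → i ≡ suc j × u ≡ ĉ j
    nbrs {zero} _ u a nl = inj₁ (trans (only u a nl) (chain₂ 0))
    nbrs {suc i} (s≤s (s≤s i<D)) u a nl with u Fin.≟ ĉ (suc (suc i)) | u Fin.≟ ĉ i
    ... | yes eq | _ = inj₁ eq
    ... | no _ | yes eq = inj₂ (i , refl , eq)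
    ... | no u≢ | no u≢′ = ⊥-elim (noThree (trans (adj-sym H _ _) (ĉ-adj i<p)) (ĉ-adj (s≤s (s≤s i<D))) a
            (ĉ-nonleaf (ℕₚ.<-trans (ℕₚ.n<1+n i) i<p)) (ĉ-nonleaf (s≤s (s≤s i<D))) nl (ĉ-straight i<D) u≢′ u≢)
      where
      i<p : suc i ℕ.< p
      i<p = ℕₚ.<-trans (ℕₚ.n<1+n _) (s≤s (s≤s i<D))

    no-loop : ∀ {v} → adj H v v ≡ true → ⊥
    no-loop {v} a with () ← trans (sym a) (irrefl H v)

    -- If position j + 1 repeated `ĉ i`, then `ĉ j` would be a nonleaf neighbour of `ĉ i` and so
    -- equal to `ĉ (i + 1)` or `ĉ (i - 1)`. That is an earlier repetition, a loop, or a step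
    -- straight back.
    ĉ-distinct : ∀ j i → i ℕ.< j → j ℕ.< p → ĉ i ≢ ĉ j
    ĉ-distinct (suc j) i i<1+j 1+j<p eq = cases
        (nbrs (ℕₚ.≤-<-trans i<1+j 1+j<p) (ĉ j)
          (subst (λ v → adj H v (ĉ j) ≡ true) (sym eq) (trans (adj-sym H _ _) (ĉ-adj 1+j<p))) (ĉ-nonleaf j<p))
      where
      j<p : j ℕ.< p
      j<p = ℕₚ.<-trans (ℕₚ.n<1+n j) 1+j<p
      ahead : ĉ j ≡ ĉ (suc i) → suc i ℕ.≤ j ⊎ i ≡ j → ⊥
      ahead _ (inj₂ refl) = no-loop (subst (λ v → adj H (ĉ j) v ≡ true) (sym eq) (ĉ-adj 1+j<p))
      ahead ej (inj₁ i<j) with ℕₚ.m≤n⇒m<n∨m≡n i<j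
      ... | inj₁ 1+i<j = ĉ-distinct j (suc i) 1+i<j j<p (sym ej)
      ahead ej (inj₁ i<j) | inj₂ refl = ĉ-straight (ℕₚ.≤-pred (ℕₚ.≤-pred 1+j<p)) (sym eq)
      cases : ĉ j ≡ ĉ (suc i) ⊎ (∃ λ i′ → i ≡ suc i′ × ĉ j ≡ ĉ i′) → ⊥
      cases (inj₁ ej) = ahead ej (ℕₚ.m≤n⇒m<n∨m≡n (ℕₚ.≤-pred i<1+j))
      cases (inj₂ (i′ , refl , ej)) = ĉ-distinct j i′ (ℕₚ.≤-trans (ℕₚ.n<1+n i′) (ℕₚ.≤-pred i<1+j)) j<p (sym ej)

    ĉ-inj : ∀ {i j} → i ℕ.< p → j ℕ.< p → ĉ i ≡ ĉ j → i ≡ j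
    ĉ-inj {i} {j} i<p j<p eq with ℕₚ.<-cmp i j
    ... | tri< i<j _ _ = contradiction eq (ĉ-distinct j i i<j j<p)
    ... | tri≈ _ i≡j _ = i≡j
    ... | tri> _ _ j<i = contradiction (sym eq) (ĉ-distinct i j j<i i<p)

  -- A positive value of `ext` has a positive term. Its next vertex is not a leaf, by `ext-leaf`,
  -- hence it is the only continuation of the chain, and the induction goes on from there.
  ext-alive : ∀ c i → (∀ {j} → j ℕ.< i → Alive j) → 0ℤ < ext H (zeros c) 0 (ĉ i) (ĉ (suc i)) →
              ∀ {j} → j ℕ.< i ℕ.+ c → Alive j
  ext-alive zero    i alive _ j<i = alive (subst (_ ℕ.<_) (ℕₚ.+-identityʳ i) j<i)
  ext-alive (suc c) i alive 0<ext {j} j< =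
    ext-alive c (suc i) alive′ (subst (λ u → 0ℤ < ext H (zeros c) 0 (ĉ (suc i)) u) u≡ 0<ext′) {j} (subst (j ℕ.<_) (ℕₚ.+-suc i c) j<)
    where
    some-u = ∑-pos³ (λ u → 𝟙 (adj H (ĉ (suc i)) u)) (λ u → away (ĉ i) u) (λ u → ext H (zeros c) 0 (ĉ (suc i)) u)
      (λ u → 𝟙-nonneg (adj H (ĉ (suc i)) u)) (away-nonneg (ĉ i)) (subst (0ℤ <_) (ℤₚ.*-identityˡ (∑
        (λ u → 𝟙 (adj H (ĉ (suc i)) u) * (away (ĉ i) u * ext H (zeros c) 0 (ĉ (suc i)) u)))) 0<ext)
    u = proj₁ some-u
    0<ext′ = proj₂ (proj₂ (proj₂ some-u))
    a : adj H (ĉ (suc i)) u ≡ true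
    a = 𝟙-pos (adj H (ĉ (suc i)) u) (proj₁ (proj₂ some-u))
    nl-u : isNonLeaf H u ≡ true
    nl-u with isNonLeaf H u in eq
    ... | true = refl
    ... | false = contradiction (ext-leaf {q = 0} within (zeros c) 0 a eq) (λ eq → ℤₚ.<-irrefl (sym eq) 0<ext′)
    u≢ : u ≢ ĉ i
    u≢ = away-pos (proj₁ (proj₂ (proj₂ some-u)))
    alive′ : ∀ {j} → j ℕ.< suc i → Alive j
    alive′ (s≤s j≤i) with ℕₚ.m≤n⇒m<n∨m≡n j≤i
    ... | inj₁ j<i = alive j<i
    ... | inj₂ refl = u , a , nl-u , u≢
    u≡ : u ≡ ĉ (suc (suc i))
    u≡ = [ id , (λ { (_ , refl , eq) → contradiction eq u≢ }) ]′ (UpTo.nbrs (suc i) alive′ {suc i} ℕₚ.≤-refl u a nl-u)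

  findDead : ∀ b → (∀ {i} → i ℕ.< b → Alive i) ⊎ ∃ λ D → (¬ Alive D) × (∀ {i} → i ℕ.< D → Alive i)
  findDead zero = inj₁ λ ()
  findDead (suc b) with findDead b
  ... | inj₂ found = inj₂ found
  ... | inj₁ alive with alive? b
  ...   | no dead = inj₂ (b , dead , alive)
  ...   | yes alive-b = inj₁ (λ { (s≤s i≤b) → [ alive , (λ { refl → alive-b }) ]′ (ℕₚ.m≤n⇒m<n∨m≡n i≤b) })

  -- A chain with n possible steps would have n + 2 distinct vertices.
  dead : ∃ λ D → (¬ Alive D) × (∀ {i} → i ℕ.< D → Alive i)
  dead with findDead n
  ... | inj₂ found = found
  ... | inj₁ alive with i , j , i<j , eq ← Finₚ.pigeonhole {n} {2 ℕ.+ n} (ℕₚ.<-trans (ℕₚ.n<1+n n) (ℕₚ.n<1+n (suc n))) (ĉ ∘ toℕ) =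
    contradiction eq (UpTo.ĉ-distinct n alive (toℕ j) (toℕ i) i<j (Finₚ.toℕ<n j))

rank-zeros : ∀ c → rank (zeros c) 0 ≡ suc c
rank-zeros zero    = refl
rank-zeros (suc c) = cong suc (rank-zeros c)

window-zeros : ∀ w c i → window w (zeros c) 0 i ≡ w (i ℕ.+ c)
window-zeros w zero    i = trans (ℤₚ.*-identityʳ (w i)) (cong w (sym (ℕₚ.+-identityʳ i)))
window-zeros w (suc c) i = trans (ℤₚ.*-identityˡ (window w (zeros c) 0 (suc i))) (trans (window-zeros w c (suc i)) (cong w (sym (ℕₚ.+-suc i c))))

crossing : ∀ {P : ℕ → Set} → (∀ k → Dec (P k)) → P 0 → ∀ N → ¬ P N → ∃ λ k → k ℕ.< N × P k × ¬ P (suc k)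
crossing P? p0 zero    ¬pN = contradiction p0 ¬pN
crossing P? p0 (suc N) ¬pN with P? N
... | yes pN = N , ℕₚ.n<1+n N , pN , ¬pN
... | no ¬p with k , k<N , r ← crossing P? p0 N ¬p = k , ℕₚ.<-trans k<N (ℕₚ.n<1+n N) , r

module _ {n q F : ℕ} {G : Graph n} (within : DegreesWithin F G) where
  word-nonneg : ∀ (S : Spine G q) i → 0ℤ ≤ word S i
  word-nonneg S i with i ℕ.<? q
  ... | yes i<q = subst (0ℤ ≤_) (sym (zeroExtend-< (λ i → f G (Spine.ê S i)) i<q)) (f-nonneg G within _)
  ... | no i≮q = ≡⇒≤ (sym (zeroExtend-≥ (λ i → f G (Spine.ê S i)) i≮q))

  word-≥1 : ∀ (S : Spine G q) {i} → i ℕ.< q → 1ℤ ≤ word S i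
  word-≥1 S {i} i<q = subst (1ℤ ≤_) (sym (trans (zeroExtend-< (λ i → f G (Spine.ê S i)) i<q) (f≡ G (Spine.ê S i))))
    (ℤₚ.+-monoˡ-≤ (- 1ℤ) (+≤+ (isNonLeaf⇒ G _ (Spine.ê-nonleaf S i<q))))

  word-≤F : ∀ (S : Spine G q) {i} → i ℕ.< q → word S i ≤ + F
  word-≤F S {i} i<q = subst (_≤ + F) (sym (zeroExtend-< (λ i → f G (Spine.ê S i)) i<q)) (f≤F G within (Spine.ê S i))

-- No nonleaf vertices outside the chain

module Closing {n F q : ℕ} (H G : Graph n) (same : SameDeck H G) (spine : Spine G q) (pruned : Pruned F H)
  (noThree : ∀ {v a b c} → adj H v a ≡ true → adj H v b ≡ true → adj H v c ≡ true →
             isNonLeaf H a ≡ true → isNonLeaf H b ≡ true → isNonLeaf H c ≡ true → b ≢ a → c ≢ a → c ≢ b → ⊥)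
  (∑-nlH : ∑ (nl H) ≡ + q) (∑-innerDegH : ∑ (λ v → nl H v * innerDeg H v) ≡ + q + + q - + 2)
  {ks : List ℕ} {e : ℕ} (B : Beginning H ks e) where
  open Beginning B
  open Chain H pruned noThree B

  module _ (D : ℕ) (¬alive-D : ¬ Alive D) (alive-<D : ∀ {i} → i ℕ.< D → Alive i)
           (small : ∀ s → s ℕ.+ (2 ℕ.+ D) ℕ.≤ q → s ℕ.* 2 ℕ.≤ n ℕ.+ 2) where
    open UpTo D alive-<D

    -- The new case is the last vertex, whose only nonleaf neighbour is its predecessor because the
    -- walk has stopped.
    nbrs-all : ∀ {i} → i ℕ.< p → ∀ u → adj H (ĉ i) u ≡ true → isNonLeaf H u ≡ true →
               (suc i ℕ.< p × u ≡ ĉ (suc i)) ⊎ ∃ λ j → i ≡ suc j × u ≡ ĉ j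
    nbrs-all {i} i<p u a nlu with ℕₚ.m≤n⇒m<n∨m≡n i<p
    ... | inj₁ 1+i<p = [ (λ eq → inj₁ (1+i<p , eq)) , inj₂ ]′ (nbrs 1+i<p u a nlu)
    ... | inj₂ refl with u Fin.≟ ĉ D
    ...   | yes eq = inj₂ (D , refl , eq)
    ...   | no u≢ = contradiction (u , a , nlu , u≢) ¬alive-D

    onChain : Fin n → Bool
    onChain v = does (Finₚ.any? (λ (i : Fin p) → ĉ (toℕ i) Fin.≟ v))

    onChain⇒ : ∀ {v} → onChain v ≡ true → ∃ λ i → i ℕ.< p × ĉ i ≡ v
    onChain⇒ {v} eq with Finₚ.any? (λ (i : Fin p) → ĉ (toℕ i) Fin.≟ v)
    ... | yes (i , eq′) = toℕ i , Finₚ.toℕ<n i , eq′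
    ... | no miss with () ← trans (sym eq) (dec-false (Finₚ.any? (λ (i : Fin p) → ĉ (toℕ i) Fin.≟ v)) miss)

    onChain⇐ : ∀ {i} → i ℕ.< p → onChain (ĉ i) ≡ true
    onChain⇐ {i} i<p = dec-true (Finₚ.any? (λ (j : Fin p) → ĉ (toℕ j) Fin.≟ ĉ i)) (fromℕ< i<p , cong ĉ (Finₚ.toℕ-fromℕ< i<p))

    leftover : Fin n → Bool
    leftover v = isNonLeaf H v ∧ not (onChain v)

    ∣leftover∣+p≤q : ∣ Vec.tabulate leftover ∣ ℕ.+ p ℕ.≤ q
    ∣leftover∣+p≤q = ℤₚ.drop‿+≤+ (subst₂ _≤_ (trans (cong (_+_ (∑ (λ v → 𝟙 (leftover v)))) on-chain) total≡) (trans (sym (∑-+ (λ v → 𝟙 (leftover v)) φ)) (trans (∑-cong both) ∑-nlH))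
      (ℤₚ.+-monoʳ-≤ (∑ (λ v → 𝟙 (leftover v))) (∑-image-≤ (ĉ ∘ toℕ {p}) inj φ (λ v → 0≤φ (isNonLeaf H v) (onChain v)))))
      where
      φ : Fin n → ℤ
      φ v = nl H v - 𝟙 (leftover v)
      0≤φ : ∀ a b → 0ℤ ≤ 𝟙 a - 𝟙 (a ∧ not b)
      0≤φ false _ = ℤₚ.≤-refl
      0≤φ true false = ℤₚ.≤-refl
      0≤φ true true = +≤+ z≤n
      inj : Injective _≡_ _≡_ (ĉ ∘ toℕ {p})
      inj {i} {j} eq = Finₚ.toℕ-injective (ĉ-inj (Finₚ.toℕ<n i) (Finₚ.toℕ<n j) eq)
      on-chain : ∑ (φ ∘ ĉ ∘ toℕ {p}) ≡ + p
      on-chain = trans (∑-cong (λ i → cong₂ (λ a b → 𝟙 a - 𝟙 (a ∧ not b)) (ĉ-nonleaf (Finₚ.toℕ<n i)) (onChain⇐ (Finₚ.toℕ<n i))))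
        (trans (∑-const p 1ℤ) (ℤₚ.*-identityʳ (+ p)))
      total≡ : ∑ (λ v → 𝟙 (leftover v)) + + p ≡ + (∣ Vec.tabulate leftover ∣ ℕ.+ p)
      total≡ = trans (cong (_+ + p) (sym (∣tabulate∣ leftover))) (sym (ℤₚ.pos-+ ∣ Vec.tabulate leftover ∣ p))
      both : ∀ v → 𝟙 (leftover v) + φ v ≡ nl H v
      both v = back (𝟙 (leftover v)) (nl H v)
        where
        back : ∀ a b → a + (b - a) ≡ b
        back = solve-∀

    innerDeg-count : ∀ v → innerDeg H v ≡ ∑ (λ u → 𝟙 (adj H v u ∧ isNonLeaf H u))
    innerDeg-count v = ∑-cong (λ u → sym (𝟙-∧ (adj H v u) (isNonLeaf H u)))

    innerDeg≤2 : ∀ v → innerDeg H v ≤ + 2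
    innerDeg≤2 v = ℤₚ.≮⇒≥ (λ 2< → three (pickThree (λ u → adj H v u ∧ isNonLeaf H u) (subst (+ 3 ≤_) (innerDeg-count v) (ℤₚ.i<j⇒suc[i]≤j 2<))))
      where
      three : (∃ λ a → ∃ λ b → ∃ λ c → (adj H v a ∧ isNonLeaf H a) ≡ true × (adj H v b ∧ isNonLeaf H b) ≡ true ×
              (adj H v c ∧ isNonLeaf H c) ≡ true × b ≢ a × c ≢ a × c ≢ b) → ⊥
      three (a , b , c , Ba , Bb , Bc , b≢a , c≢a , c≢b) =
        noThree (proj₁ (∧-true Ba)) (proj₁ (∧-true Bb)) (proj₁ (∧-true Bc)) (proj₂ (∧-true Ba)) (proj₂ (∧-true Bb)) (proj₂ (∧-true Bc)) b≢a c≢a c≢b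

    innerDeg≤1 : ∀ {v w} → (∀ u → adj H v u ≡ true → isNonLeaf H u ≡ true → u ≡ w) → innerDeg H v ≤ 1ℤ
    innerDeg≤1 {v} {w} uniq = ℤₚ.≮⇒≥ (λ 1< → two (pickTwo (λ u → adj H v u ∧ isNonLeaf H u) (subst (+ 2 ≤_) (innerDeg-count v) (ℤₚ.i<j⇒suc[i]≤j 1<))))
      where
      two : (∃ λ a → ∃ λ b → (adj H v a ∧ isNonLeaf H a) ≡ true × (adj H v b ∧ isNonLeaf H b) ≡ true × b ≢ a) → ⊥
      two (a , b , Ba , Bb , b≢a) = b≢a (trans (uniq b (proj₁ (∧-true Bb)) (proj₂ (∧-true Bb))) (sym (uniq a (proj₁ (∧-true Ba)) (proj₂ (∧-true Ba)))))

    LeftoverNbrs : Fin n → Set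
    LeftoverNbrs v = ∃ λ a → ∃ λ b →
      (adj H v a ≡ true × leftover a ≡ true) × (adj H v b ≡ true × leftover b ≡ true) × b ≢ a

    -- The deficits 2 - innerDeg add up to 2 over the nonleaf vertices, and the
    -- two ends of the chain already use them up.
    leftover-nbrs : ∀ {v} → leftover v ≡ true → LeftoverNbrs v
    leftover-nbrs {v} left = two (pickTwo (λ u → adj H v u ∧ isNonLeaf H u) (subst (+ 2 ≤_) (innerDeg-count v) 2≤))
      where
      nlv : isNonLeaf H v ≡ true
      nlv = proj₁ (∧-true left)
      off : onChain v ≡ true → ⊥
      off on with () ← trans (sym (proj₂ (∧-true left))) (cong not on)
      -- If the neighbour lay on the chain, then `v` would be one of its chain neighbours and lie on
      -- the chain too.
      spread : ∀ u → adj H v u ≡ true → isNonLeaf H u ≡ true → leftover u ≡ true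
      spread u a nlu with onChain u in on
      ... | false = cong (_∧ true) nlu
      ... | true with i , i<p , refl ← onChain⇒ on =
        ⊥-elim ([ (λ { (1+i<p , refl) → off (onChain⇐ 1+i<p) }) , (λ { (j , refl , refl) → off (onChain⇐ (ℕₚ.<-trans (ℕₚ.n<1+n j) i<p)) }) ]′
          (nbrs-all i<p v (trans (adj-sym H _ _) a) nlv))
      two : (∃ λ a → ∃ λ b → (adj H v a ∧ isNonLeaf H a) ≡ true × (adj H v b ∧ isNonLeaf H b) ≡ true × b ≢ a) → LeftoverNbrs v
      two (a , b , Ba , Bb , b≢a) = a , b , (proj₁ (∧-true Ba) , spread a (proj₁ (∧-true Ba)) (proj₂ (∧-true Ba))) ,
        (proj₁ (∧-true Bb) , spread b (proj₁ (∧-true Bb)) (proj₂ (∧-true Bb))) , b≢a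
      deficit : Fin n → ℤ
      deficit u = nl H u * (+ 2 - innerDeg H u)
      deficit-nonneg : ∀ u → 0ℤ ≤ deficit u
      deficit-nonneg u = *-nonneg (𝟙-nonneg (isNonLeaf H u)) (0≤y-x (innerDeg≤2 u))
      deficit-total : ∑ deficit ≡ + 2
      deficit-total = trans (∑-cong (λ u → expand (nl H u) (innerDeg H u))) (trans (∑-- _ _) (trans
        (cong₂ _-_ (trans (∑-*ʳ (+ 2) (nl H)) (cong (_* + 2) ∑-nlH)) ∑-innerDegH) (collect (+ q))))
        where
        expand : ∀ a b → a * (+ 2 - b) ≡ a * + 2 - a * b
        expand = solve-∀
        collect : ∀ q → q * + 2 - (q + q - + 2) ≡ + 2
        collect = solve-∀
      nonleaf-deficit : ∀ {u} → isNonLeaf H u ≡ true → deficit u ≡ + 2 - innerDeg H u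
      nonleaf-deficit {u} nlu = trans (cong (λ b → 𝟙 b * (+ 2 - innerDeg H u)) nlu) (ℤₚ.*-identityˡ (+ 2 - innerDeg H u))
      ends : Fin 3 → Fin n
      ends Fin.zero = ĉ 0
      ends (Fin.suc Fin.zero) = ĉ (suc D)
      ends (Fin.suc (Fin.suc Fin.zero)) = v
      0<p : 0 ℕ.< p
      0<p = s≤s z≤n
      last<p : suc D ℕ.< p
      last<p = ℕₚ.≤-refl
      v≢ : ∀ {i} → i ℕ.< p → ĉ i ≢ v
      v≢ i<p refl = off (onChain⇐ i<p)
      ends-inj : Injective _≡_ _≡_ ends
      ends-inj {Fin.zero} {Fin.zero} _ = refl
      ends-inj {Fin.suc Fin.zero} {Fin.suc Fin.zero} _ = refl
      ends-inj {Fin.suc (Fin.suc Fin.zero)} {Fin.suc (Fin.suc Fin.zero)} _ = refl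
      ends-inj {Fin.zero} {Fin.suc Fin.zero} eq with () ← ĉ-inj {0} {suc D} 0<p last<p eq
      ends-inj {Fin.suc Fin.zero} {Fin.zero} eq with () ← ĉ-inj {suc D} {0} last<p 0<p eq
      ends-inj {Fin.zero} {Fin.suc (Fin.suc Fin.zero)} eq = contradiction eq (v≢ {0} 0<p)
      ends-inj {Fin.suc Fin.zero} {Fin.suc (Fin.suc Fin.zero)} eq = contradiction eq (v≢ {suc D} last<p)
      ends-inj {Fin.suc (Fin.suc Fin.zero)} {Fin.zero} eq = contradiction (sym eq) (v≢ {0} 0<p)
      ends-inj {Fin.suc (Fin.suc Fin.zero)} {Fin.suc Fin.zero} eq = contradiction (sym eq) (v≢ {suc D} last<p)
      ≥1 : ∀ {u} → isNonLeaf H u ≡ true → innerDeg H u ≤ 1ℤ → 1ℤ ≤ deficit u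
      ≥1 {u} nlu ≤1 = subst (1ℤ ≤_) (sym (nonleaf-deficit nlu)) (ℤₚ.+-monoʳ-≤ (+ 2) (ℤₚ.neg-mono-≤ ≤1))
      first≥1 : 1ℤ ≤ deficit (ĉ 0)
      first≥1 = ≥1 nl-v₀ (innerDeg≤1 only)
      last≥1 : 1ℤ ≤ deficit (ĉ (suc D))
      last≥1 = ≥1 (ĉ-nonleaf last<p) (innerDeg≤1 {w = ĉ D} (λ u a nlu →
        [ (λ { (lt , _) → contradiction lt (ℕₚ.<-irrefl refl) }) , (λ { (_ , refl , eq) → eq }) ]′ (nbrs-all last<p u a nlu)))
      three≤2 : deficit (ĉ 0) + (deficit (ĉ (suc D)) + (deficit v + 0ℤ)) ≤ + 2
      three≤2 = subst₂ _≤_ (trans (∑-∷ _) (cong (_+_ (deficit (ĉ 0))) (trans (∑-∷ _) (cong (_+_ (deficit (ĉ (suc D)))) (trans (∑-∷ _) (cong (_+_ (deficit v)) (∑-[] _)))))))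
        deficit-total (∑-image-≤ ends ends-inj deficit deficit-nonneg)
      deficit-v≤0 : deficit v ≤ 0ℤ
      deficit-v≤0 = subst₂ _≤_ (left≡ (deficit v)) (ℤₚ.+-inverseˡ (+ 2))
        (ℤₚ.+-monoʳ-≤ (- (+ 2)) (ℤₚ.≤-trans (ℤₚ.+-mono-≤ first≥1 (ℤₚ.+-mono-≤ last≥1 (ℤₚ.≤-refl {deficit v + 0ℤ}))) three≤2))
        where
        left≡ : ∀ x → - (+ 2) + (1ℤ + (1ℤ + (x + 0ℤ))) ≡ x
        left≡ = solve-∀
      2≤ : + 2 ≤ innerDeg H v
      2≤ = ℤₚ.i-j≤0⇒i≤j (subst (_≤ 0ℤ) (nonleaf-deficit nlv) deficit-v≤0)

    leftoverCard : Card n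
    leftoverCard = Vec.tabulate leftover , small ∣ Vec.tabulate leftover ∣ ∣leftover∣+p≤q

    module _ where
      open Deck H G same
      open PartialIso (R-iso leftoverCard)

      ∈leftover : ∀ {v} → leftover v ≡ true → v ∈ˢ proj₁ leftoverCard
      ∈leftover {v} left = lookup⇒[]= v _ (trans (lookup∘tabulate leftover v) left)

      leftover∈ : ∀ {v} → v ∈ˢ proj₁ leftoverCard → leftover v ≡ true
      leftover∈ {v} v∈ = trans (sym (lookup∘tabulate leftover v)) ([]=⇒lookup v∈)

      -- A copy of the leftover graph in G would have no first vertex on the spine.
      Absent : ℕ → Set
      Absent i = i ℕ.< q → ∀ {v} → R leftoverCard v (Spine.ê spine i) → ⊥

      -- At most one of the two neighbours can have its image at position i + 1, so the other sits
      -- at i - 1, where `before` forbids it.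
      descend-step : ∀ i → (∀ j → i ≡ suc j → Absent j) → Absent i
      descend-step i before i<q {v} r@(v∈ , _) = lower (leftover-nbrs (leftover∈ v∈))
        where
        open Spine spine
        adjacent : ∀ {a a′} → adj H v a ≡ true → R leftoverCard a a′ → adj G (ê i) a′ ≡ true
        adjacent va ra = trans (sym (adj-≡ r ra)) va
        -- The vertex `a` has two leftover neighbours of its own, so its image has degree at least 2
        -- in G and lies on the spine.
        index : ∀ {a a′} → leftover a ≡ true → R leftoverCard a a′ → ∃ λ j → j ℕ.< q × ê j ≡ a′
        index {a} {a′} left-a ra = onSpine (leftover-nbrs left-a)
          where
          onSpine : LeftoverNbrs a → ∃ λ j → j ℕ.< q × ê j ≡ a′
          onSpine (x , y , (ax , left-x) , (ay , left-y) , y≢x) =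
            let x′ , rx = R-total leftoverCard (∈leftover left-x)
                y′ , ry = R-total leftoverCard (∈leftover left-y)
            in nonleaf⇒ê a′ (isNonLeaf⇐ G a′ (two-nbrs G (trans (sym (adj-≡ ra rx)) ax) (trans (sym (adj-≡ ra ry)) ay)
                 (λ eq → y≢x (inj ry (subst (R leftoverCard x) (sym eq) rx)))))
        lower : LeftoverNbrs v → ⊥
        lower (a , b , (va , left-a) , (vb , left-b) , b≢a) =
          let a′ , ra = R-total leftoverCard (∈leftover left-a)
              b′ , rb = R-total leftoverCard (∈leftover left-b)
              j , j<q , ja = index left-a ra
              k , k<q , kb = index left-b rb
          in finish (subst (R leftoverCard a) (sym ja) ra) (subst (R leftoverCard b) (sym kb) rb) j<q k<q
               (consec⁻ i<q j<q (trans (cong (adj G (ê i)) ja) (adjacent va ra)))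
               (consec⁻ i<q k<q (trans (cong (adj G (ê i)) kb) (adjacent vb rb)))
          where
          finish : ∀ {j k} → R leftoverCard a (ê j) → R leftoverCard b (ê k) → j ℕ.< q → k ℕ.< q →
                   (j ≡ suc i ⊎ i ≡ suc j) → (k ≡ suc i ⊎ i ≡ suc k) → ⊥
          finish ra rb _   _   (inj₁ refl) (inj₁ refl) = b≢a (inj rb ra)
          finish ra rb j<q _   (inj₂ i≡)   _           = before _ i≡ j<q ra
          finish ra rb _   k<q (inj₁ _)    (inj₂ i≡)   = before _ i≡ k<q rb

      descend : ∀ i → Absent i
      descend zero    = descend-step zero (λ _ ())
      descend (suc i) = descend-step (suc i) (λ { _ refl → descend i })

      no-leftover : ∀ {v} → leftover v ≡ true → ⊥
      no-leftover {v} left = onSpine (leftover-nbrs left)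
        where
        onSpine : LeftoverNbrs v → ⊥
        onSpine (x , y , (ax , left-x) , (ay , left-y) , y≢x) =
          let v′ , rv = R-total leftoverCard (∈leftover left)
              x′ , rx = R-total leftoverCard (∈leftover left-x)
              y′ , ry = R-total leftoverCard (∈leftover left-y)
              i , i<q , eq = Spine.nonleaf⇒ê spine v′ (isNonLeaf⇐ G v′ (two-nbrs G (trans (sym (adj-≡ rv rx)) ax)
                (trans (sym (adj-≡ rv ry)) ay) (λ eq → y≢x (inj ry (subst (R leftoverCard x) (sym eq) rx)))))
          in descend i i<q (subst (R leftoverCard v) (sym eq) rv)

    chainSpine : Spine H p
    chainSpine = record
      { ê = ĉ
      ; ê-inj = ĉ-inj
      ; nonleaf⇒ê = onto
      ; ê-nonleaf = ĉ-nonleaf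
      ; consec = ĉ-adj
      ; consec⁻ = λ {i} {j} i<p j<p a → [ (λ { (1+i<p , eq) → inj₁ (ĉ-inj j<p 1+i<p eq) })
                  , (λ { (h , refl , eq) → inj₂ (cong suc (sym (ĉ-inj j<p (ℕₚ.<-trans (ℕₚ.n<1+n h) i<p) eq))) }) ]′
                  (nbrs-all i<p (ĉ j) a (ĉ-nonleaf j<p))
      }
      where
      onto : ∀ v → isNonLeaf H v ≡ true → ∃ λ i → i ℕ.< p × ĉ i ≡ v
      onto v nlv with onChain v in on
      ... | true = onChain⇒ on
      ... | false = ⊥-elim (no-leftover {v} (cong₂ (λ a b → a ∧ not b) nlv on))

    -- Now p is the number of nonleaf vertices of H, which the deck has shown to be q.
    spineH : Spine H q
    spineH = subst (Spine H) (ℤₚ.+-injective (trans (sym (∑-nl H chainSpine)) ∑-nlH)) chainSpine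

-- The length of the walk that finds the spine of H

module Rebuild {n : ℕ} (48≤n : 48 ℕ.≤ n) (H G : Graph n) (same : SameDeck H G) (C : Caterpillar G) where
  open Recognition 48≤n H G same C
  open Caterpillar C

  -- Adding 4 + 4F ≤ n + 2 and 50 ≤ n + 2 gives more than twice the claim.
  fits-F+4 : Fits (2 ℕ.+ (F ℕ.+ 2))
  fits-F+4 = ℕₚ.*-cancelʳ-≤ _ _ 2 (ℕₚ.≤-trans (ℕₚ.m≤m+n _ 38) (subst₂ ℕ._≤_ (lhs F) (rhs n)
    (ℕₚ.+-mono-≤ (ℕₚ.≤-trans (ℕₚ.+-monoˡ-≤ (4 ℕ.* F) 4≤q) q+4F≤) (ℕₚ.+-monoˡ-≤ 2 48≤n))))
    where
    lhs : ∀ F → (4 ℕ.+ 4 ℕ.* F) ℕ.+ 50 ≡ (2 ℕ.+ (F ℕ.+ 2)) ℕ.* 2 ℕ.* 2 ℕ.+ 38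
    lhs = solveℕ-∀
    rhs : ∀ n → (n ℕ.+ 2) ℕ.+ (n ℕ.+ 2) ≡ (n ℕ.+ 2) ℕ.* 2
    rhs = solveℕ-∀

  private
    -- The walks used to find an end have c + 2 vertices: few enough to be counted from the deck,
    -- yet so many that the nonleaf vertices missed by such a chain fit on a card.
    record Budget : Set where
      field
        c     : ℕ
        c+2≤q : 2 ℕ.+ c ℕ.≤ q
        fits  : Fits (2 ℕ.+ (F ℕ.+ (2 ℕ.+ c)))
        small : ∀ s → s ℕ.+ (2 ℕ.+ c) ℕ.≤ q → Fits s

    -- If the next length is too expensive, then n + 3 ≤ 2 (5 + F + k). Together with 2 (s + 2 + k +
    -- 4F) ≤ 2 (n + 2) and 6 ≤ 6F this leaves 2s < n + 2.
    small-lemma : ∀ k → ¬ Fits (2 ℕ.+ (F ℕ.+ (3 ℕ.+ k))) → ∀ s → s ℕ.+ (2 ℕ.+ k) ℕ.≤ q → Fits s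
    small-lemma k ¬fits s s≤ = ℕₚ.≤-trans (ℕₚ.n≤1+n _) (ℕₚ.+-cancelʳ-≤ (n ℕ.+ 12 ℕ.+ 2 ℕ.* k ℕ.+ 8 ℕ.* F) _ _
      (subst₂ ℕ._≤_ (lhs s k F n) (rhs k F n)
        (ℕₚ.+-mono-≤ (ℕₚ.+-mono-≤ (ℕₚ.*-monoˡ-≤ 2 (ℕₚ.≤-trans (ℕₚ.+-monoˡ-≤ (4 ℕ.* F) s≤) q+4F≤)) (ℕₚ.≰⇒> ¬fits)) (ℕₚ.*-monoʳ-≤ 6 1≤F))))
      where
      lhs : ∀ s k F n → (s ℕ.+ (2 ℕ.+ k) ℕ.+ 4 ℕ.* F) ℕ.* 2 ℕ.+ suc (n ℕ.+ 2) ℕ.+ 6 ≡ suc (s ℕ.* 2) ℕ.+ (n ℕ.+ 12 ℕ.+ 2 ℕ.* k ℕ.+ 8 ℕ.* F)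
      lhs = solveℕ-∀
      rhs : ∀ k F n → (n ℕ.+ 2) ℕ.* 2 ℕ.+ (2 ℕ.+ (F ℕ.+ (3 ℕ.+ k))) ℕ.* 2 ℕ.+ 6 ℕ.* F ≡ n ℕ.+ 2 ℕ.+ (n ℕ.+ 12 ℕ.+ 2 ℕ.* k ℕ.+ 8 ℕ.* F)
      rhs = solveℕ-∀

    Fits₀ : ℕ → Set
    Fits₀ k = Fits (2 ℕ.+ (F ℕ.+ (2 ℕ.+ k)))

    fits₀? : ∀ k → Dec (Fits₀ k)
    fits₀? k = (2 ℕ.+ (F ℕ.+ (2 ℕ.+ k))) ℕ.* 2 ℕ.≤? n ℕ.+ 2

    budget : Budget
    budget = choose (ℕₚ.m≤n⇒∃[o]m+o≡n (ℕₚ.≤-trans (s≤s (s≤s z≤n)) 4≤q))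
      where
      maximal : ∀ {Q} → 2 ℕ.+ Q ≡ q → (∃ λ k → k ℕ.< Q × Fits₀ k × ¬ Fits₀ (suc k)) → Budget
      maximal q≡ (k , k<Q , fits , ¬fits) =
        record { c = k ; c+2≤q = subst (2 ℕ.+ k ℕ.≤_) q≡ (s≤s (s≤s (ℕₚ.<⇒≤ k<Q))) ; fits = fits ; small = small-lemma k ¬fits }
      whole : ∀ {Q} → 2 ℕ.+ Q ≡ q → Fits₀ Q → Budget
      whole {Q} q≡ fits = record
        { c = Q ; c+2≤q = ℕₚ.≤-reflexive q≡ ; fits = fits
        -- A chain as long as the whole spine misses nothing, so s = 0.
        ; small = λ s s+q≤q → subst Fits (sym (ℕₚ.n≤0⇒n≡0 (ℕₚ.+-cancelʳ-≤ (2 ℕ.+ Q) s 0 (subst (s ℕ.+ (2 ℕ.+ Q) ℕ.≤_) (sym q≡) s+q≤q)))) z≤n }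
      choose : (∃ λ Q → 2 ℕ.+ Q ≡ q) → Budget
      choose (Q , q≡) with fits₀? Q
      ... | yes fits = whole q≡ fits
      ... | no unfit = maximal q≡ (crossing fits₀? fits-F+4 Q unfit)

  open Budget budget using (c; c+2≤q; fits; small)

  private
    withinH = Pruned.within prunedH
    withinG = Pruned.within pruned

    -- In G the difference is, by `anchored`, the sum of the letters at position c + 1 of the word
    -- and of its reverse; as c + 2 ≤ q, the first is at least 1.
    positive : 0ℤ < walks H 0 (zeros c) 0 - walks H 0 (0 ∷ zeros c) 0
    positive = subst (0ℤ <_) (sym (trans (start-walks-≡ (zeros (suc c)) 0 (subst (λ r → Fits (2 ℕ.+ (F ℕ.+ r))) (sym (rank-zeros (suc c))) fits))
        (trans (anchored withinG spine (zeros (suc c)) 0) (cong₂ _+_ (window-zeros (word spine) (suc c) 0) (window-zeros (word (reverse spine)) (suc c) 0)))))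
      (ℤₚ.+-mono-<-≤ (ℤₚ.<-≤-trans 0<1 (word-≥1 withinG spine c+2≤q)) (word-nonneg withinG (reverse spine) (suc c)))

  module _ (B : Beginning H (zeros c) 0) where
    open Beginning B
    open Chain H prunedH noThree B

    spine-from : Spine H q
    spine-from = finish dead
      where
      finish : (∃ λ D → (¬ Alive D) × (∀ {i} → i ℕ.< D → Alive i)) → Spine H q
      finish (D , ¬alive-D , alive-<D) = Closing.spineH H G same spine prunedH noThree ∑-nlH ∑-innerDegH B D ¬alive-D alive-<D
        (λ s s≤ → small s (ℕₚ.≤-trans (ℕₚ.+-monoʳ-≤ s (s≤s (s≤s c≤D))) s≤))
        where
        c≤D : c ℕ.≤ D
        c≤D = ℕₚ.≮⇒≥ (λ D<c → ¬alive-D (ext-alive c 0 (λ ()) (subst (λ u → 0ℤ < ext H (zeros c) 0 v₀ u) (chain₂ 0) 0<ext) D<c))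

  spineH : Spine H q
  spineH = spine-from (beginning H withinH (zeros c) 0 positive)

-- Words determined up to reversal

+-cancelˡ : ∀ x y z → x + y ≡ x + z → y ≡ z
+-cancelˡ x y z eq = trans (undo x y) (trans (cong (λ t → - x + t) eq) (sym (undo x z)))
  where
  undo : ∀ x y → y ≡ - x + (x + y)
  undo = solve-∀

double-inj : ∀ {x y : ℤ} → x + x ≡ y + y → x ≡ y
double-inj {x} {y} eq = *-cancelˡ-pos {+ 2} (+<+ (s≤s z≤n)) (trans (two x) (trans eq (sym (two y))))
  where
  two : ∀ x → + 2 * x ≡ x + x
  two = solve-∀

≡-by-difference : ∀ {x y : ℤ} → x - y ≡ 0ℤ → x ≡ y
≡-by-difference {x} {y} = ℤₚ.i-j≡0⇒i≡j x y

square-roots : ∀ {x y : ℤ} → x * x ≡ y * y → y ≡ x ⊎ y ≡ - x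
square-roots {x} {y} eq with ℤₚ.i*j≡0⇒i≡0∨j≡0 (x - y) (trans (factor x y) (trans (cong (_- y * y) eq) (ℤₚ.+-inverseʳ (y * y))))
  where
  factor : ∀ x y → (x - y) * (x + y) ≡ x * x - y * y
  factor = solve-∀
... | inj₁ x-y≡0 = inj₁ (sym (≡-by-difference x-y≡0))
... | inj₂ x+y≡0 = inj₂ (trans (isolate x y) (trans (cong (_- x) x+y≡0) (ℤₚ.+-identityˡ (- x))))
  where
  isolate : ∀ x y → y ≡ x + y - x
  isolate = solve-∀

one-or-two : ∀ {x : ℤ} → 1ℤ ≤ x → x ≤ + 2 → x ≡ + 1 ⊎ x ≡ + 2
one-or-two {+ 0} (+≤+ ()) _
one-or-two {+ 1} _ _ = inj₁ refl
one-or-two {+ 2} _ _ = inj₂ refl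
one-or-two {+ suc (suc (suc x))} _ (+≤+ (s≤s (s≤s ())))

-- Autocorrelations of words that differ in two places

autocorrelation : ℕ → (ℕ → ℤ) → ℕ → ℤ
autocorrelation q x L = ∑ {q} (λ i → x (toℕ i) * x (toℕ i ℕ.+ L))

module _ {q : ℕ} (x y : ℕ → ℤ) {δ : ℤ} {ρ σ : ℕ} (σ<q : σ ℕ.< q) (ρ<σ : ρ ℕ.< σ)
  (at-ρ : x ρ - y ρ ≡ δ) (at-σ : x σ - y σ ≡ - δ) (elsewhere : ∀ i → i ≢ ρ → i ≢ σ → x i - y i ≡ 0ℤ) where
  private
    U E : ℕ → ℤ
    U i = x i + y i
    E i = x i - y i

    pulses : ∀ i → E i ≡ δ * 𝟙 (does (i ℕ.≟ ρ)) - δ * 𝟙 (does (i ℕ.≟ σ))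
    pulses i with i ℕ.≟ ρ | i ℕ.≟ σ
    ... | yes refl | yes refl = contradiction ρ<σ (ℕₚ.<-irrefl refl)
    ... | yes refl | no i≢σ = trans at-ρ (sym (trans (cong₂ (λ a b → δ * 𝟙 a - δ * 𝟙 b) (dec-true (ρ ℕ.≟ ρ) refl) (dec-false (ρ ℕ.≟ σ) i≢σ)) (val δ)))
      where
      val : ∀ d → d * 1ℤ - d * 0ℤ ≡ d
      val = solve-∀
    ... | no i≢ρ | yes refl = trans at-σ (sym (trans (cong₂ (λ a b → δ * 𝟙 a - δ * 𝟙 b) (dec-false (σ ℕ.≟ ρ) i≢ρ) (dec-true (σ ℕ.≟ σ) refl)) (val δ)))
      where
      val : ∀ d → d * 0ℤ - d * 1ℤ ≡ - d
      val = solve-∀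
    ... | no i≢ρ | no i≢σ = trans (elsewhere i i≢ρ i≢σ) (sym (trans (cong₂ (λ a b → δ * 𝟙 a - δ * 𝟙 b) (dec-false (i ℕ.≟ ρ) i≢ρ) (dec-false (i ℕ.≟ σ) i≢σ)) (val δ)))
      where
      val : ∀ d → d * 0ℤ - d * 0ℤ ≡ 0ℤ
      val = solve-∀

    pick-pulses : ∀ {r s} (w : ℕ → ℤ) → r ℕ.< q → s ℕ.< q → (e : ℕ → ℤ) →
      (∀ i → e i ≡ δ * 𝟙 (does (i ℕ.≟ r)) - δ * 𝟙 (does (i ℕ.≟ s))) →
      ∑ {q} (λ i → e (toℕ i) * w (toℕ i)) ≡ δ * (w r - w s)
    pick-pulses {r} {s} w r<q s<q e e≡ = begin
      ∑ {q} (λ i → e (toℕ i) * w (toℕ i))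
        ≡⟨ ∑-cong (λ i → trans (cong (_* w (toℕ i)) (e≡ (toℕ i))) (spread δ (𝟙 (does (toℕ i ℕ.≟ r))) (𝟙 (does (toℕ i ℕ.≟ s))) (w (toℕ i)))) ⟩
      ∑ {q} (λ i → δ * (𝟙 (does (toℕ i ℕ.≟ r)) * w (toℕ i) - 𝟙 (does (toℕ i ℕ.≟ s)) * w (toℕ i)))
        ≡⟨ trans (∑-*ˡ δ (λ (i : Fin q) → 𝟙 (does (toℕ i ℕ.≟ r)) * w (toℕ i) - 𝟙 (does (toℕ i ℕ.≟ s)) * w (toℕ i)))
             (cong (_*_ δ) (∑-- (λ (i : Fin q) → 𝟙 (does (toℕ i ℕ.≟ r)) * w (toℕ i)) (λ i → 𝟙 (does (toℕ i ℕ.≟ s)) * w (toℕ i)))) ⟩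
      δ * (∑ {q} (λ i → 𝟙 (does (toℕ i ℕ.≟ r)) * w (toℕ i)) - ∑ {q} (λ i → 𝟙 (does (toℕ i ℕ.≟ s)) * w (toℕ i)))
        ≡⟨ cong₂ (λ a b → δ * (a - b)) (trans (∑-δℕ q r w) (zeroExtend-< w r<q)) (trans (∑-δℕ q s w) (zeroExtend-< w s<q)) ⟩
      δ * (w r - w s) ∎
      where
      open ≡-Reasoning
      spread : ∀ d a b w → (d * a - d * b) * w ≡ d * (a * w - b * w)
      spread = solve-∀

    shift-≟ : ∀ {L k} i → L ℕ.≤ k → 𝟙 (does (i ℕ.+ L ℕ.≟ k)) ≡ 𝟙 (does (i ℕ.≟ k ℕ.∸ L))
    shift-≟ {L} {k} i L≤k with i ℕ.≟ k ℕ.∸ L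
    ... | yes refl = cong 𝟙 (trans (dec-true (k ℕ.∸ L ℕ.+ L ℕ.≟ k) (ℕₚ.m∸n+n≡m L≤k)) (sym (dec-true (k ℕ.∸ L ℕ.≟ k ℕ.∸ L) refl)))
    ... | no i≢ = cong 𝟙 (trans (dec-false (i ℕ.+ L ℕ.≟ k) (λ eq → i≢ (trans (sym (ℕₚ.m+n∸n≡m i L)) (cong (ℕ._∸ L) eq)))) (sym (dec-false (i ℕ.≟ k ℕ.∸ L) i≢)))

  -- Polarization: twice the difference is a sum of values of x - y at one place times values of x +
  -- y at the other, and x - y consists of the pulses δ at ρ and -δ at σ. With L ≤ ρ, shifting the
  -- pulses back by L keeps them inside the word.
  autocorrelation-difference : ∀ {L} → L ℕ.≤ ρ →
    + 2 * (autocorrelation q x L - autocorrelation q y L) ≡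
    δ * ((x (ρ ℕ.+ L) + y (ρ ℕ.+ L)) - (x (σ ℕ.+ L) + y (σ ℕ.+ L)) + ((x (ρ ℕ.∸ L) + y (ρ ℕ.∸ L)) - (x (σ ℕ.∸ L) + y (σ ℕ.∸ L))))
  autocorrelation-difference {L} L≤ρ = begin
    + 2 * (autocorrelation q x L - autocorrelation q y L)
      ≡⟨ cong (_*_ (+ 2)) (∑-- (λ (i : Fin q) → x (toℕ i) * x (toℕ i ℕ.+ L)) (λ i → y (toℕ i) * y (toℕ i ℕ.+ L))) ⟨
    + 2 * ∑ {q} (λ i → x (toℕ i) * x (toℕ i ℕ.+ L) - y (toℕ i) * y (toℕ i ℕ.+ L))
      ≡⟨ ∑-*ˡ (+ 2) (λ (i : Fin q) → x (toℕ i) * x (toℕ i ℕ.+ L) - y (toℕ i) * y (toℕ i ℕ.+ L)) ⟨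
    ∑ {q} (λ i → + 2 * (x (toℕ i) * x (toℕ i ℕ.+ L) - y (toℕ i) * y (toℕ i ℕ.+ L)))
      ≡⟨ trans (∑-cong (λ i → polarize (x (toℕ i)) (x (toℕ i ℕ.+ L)) (y (toℕ i)) (y (toℕ i ℕ.+ L))))
           (∑-+ (λ (i : Fin q) → E (toℕ i) * U (toℕ i ℕ.+ L)) (λ i → E (toℕ i ℕ.+ L) * U (toℕ i))) ⟩
    ∑ {q} (λ i → E (toℕ i) * U (toℕ i ℕ.+ L)) + ∑ {q} (λ i → E (toℕ i ℕ.+ L) * U (toℕ i))
      ≡⟨ cong₂ _+_ (pick-pulses (λ i → U (i ℕ.+ L)) ρ<q σ<q E pulses)
           (pick-pulses U (ℕₚ.≤-<-trans (ℕₚ.m∸n≤m ρ L) ρ<q) (ℕₚ.≤-<-trans (ℕₚ.m∸n≤m σ L) σ<q) (λ i → E (i ℕ.+ L))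
             (λ i → trans (pulses (i ℕ.+ L)) (cong₂ (λ a b → δ * a - δ * b) (shift-≟ i L≤ρ) (shift-≟ i (ℕₚ.≤-trans L≤ρ (ℕₚ.<⇒≤ ρ<σ)))))) ⟩
    δ * (U (ρ ℕ.+ L) - U (σ ℕ.+ L)) + δ * (U (ρ ℕ.∸ L) - U (σ ℕ.∸ L))
      ≡⟨ ℤₚ.*-distribˡ-+ δ (U (ρ ℕ.+ L) - U (σ ℕ.+ L)) (U (ρ ℕ.∸ L) - U (σ ℕ.∸ L)) ⟨
    δ * (U (ρ ℕ.+ L) - U (σ ℕ.+ L) + (U (ρ ℕ.∸ L) - U (σ ℕ.∸ L))) ∎
    where
    open ≡-Reasoning
    ρ<q : ρ ℕ.< q
    ρ<q = ℕₚ.<-trans ρ<σ σ<q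
    polarize : ∀ a a′ b b′ → + 2 * (a * a′ - b * b′) ≡ (a - b) * (a′ + b′) + (a′ - b′) * (a + b)
    polarize = solve-∀

-- Letters reached from the two ends

module Words (n q F : ℕ) (1≤F : 1 ℕ.≤ F) (q+4F≤ : q ℕ.+ 4 ℕ.* F ℕ.≤ n ℕ.+ 2)
             (enough : (4 ℕ.+ F) ℕ.* 2 ℕ.≤ n ℕ.+ 2) where

  Fits : ℕ → Set
  Fits r = r ℕ.* 2 ℕ.≤ n ℕ.+ 2

  record Letters (w w* : ℕ → ℤ) : Set where
    field
      ≥1     : ∀ {i} → i ℕ.< q → 1ℤ ≤ w i
      ≤F     : ∀ {i} → i ℕ.< q → w i ≤ + F
      beyond : ∀ {i} → ¬ i ℕ.< q → w i ≡ 0ℤ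
      mirror : ∀ {i} → i ℕ.< q → w* i ≡ w (q ℕ.∸ suc i)

  -- All that the rest of the argument knows about the two words, each item with its cost. The sums
  -- reach one letter further than the products.
  record Agree (a a* b b* : ℕ → ℤ) : Set where
    field
      a-letters  : Letters a a*
      a*-letters : Letters a* a
      b-letters  : Letters b b*
      b*-letters : Letters b* b
      sums       : ∀ c → Fits (3 ℕ.+ F ℕ.+ c) → a c + a* c ≡ b c + b* c
      products   : ∀ c d → c ℕ.≤ d → Fits (4 ℕ.+ F ℕ.+ d) → a c * a d + a* c * a* d ≡ b c * b d + b* c * b* d
      totals     : ∑ {q} (λ i → a (toℕ i)) + ∑ {q} (λ i → a* (toℕ i)) ≡ ∑ {q} (λ i → b (toℕ i)) + ∑ {q} (λ i → b* (toℕ i))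
      correlated : ∀ L → Fits (4 ℕ.+ L) → autocorrelation q a (suc L) + autocorrelation q a* (suc L)
                                       ≡ autocorrelation q b (suc L) + autocorrelation q b* (suc L)

  swap : ∀ {a a* b b*} → Agree a a* b b* → Agree a a* b* b
  swap {a} {a*} {b} {b*} A = record
    { a-letters = a-letters ; a*-letters = a*-letters ; b-letters = b*-letters ; b*-letters = b-letters
    ; sums = λ c fits → trans (sums c fits) (ℤₚ.+-comm (b c) (b* c))
    ; products = λ c d c≤d fits → trans (products c d c≤d fits) (ℤₚ.+-comm (b c * b d) (b* c * b* d))
    ; totals = trans totals (ℤₚ.+-comm (∑ {q} (λ i → b (toℕ i))) (∑ {q} (λ i → b* (toℕ i))))
    ; correlated = λ L fits → trans (correlated L fits) (ℤₚ.+-comm (autocorrelation q b (suc L)) (autocorrelation q b* (suc L)))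
    }
    where open Agree A

  -- The positions at which sums and products are both available.
  Low : ℕ → Set
  Low c = Fits (4 ℕ.+ F ℕ.+ c)

  low? : ∀ c → Dec (Low c)
  low? c = (4 ℕ.+ F ℕ.+ c) ℕ.* 2 ℕ.≤? n ℕ.+ 2

  low-≤ : ∀ {c d} → c ℕ.≤ d → Low d → Low c
  low-≤ c≤d = ℕₚ.≤-trans (ℕₚ.*-monoˡ-≤ 2 (ℕₚ.+-monoʳ-≤ (4 ℕ.+ F) c≤d))

  low⇒mid : ∀ {c} → Low c → Fits (3 ℕ.+ F ℕ.+ c)
  low⇒mid {c} = ℕₚ.≤-trans (ℕₚ.*-monoˡ-≤ 2 {3 ℕ.+ F ℕ.+ c} {4 ℕ.+ F ℕ.+ c} (ℕₚ.n≤1+n _))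

  LowEqual : (a a* b b* : ℕ → ℤ) → Set
  LowEqual a a* b b* = ∀ c → c ℕ.< q → Low c → a c ≡ b c × a* c ≡ b* c

  module _ {a a* b b* : ℕ → ℤ} (A : Agree a a* b b*) where
    open Agree A

    private
      α β : ℕ → ℤ
      α c = a c - a* c
      β c = b c - b* c

      -- Differences of mirrored letters change sign under reversal, but their products do not; this
      -- writes the products through quantities in `Agree`.
      skew : (w w* : ℕ → ℤ) → ∀ c d → (w c - w* c) * (w d - w* d) ≡ + 2 * (w c * w d + w* c * w* d) - (w c + w* c) * (w d + w* d)
      skew w w* c d = identity (w c) (w* c) (w d) (w* d)
        where
        identity : ∀ x x* y y* → (x - x*) * (y - y*) ≡ + 2 * (x * y + x* * y*) - (x + x*) * (y + y*)
        identity = solve-∀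

      αβ : ∀ c d → c ℕ.≤ d → Low d → α c * α d ≡ β c * β d
      αβ c d c≤d low = trans (skew a a* c d) (trans
        (cong₂ (λ x y → + 2 * x - y) (products c d c≤d low) (cong₂ _*_ (sums c (low⇒mid (low-≤ c≤d low))) (sums d (low⇒mid low))))
        (sym (skew b b* c d)))

      αβ′ : ∀ c d → Low c → Low d → α c * α d ≡ β c * β d
      αβ′ c d lc ld with ℕₚ.≤-total c d
      ... | inj₁ c≤d = αβ c d c≤d ld
      ... | inj₂ d≤c = trans (ℤₚ.*-comm (α c) (α d)) (trans (αβ d c d≤c lc) (ℤₚ.*-comm (β d) (β c)))

      separate : ∀ x x* y y* → x - x* ≡ y - y* → x + x* ≡ y + y* → x ≡ y × x* ≡ y*
      separate x x* y y* diff sum = x≡y , +-cancelˡ x x* y* (trans sum (cong (_+ y*) (sym x≡y)))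
        where
        twice : ∀ x x* → x + x ≡ (x - x*) + (x + x*)
        twice = solve-∀
        x≡y : x ≡ y
        x≡y = double-inj (trans (twice x x*) (trans (cong₂ _+_ diff sum) (sym (twice y y*))))

    -- All products of two differences agree, so a single nonzero difference with the right sign
    -- fixes the others.
    same-sign : (∃ λ c → c ℕ.< q × Low c × α c ≢ 0ℤ × β c ≡ α c) → LowEqual a a* b b*
    same-sign (c₀ , _ , low₀ , α₀≢0 , β₀≡) c _ low = separate (a c) (a* c) (b c) (b* c)
      (ℤₚ.*-cancelˡ-≡ (α c₀) (α c) (β c) {{ℤ.≢-nonZero α₀≢0}} (trans (αβ′ c₀ c low₀ low) (cong (_* β c) β₀≡)))
      (sums c (low⇒mid low))

    orientation : LowEqual a a* b b* ⊎ (∃ λ c → c ℕ.< q × Low c × α c ≢ 0ℤ × β c ≡ - α c)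
    orientation with Finₚ.any? (λ (i : Fin q) → low? (toℕ i) ×-dec ¬? (α (toℕ i) ℤ.≟ 0ℤ))
    ... | yes (i , low , α≢0) with square-roots (αβ (toℕ i) (toℕ i) ℕₚ.≤-refl low)
    ...   | inj₁ β≡ = inj₁ (same-sign (toℕ i , Finₚ.toℕ<n i , low , α≢0 , β≡))
    ...   | inj₂ β≡ = inj₂ (toℕ i , Finₚ.toℕ<n i , low , α≢0 , β≡)
    orientation | no none = inj₁ λ c c<q low → separate (a c) (a* c) (b c) (b* c) (trans (α≡0 c<q low) (sym (β≡0 c<q low))) (sums c (low⇒mid low))
      where
      α≡0 : ∀ {c} → c ℕ.< q → Low c → α c ≡ 0ℤ
      α≡0 {c} c<q low with α c ℤ.≟ 0ℤ
      ... | yes eq = eq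
      ... | no ≢0 = contradiction (fromℕ< c<q , subst (λ i → Low i × α i ≢ 0ℤ) (sym (Finₚ.toℕ-fromℕ< c<q)) (low , ≢0)) none
      β≡0 : ∀ {c} → c ℕ.< q → Low c → β c ≡ 0ℤ
      β≡0 {c} c<q low = [ id , id ]′ (ℤₚ.i*j≡0⇒i≡0∨j≡0 (β c) (trans (sym (αβ c c ℕₚ.≤-refl low))
        (cong (_* α c) (α≡0 c<q low))))

  oriented : ∀ {a a* b b*} → Agree a a* b b* → LowEqual a a* b b* ⊎ LowEqual a a* b* b
  oriented {a} {a*} {b} {b*} A with orientation A
  ... | inj₁ eq = inj₁ eq
  ... | inj₂ (c , c<q , low , α≢0 , β≡) = inj₂ (same-sign (swap A) (c , c<q , low , α≢0 , trans (flip (b c) (b* c)) (trans (cong -_ β≡) (ℤₚ.neg-involutive (a c - a* c)))))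
    where
    flip : ∀ x y → y - x ≡ - (x - y)
    flip = solve-∀

  Conclusion : (a b b* : ℕ → ℤ) → Set
  Conclusion a b b* = (∀ i → i ℕ.< q → a i ≡ b i) ⊎ (∀ i → i ℕ.< q → a i ≡ b* i)

  -- Here ρ is meant to be the first position that is not low and σ is its mirror image. At ρ only
  -- the sum of the letter and its mirror image is known.
  module Middle {a a* b b* : ℕ → ℤ} (A : Agree a a* b b*) (low-eq : LowEqual a a* b b*)
                (ρ κ : ℕ) (q≡ : q ≡ suc (ρ ℕ.+ κ ℕ.+ ρ)) (below : ∀ {c} → c ℕ.< ρ → Low c) (mid : Fits (3 ℕ.+ F ℕ.+ ρ)) where
    open Agree A
    open Letters

    σ : ℕ
    σ = ρ ℕ.+ κ

    mirror-σ+ : ∀ {t} → t ℕ.≤ ρ → q ℕ.∸ suc (ρ ℕ.∸ t) ≡ σ ℕ.+ t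
    mirror-σ+ {t} t≤ρ = trans (cong (ℕ._∸ suc (ρ ℕ.∸ t)) q≡) (trans (ℕₚ.+-∸-assoc σ (ℕₚ.m∸n≤m ρ t)) (cong (σ ℕ.+_) (ℕₚ.m∸[m∸n]≡n t≤ρ)))

    σ+<q : ∀ {t} → t ℕ.≤ ρ → σ ℕ.+ t ℕ.< q
    σ+<q t≤ρ = subst (σ ℕ.+ _ ℕ.<_) (sym q≡) (s≤s (ℕₚ.+-monoʳ-≤ σ t≤ρ))

    ≤ρ<q : ∀ {i} → i ℕ.≤ ρ → i ℕ.< q
    ≤ρ<q i≤ρ = subst (_ ℕ.<_) (sym q≡) (s≤s (ℕₚ.≤-trans i≤ρ (ℕₚ.m≤n+m ρ σ)))

    reflect : ∀ {w w*} → Letters w w* → ∀ {t} → t ℕ.≤ ρ → w* (ρ ℕ.∸ t) ≡ w (σ ℕ.+ t)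
    reflect {w} l {t} t≤ρ = trans (mirror l (≤ρ<q (ℕₚ.m∸n≤m ρ t))) (cong w (mirror-σ+ t≤ρ))

    outer : ∀ {t} → 1 ℕ.≤ t → t ℕ.≤ ρ → a (ρ ℕ.∸ t) ≡ b (ρ ℕ.∸ t) × a* (ρ ℕ.∸ t) ≡ b* (ρ ℕ.∸ t)
    outer {t} 1≤t t≤ρ = low-eq (ρ ℕ.∸ t) (≤ρ<q (ℕₚ.m∸n≤m ρ t)) (below (ℕₚ.∸-monoʳ-< {ρ} {t} {0} 1≤t t≤ρ))

    data Position (i : ℕ) : Set where
      left   : ∀ t → 1 ℕ.≤ t → t ℕ.≤ ρ → i ≡ ρ ℕ.∸ t → Position i
      right  : ∀ t → 1 ℕ.≤ t → t ℕ.≤ ρ → i ≡ σ ℕ.+ t → Position i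
      middle : ρ ℕ.≤ i → i ℕ.≤ σ → Position i

    position : ∀ i → i ℕ.< q → Position i
    position i i<q with ρ ℕ.≤? i
    ... | no ρ≰i = left (ρ ℕ.∸ i) (ℕₚ.m<n⇒0<n∸m (ℕₚ.≰⇒> ρ≰i)) (ℕₚ.m∸n≤m ρ i) (sym (ℕₚ.m∸[m∸n]≡n (ℕₚ.<⇒≤ (ℕₚ.≰⇒> ρ≰i))))
    ... | yes ρ≤i with i ℕ.≤? σ
    ...   | yes i≤σ = middle ρ≤i i≤σ
    ...   | no i≰σ = right (i ℕ.∸ σ) (ℕₚ.m<n⇒0<n∸m (ℕₚ.≰⇒> i≰σ))
              (ℕₚ.m≤n+o⇒m∸n≤o i σ (ℕₚ.≤-pred (subst (i ℕ.<_) q≡ i<q)))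
              (sym (ℕₚ.m+[n∸m]≡n (ℕₚ.<⇒≤ (ℕₚ.≰⇒> i≰σ))))

    mid-sum : a ρ + a σ ≡ b ρ + b σ
    mid-sum = trans (cong (_+_ (a ρ)) (sym (at-σ a-letters))) (trans (sums ρ mid) (cong (_+_ (b ρ)) (at-σ b-letters)))
      where
      at-σ : ∀ {w w*} → Letters w w* → w* ρ ≡ w σ
      at-σ {w} l = trans (reflect l z≤n) (cong w (ℕₚ.+-identityʳ σ))

    equal-unless-middle : (∀ i → ρ ℕ.≤ i → i ℕ.≤ σ → a i ≡ b i) → ∀ i → i ℕ.< q → a i ≡ b i
    equal-unless-middle mid-eq i i<q with position i i<q
    ... | left t 1≤t t≤ρ refl = proj₁ (outer 1≤t t≤ρ)
    ... | right t 1≤t t≤ρ refl = trans (sym (reflect a-letters t≤ρ)) (trans (proj₂ (outer 1≤t t≤ρ)) (reflect b-letters t≤ρ))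
    ... | middle ρ≤i i≤σ = mid-eq i ρ≤i i≤σ

crossed : ∀ {x y z w : ℤ} → x ≡ + 1 ⊎ x ≡ + 2 → y ≡ + 1 ⊎ y ≡ + 2 → z ≡ + 1 ⊎ z ≡ + 2 → w ≡ + 1 ⊎ w ≡ + 2 →
          x ≢ y → x + z ≡ y + w → x ≡ w × z ≡ y
crossed (inj₁ refl) (inj₁ refl) _ _ x≢y _ = contradiction refl x≢y
crossed (inj₂ refl) (inj₂ refl) _ _ x≢y _ = contradiction refl x≢y
crossed (inj₁ refl) (inj₂ refl) (inj₂ refl) (inj₁ refl) _ _ = refl , refl
crossed (inj₂ refl) (inj₁ refl) (inj₁ refl) (inj₂ refl) _ _ = refl , refl
crossed (inj₁ refl) (inj₂ refl) (inj₁ refl) (inj₁ refl) _ ()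
crossed (inj₁ refl) (inj₂ refl) (inj₁ refl) (inj₂ refl) _ ()
crossed (inj₁ refl) (inj₂ refl) (inj₂ refl) (inj₂ refl) _ ()
crossed (inj₂ refl) (inj₁ refl) (inj₁ refl) (inj₁ refl) _ ()
crossed (inj₂ refl) (inj₁ refl) (inj₂ refl) (inj₁ refl) _ ()
crossed (inj₂ refl) (inj₁ refl) (inj₂ refl) (inj₂ refl) _ ()

-- A pair of letters that may be exchanged

module WordsAgree (n q F : ℕ) (1≤F : 1 ℕ.≤ F) (q+4F≤ : q ℕ.+ 4 ℕ.* F ℕ.≤ n ℕ.+ 2)
                  (enough : (4 ℕ.+ F) ℕ.* 2 ℕ.≤ n ℕ.+ 2) where
  open Words n q F 1≤F q+4F≤ enough public

  ∑-letters : ∀ {w w*} → Letters w w* → ∑ {q} (λ i → w* (toℕ i)) ≡ ∑ {q} (λ i → w (toℕ i))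
  ∑-letters {w} l = trans (∑-cong (λ i → Letters.mirror l (Finₚ.toℕ<n i))) (sym (∑-mirror q w))

  module Close {a a* b b* : ℕ → ℤ} (A : Agree a a* b b*) (low-eq : LowEqual a a* b b*)
               (ρ κ : ℕ) (q≡ : q ≡ suc (ρ ℕ.+ κ ℕ.+ ρ)) (below : ∀ {c} → c ℕ.< ρ → Low c) (mid : Fits (3 ℕ.+ F ℕ.+ ρ)) where
    open Agree A
    open Letters
    open Middle A low-eq ρ κ q≡ below mid

    ρ<q : ρ ℕ.< q
    ρ<q = ≤ρ<q ℕₚ.≤-refl

    σ<q : σ ℕ.< q
    σ<q = subst (ℕ._< q) (ℕₚ.+-identityʳ σ) (σ+<q z≤n)

    mirror-ρ : q ℕ.∸ suc ρ ≡ σ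
    mirror-ρ = trans (mirror-σ+ z≤n) (ℕₚ.+-identityʳ σ)

    mirror-σ : q ℕ.∸ suc σ ≡ ρ
    mirror-σ = trans (cong (λ t → q ℕ.∸ suc t) (sym mirror-ρ)) (mirror-mirror ρ<q)

    aσ-determined : a ρ ≡ b ρ → a σ ≡ b σ
    aσ-determined eq = +-cancelˡ (a ρ) (a σ) (b σ) (trans mid-sum (cong (_+ b σ) (sym eq)))

    -- Either a and b agree at ρ, and then everywhere, or they have the letters 1 and 2 at ρ and σ
    -- exchanged. In the second case the autocorrelations force a to be the reverse of b.
    module TwoLetters (F≡2 : F ≡ 2) (ρ<σ : ρ ℕ.< σ)
                      (centre : ∀ i → ρ ℕ.< i → i ℕ.< σ → a i ≡ b i)
                      (centre-mirror : ∀ i → ρ ℕ.< i → i ℕ.< σ → q ℕ.∸ suc i ≡ i) where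

      equal-if : a ρ ≡ b ρ → ∀ i → i ℕ.< q → a i ≡ b i
      equal-if eq = equal-unless-middle cases
        where
        cases : ∀ i → ρ ℕ.≤ i → i ℕ.≤ σ → a i ≡ b i
        cases i ρ≤i i≤σ with ℕₚ.m≤n⇒m<n∨m≡n ρ≤i | ℕₚ.m≤n⇒m<n∨m≡n i≤σ
        ... | inj₂ refl | _ = eq
        ... | _ | inj₂ refl = aσ-determined eq
        ... | inj₁ ρ<i | inj₁ i<σ = centre i ρ<i i<σ

      module _ (aρ≢bρ : a ρ ≢ b ρ) where
        private
          letter : ∀ {w w*} → Letters w w* → ∀ {i} → i ℕ.< q → w i ≡ + 1 ⊎ w i ≡ + 2
          letter l i<q = one-or-two (≥1 l i<q) (subst (λ F → _ ≤ + F) F≡2 (≤F l i<q))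

          exchanged : a ρ ≡ b σ × a σ ≡ b ρ
          exchanged = crossed (letter a-letters ρ<q) (letter b-letters ρ<q) (letter a-letters σ<q) (letter b-letters σ<q) aρ≢bρ mid-sum

          δ = a ρ - b ρ

          U : ℕ → ℤ
          U i = a i + b i

          at-σ : a σ - b σ ≡ - δ
          at-σ = trans (cong₂ _-_ (proj₂ exchanged) (sym (proj₁ exchanged))) (flip (a ρ) (b ρ))
            where
            flip : ∀ x y → y - x ≡ - (x - y)
            flip = solve-∀

          elsewhere : ∀ i → i ≢ ρ → i ≢ σ → a i - b i ≡ 0ℤ
          elsewhere i i≢ρ i≢σ with i ℕ.<? q
          ... | no i≮q = cong₂ _-_ (beyond a-letters i≮q) (beyond b-letters i≮q)
          ... | yes i<q = trans (cong (_- b i) (equal (position i i<q))) (ℤₚ.+-inverseʳ (b i))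
            where
            equal : Position i → a i ≡ b i
            equal (left t 1≤t t≤ρ refl) = proj₁ (outer 1≤t t≤ρ)
            equal (right t 1≤t t≤ρ refl) = trans (sym (reflect a-letters t≤ρ)) (trans (proj₂ (outer 1≤t t≤ρ)) (reflect b-letters t≤ρ))
            equal (middle ρ≤i i≤σ) = centre i (ℕₚ.≤∧≢⇒< ρ≤i (i≢ρ ∘ sym)) (ℕₚ.≤∧≢⇒< i≤σ i≢σ)

          mirrored : ∀ i → i ℕ.< q → a* i - b* i ≡ a (q ℕ.∸ suc i) - b (q ℕ.∸ suc i)
          mirrored i i<q = cong₂ _-_ (mirror a-letters i<q) (mirror b-letters i<q)

          at-ρ* : a* ρ - b* ρ ≡ - δ
          at-ρ* = trans (mirrored ρ ρ<q) (trans (cong (λ j → a j - b j) mirror-ρ) at-σ)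

          at-σ* : a* σ - b* σ ≡ - (- δ)
          at-σ* = trans (mirrored σ σ<q) (trans (cong (λ j → a j - b j) mirror-σ) (sym (ℤₚ.neg-involutive δ)))

          elsewhere* : ∀ i → i ≢ ρ → i ≢ σ → a* i - b* i ≡ 0ℤ
          elsewhere* i i≢ρ i≢σ with i ℕ.<? q
          ... | no i≮q = cong₂ _-_ (beyond a*-letters i≮q) (beyond b*-letters i≮q)
          ... | yes i<q = trans (mirrored i i<q) (elsewhere (q ℕ.∸ suc i)
                  (λ eq → i≢σ (trans (sym (mirror-mirror i<q)) (trans (cong (λ j → q ℕ.∸ suc j) eq) mirror-ρ)))
                  (λ eq → i≢ρ (trans (sym (mirror-mirror i<q)) (trans (cong (λ j → q ℕ.∸ suc j) eq) mirror-σ))))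

          reflect+ : ∀ {w w*} → Letters w w* → ∀ {L} → L ℕ.≤ ρ → w* (ρ ℕ.+ L) ≡ w (σ ℕ.∸ L)
          reflect+ {w} l {L} L≤ρ = trans (mirror l ρ+L<q) (cong w (trans (cong (ℕ._∸ suc (ρ ℕ.+ L)) (trans q≡ (cong suc (ℕₚ.+-comm σ ρ)))) (ℕₚ.[m+n]∸[m+o]≡n∸o ρ σ L)))
            where
            ρ+L<q : ρ ℕ.+ L ℕ.< q
            ρ+L<q = subst (ρ ℕ.+ L ℕ.<_) (sym q≡) (s≤s (ℕₚ.+-mono-≤ (ℕₚ.<⇒≤ ρ<σ) L≤ρ))

          -- For the reversed words the pulses have opposite sign and everything is read from the
          -- other side, so they contribute the same difference. Only the sum of both contributions
          -- is known to vanish; hence each vanishes, and δ ≠ 0 cancels.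
          balance : ∀ L → suc L ℕ.≤ ρ → U (ρ ℕ.+ suc L) + U (ρ ℕ.∸ suc L) ≡ U (σ ℕ.+ suc L) + U (σ ℕ.∸ suc L)
          balance L L<ρ = conclude (U (ρ ℕ.+ suc L)) (U (σ ℕ.+ suc L)) (U (ρ ℕ.∸ suc L)) (U (σ ℕ.∸ suc L))
            (autocorrelation q a (suc L)) (autocorrelation q b (suc L)) (autocorrelation q a* (suc L)) (autocorrelation q b* (suc L))
            (autocorrelation-difference {q} a b {δ} {ρ} {σ} σ<q ρ<σ refl at-σ elsewhere L<ρ)
            (trans (autocorrelation-difference {q} a* b* { - δ} {ρ} {σ} σ<q ρ<σ at-ρ* at-σ* elsewhere* L<ρ)
              (cong₂ (λ s t → - δ * (s + t)) (cong₂ _-_ (U+ L<ρ) (U* (sym (reflect a*-letters L<ρ)) (sym (reflect b*-letters L<ρ))))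
                (cong₂ _-_ (U* (reflect a-letters L<ρ) (reflect b-letters L<ρ)) (U* (sym (reflect+ a*-letters L<ρ)) (sym (reflect+ b*-letters L<ρ))))))
            -- The cost 4 + L is at most 3 + ρ, so every shift up to ρ is affordable.
            (correlated L (ℕₚ.≤-trans (ℕₚ.*-monoˡ-≤ 2 (s≤s (s≤s (s≤s (ℕₚ.≤-trans L<ρ (ℕₚ.m≤n+m ρ F)))))) mid))
            where
            U+ : suc L ℕ.≤ ρ → a* (ρ ℕ.+ suc L) + b* (ρ ℕ.+ suc L) ≡ U (σ ℕ.∸ suc L)
            U+ L<ρ = cong₂ _+_ (reflect+ a-letters L<ρ) (reflect+ b-letters L<ρ)
            U* : ∀ {x x′ y y′ : ℤ} → x ≡ x′ → y ≡ y′ → x + y ≡ x′ + y′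
            U* = cong₂ _+_
            δ≢0 : δ ≢ 0ℤ
            δ≢0 eq = aρ≢bρ (≡-by-difference eq)
            conclude : ∀ u v r s ca cb ca* cb* →
              + 2 * (ca - cb) ≡ δ * (u - v + (r - s)) → + 2 * (ca* - cb*) ≡ - δ * (s - r + (v - u)) →
              ca + ca* ≡ cb + cb* → u + r ≡ v + s
            conclude u v r s ca cb ca* cb* e₁ e₂ e₃ = ≡-by-difference (trans (shape u v r s) (zero-of (ℤₚ.i*j≡0⇒i≡0∨j≡0 δ (*-cancelˡ-pos {+ 2} (+<+ (s≤s z≤n)) (begin
              + 2 * (δ * (u - v + (r - s)))                              ≡⟨ twice δ (u - v + (r - s)) ⟩
              δ * (u - v + (r - s)) + δ * (u - v + (r - s))              ≡⟨ cong (_+_ (δ * (u - v + (r - s)))) (negate δ u v r s) ⟩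
              δ * (u - v + (r - s)) + - δ * (s - r + (v - u))            ≡⟨ cong₂ _+_ e₁ e₂ ⟨
              + 2 * (ca - cb) + + 2 * (ca* - cb*)                        ≡⟨ gather ca cb ca* cb* ⟩
              + 2 * (ca + ca* - (cb + cb*))                              ≡⟨ cong (λ t → + 2 * (t - (cb + cb*))) e₃ ⟩
              + 2 * (cb + cb* - (cb + cb*))                              ≡⟨ cong (_*_ (+ 2)) (ℤₚ.+-inverseʳ (cb + cb*)) ⟩
              + 2 * 0ℤ ∎)))))
              where
              open ≡-Reasoning
              shape : ∀ u v r s → u + r - (v + s) ≡ u - v + (r - s)
              shape = solve-∀
              twice : ∀ d z → + 2 * (d * z) ≡ d * z + d * z
              twice = solve-∀
              negate : ∀ d u v r s → d * (u - v + (r - s)) ≡ - d * (s - r + (v - u))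
              negate = solve-∀
              gather : ∀ a b c d → + 2 * (a - b) + + 2 * (c - d) ≡ + 2 * (a + c - (b + d))
              gather = solve-∀
              zero-of : δ ≡ 0ℤ ⊎ u - v + (r - s) ≡ 0ℤ → u - v + (r - s) ≡ 0ℤ
              zero-of (inj₁ eq) = contradiction eq δ≢0
              zero-of (inj₂ eq) = eq

          base : U ρ ≡ U σ
          base = trans (cong₂ _+_ (proj₁ exchanged) (sym (proj₂ exchanged))) (ℤₚ.+-comm (b σ) (a σ))

        module Reversed (symmetric : ∀ t → t ℕ.≤ ρ → U (ρ ℕ.∸ t) ≡ U (σ ℕ.+ t)) where
          -- Left of ρ the words agree, and so do their reverses. Symmetry of a + b therefore
          -- equates twice a letter of a with twice the letter of the reverse of b.
          reversed : ∀ i → i ℕ.< q → a i ≡ b* i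
          reversed i i<q = cases (position i i<q)
            where
            on-left : ∀ {t} → 1 ℕ.≤ t → t ℕ.≤ ρ → a (ρ ℕ.∸ t) ≡ b* (ρ ℕ.∸ t)
            on-left {t} 1≤t t≤ρ = double-inj (trans (cong (_+_ (a (ρ ℕ.∸ t))) (proj₁ (outer 1≤t t≤ρ)))
              (trans (symmetric t t≤ρ) (trans (sym (cong₂ _+_ (reflect a-letters t≤ρ) (reflect b-letters t≤ρ)))
                (cong (_+ b* (ρ ℕ.∸ t)) (proj₂ (outer 1≤t t≤ρ))))))
            cases : Position i → a i ≡ b* i
            cases (left t 1≤t t≤ρ refl) = on-left 1≤t t≤ρ
            cases (right t 1≤t t≤ρ refl) = trans (sym (reflect a-letters t≤ρ)) (trans (proj₂ (outer 1≤t t≤ρ))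
              (trans (sym (on-left 1≤t t≤ρ)) (trans (proj₁ (outer 1≤t t≤ρ)) (reflect b*-letters t≤ρ))))
            cases (middle ρ≤i i≤σ) with ℕₚ.m≤n⇒m<n∨m≡n ρ≤i | ℕₚ.m≤n⇒m<n∨m≡n i≤σ
            ... | inj₂ refl | _ = trans (proj₁ exchanged) (trans (cong b (sym mirror-ρ)) (sym (mirror b-letters ρ<q)))
            ... | _ | inj₂ refl = trans (proj₂ exchanged) (trans (cong b (sym mirror-σ)) (sym (mirror b-letters σ<q)))
            ... | inj₁ ρ<i | inj₁ i<σ = trans (centre i ρ<i i<σ) (trans (cong b (sym (centre-mirror i ρ<i i<σ))) (sym (mirror b-letters i<q)))

        module Induct where
          -- Induction in steps of κ, which is 1 or 2. Since σ - (t + κ) = ρ - t and ρ + (t + κ) = σ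
          -- + t, the inner terms of `balance` at shift t + κ agree by the case t, so the outer
          -- terms agree. For κ = 2 and shift 1 the inner terms are the same letter.
          U-sym : ∀ κ′ → κ ≡ suc κ′ → κ′ ℕ.≤ 1 → ∀ t → t ℕ.≤ ρ → U (ρ ℕ.∸ t) ≡ U (σ ℕ.+ t)
          U-sym κ′ _ _ zero _ = trans base (cong U (sym (ℕₚ.+-identityʳ σ)))
          U-sym zero κ≡ κ′≤1 (suc t) t<ρ = +-cancelˡ (U (ρ ℕ.+ suc t)) _ _ (trans (balance t t<ρ)
            (trans (cong (_+_ (U (σ ℕ.+ suc t))) (trans (cong U σ∸) (trans (U-sym zero κ≡ κ′≤1 t (ℕₚ.<⇒≤ t<ρ)) (cong U σ+)))) (ℤₚ.+-comm (U (σ ℕ.+ suc t)) (U (ρ ℕ.+ suc t)))))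
            where
            σ≡ : σ ≡ suc ρ
            σ≡ = trans (cong (ρ ℕ.+_) κ≡) (ℕₚ.+-comm ρ 1)
            σ∸ : σ ℕ.∸ suc t ≡ ρ ℕ.∸ t
            σ∸ = cong (ℕ._∸ suc t) σ≡
            σ+ : σ ℕ.+ t ≡ ρ ℕ.+ suc t
            σ+ = trans (cong (ℕ._+ t) σ≡) (sym (ℕₚ.+-suc ρ t))
          U-sym (suc zero) κ≡ _ (suc zero) 1≤ρ = +-cancelˡ (U (ρ ℕ.+ 1)) _ _ (trans (balance 0 1≤ρ)
            (trans (cong (λ j → U (σ ℕ.+ 1) + U j) σ∸) (ℤₚ.+-comm (U (σ ℕ.+ 1)) (U (ρ ℕ.+ 1)))))
            where
            σ∸ : σ ℕ.∸ 1 ≡ ρ ℕ.+ 1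
            σ∸ = trans (cong (λ k → ρ ℕ.+ k ℕ.∸ 1) κ≡) (ℕₚ.+-∸-assoc ρ {2} {1} (s≤s z≤n))
          U-sym (suc zero) κ≡ κ′≤1 (suc (suc t)) t<ρ = +-cancelˡ (U (ρ ℕ.+ suc (suc t))) _ _ (trans (balance (suc t) t<ρ)
            (trans (cong (_+_ (U (σ ℕ.+ suc (suc t)))) (trans (cong U σ∸) (trans (U-sym (suc zero) κ≡ κ′≤1 t (ℕₚ.≤-trans (ℕₚ.≤-trans (ℕₚ.n≤1+n t) (ℕₚ.n≤1+n _)) t<ρ)) (cong U σ+))))
              (ℤₚ.+-comm (U (σ ℕ.+ suc (suc t))) (U (ρ ℕ.+ suc (suc t))))))
            where
            σ≡ : σ ≡ suc (suc ρ)
            σ≡ = trans (cong (ρ ℕ.+_) κ≡) (ℕₚ.+-comm ρ 2)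
            σ∸ : σ ℕ.∸ suc (suc t) ≡ ρ ℕ.∸ t
            σ∸ = cong (ℕ._∸ suc (suc t)) σ≡
            σ+ : σ ℕ.+ t ≡ ρ ℕ.+ suc (suc t)
            σ+ = trans (cong (ℕ._+ t) σ≡) (sym (trans (ℕₚ.+-suc ρ (suc t)) (cong suc (ℕₚ.+-suc ρ t))))
          U-sym (suc (suc _)) _ (s≤s ())

        finish : ∀ κ′ → κ ≡ suc κ′ → κ′ ℕ.≤ 1 → ∀ i → i ℕ.< q → a i ≡ b* i
        finish κ′ κ≡ κ′≤1 = Reversed.reversed (Induct.U-sym κ′ κ≡ κ′≤1)

-- The hidden block in the middle

module WordsTheorem (n q F : ℕ) (1≤F : 1 ℕ.≤ F) (q+4F≤ : q ℕ.+ 4 ℕ.* F ℕ.≤ n ℕ.+ 2)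
                    (enough : (4 ℕ.+ F) ℕ.* 2 ℕ.≤ n ℕ.+ 2) where
  open WordsAgree n q F 1≤F q+4F≤ enough public

  module _ {a a* b b* : ℕ → ℤ} (A : Agree a a* b b*) (low-eq : LowEqual a a* b b*) where
    open Agree A
    open Letters

    ∑a≡∑b : ∑ {q} (λ i → a (toℕ i)) ≡ ∑ {q} (λ i → b (toℕ i))
    ∑a≡∑b = double-inj (trans (cong (_+_ (∑ {q} (λ i → a (toℕ i)))) (sym (∑-letters a-letters)))
      (trans totals (cong (_+_ (∑ {q} (λ i → b (toℕ i)))) (∑-letters b-letters))))

    module Centre (ρ : ℕ) (q≡ : q ≡ suc (ρ ℕ.+ 2 ℕ.+ ρ)) (below : ∀ {c} → c ℕ.< ρ → Low c) (mid : Fits (3 ℕ.+ F ℕ.+ ρ)) where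
      open Middle A low-eq ρ 2 q≡ below mid
      open Close A low-eq ρ 2 q≡ below mid using (ρ<q; σ<q)

      private
        m : ℕ
        m = suc ρ

        E : ℕ → ℤ
        E i = a i - b i

        σ≡ : σ ≡ suc m
        σ≡ = ℕₚ.+-comm ρ 2

        m<q : m ℕ.< q
        m<q = ℕₚ.<-trans (subst (m ℕ.<_) (sym σ≡) (ℕₚ.n<1+n m)) σ<q

        outside-zero : ∀ i → i ℕ.< q → i ≢ ρ → i ≢ m → i ≢ σ → E i ≡ 0ℤ
        outside-zero i i<q i≢ρ i≢m i≢σ = cases (position i i<q)
          where
          cases : Position i → E i ≡ 0ℤ
          cases (left t 1≤t t≤ρ refl) = trans (cong (_- b i) (proj₁ (outer 1≤t t≤ρ))) (ℤₚ.+-inverseʳ (b i))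
          cases (right t 1≤t t≤ρ refl) = trans (cong (_- b i) (trans (sym (reflect a-letters t≤ρ)) (trans (proj₂ (outer 1≤t t≤ρ)) (reflect b-letters t≤ρ)))) (ℤₚ.+-inverseʳ (b i))
          cases (middle ρ≤i i≤σ) = contradiction (ℕₚ.≤-antisym (ℕₚ.≤-pred (subst (i ℕ.<_) σ≡ (ℕₚ.≤∧≢⇒< i≤σ i≢σ))) (ℕₚ.≤∧≢⇒< ρ≤i (i≢ρ ∘ sym))) i≢m

        [_≟_] : ℕ → ℕ → ℤ
        [ i ≟ k ] = 𝟙 (does (i ℕ.≟ k))

        is : ∀ k → [ k ≟ k ] ≡ 1ℤ
        is k = cong 𝟙 (dec-true (k ℕ.≟ k) refl)

        isn't : ∀ {i k} → i ≢ k → [ i ≟ k ] ≡ 0ℤ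
        isn't {i} {k} i≢k = cong 𝟙 (dec-false (i ℕ.≟ k) i≢k)

        three : ∀ i → i ℕ.< q → E i ≡ [ i ≟ ρ ] * E i + ([ i ≟ m ] * E i + [ i ≟ σ ] * E i)
        three i i<q with i ℕ.≟ ρ | i ℕ.≟ m | i ℕ.≟ σ
        ... | yes i≡ρ | _ | _ = sum-to-one (trans (cong (λ j → [ i ≟ j ]) (sym i≡ρ)) (is i))
                (isn't (λ i≡m → ℕₚ.<-irrefl (trans (sym i≡ρ) i≡m) (ℕₚ.n<1+n ρ)))
                (isn't (λ i≡σ → ℕₚ.<-irrefl (trans (sym i≡ρ) (trans i≡σ σ≡)) (ℕₚ.<-trans (ℕₚ.n<1+n ρ) (ℕₚ.n<1+n m))))
          where
          sum-to-one : ∀ {x y z} → x ≡ 1ℤ → y ≡ 0ℤ → z ≡ 0ℤ → E i ≡ x * E i + (y * E i + z * E i)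
          sum-to-one refl refl refl = val (E i)
            where
            val : ∀ e → e ≡ 1ℤ * e + (0ℤ * e + 0ℤ * e)
            val = solve-∀
        ... | no i≢ρ | yes i≡m | _ = sum-to-one (isn't i≢ρ) (trans (cong (λ j → [ i ≟ j ]) (sym i≡m)) (is i))
                (isn't (λ i≡σ → ℕₚ.<-irrefl (trans (sym i≡m) (trans i≡σ σ≡)) (ℕₚ.n<1+n m)))
          where
          sum-to-one : ∀ {x y z} → x ≡ 0ℤ → y ≡ 1ℤ → z ≡ 0ℤ → E i ≡ x * E i + (y * E i + z * E i)
          sum-to-one refl refl refl = val (E i)
            where
            val : ∀ e → e ≡ 0ℤ * e + (1ℤ * e + 0ℤ * e)
            val = solve-∀
        ... | no i≢ρ | no i≢m | yes i≡σ = sum-to-one (isn't i≢ρ) (isn't i≢m) (trans (cong (λ j → [ i ≟ j ]) (sym i≡σ)) (is i))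
          where
          sum-to-one : ∀ {x y z} → x ≡ 0ℤ → y ≡ 0ℤ → z ≡ 1ℤ → E i ≡ x * E i + (y * E i + z * E i)
          sum-to-one refl refl refl = val (E i)
            where
            val : ∀ e → e ≡ 0ℤ * e + (0ℤ * e + 1ℤ * e)
            val = solve-∀
        ... | no i≢ρ | no i≢m | no i≢σ = all-zero ([ i ≟ ρ ]) ([ i ≟ m ]) ([ i ≟ σ ]) (outside-zero i i<q i≢ρ i≢m i≢σ)
          where
          all-zero : ∀ x y z {e} → e ≡ 0ℤ → e ≡ x * e + (y * e + z * e)
          all-zero x y z refl = val x y z
            where
            val : ∀ x y z → 0ℤ ≡ x * 0ℤ + (y * 0ℤ + z * 0ℤ)
            val = solve-∀

        at : ∀ {k} → k ℕ.< q → ∑ {q} (λ i → [ toℕ i ≟ k ] * E (toℕ i)) ≡ E k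
        at {k} k<q = trans (∑-δℕ q k E) (zeroExtend-< E k<q)

        total-E : E ρ + (E m + E σ) ≡ 0ℤ
        total-E = begin
          E ρ + (E m + E σ)
            ≡⟨ cong₂ _+_ (at ρ<q) (cong₂ _+_ (at m<q) (at σ<q)) ⟨
          ∑ {q} (λ i → [ toℕ i ≟ ρ ] * E (toℕ i)) + (∑ {q} (λ i → [ toℕ i ≟ m ] * E (toℕ i)) + ∑ {q} (λ i → [ toℕ i ≟ σ ] * E (toℕ i)))
            ≡⟨ cong (_+_ (∑ {q} (λ i → [ toℕ i ≟ ρ ] * E (toℕ i)))) (∑-+ (λ (i : Fin q) → [ toℕ i ≟ m ] * E (toℕ i)) (λ i → [ toℕ i ≟ σ ] * E (toℕ i))) ⟨
          ∑ {q} (λ i → [ toℕ i ≟ ρ ] * E (toℕ i)) + ∑ {q} (λ i → [ toℕ i ≟ m ] * E (toℕ i) + [ toℕ i ≟ σ ] * E (toℕ i))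
            ≡⟨ ∑-+ (λ (i : Fin q) → [ toℕ i ≟ ρ ] * E (toℕ i)) (λ i → [ toℕ i ≟ m ] * E (toℕ i) + [ toℕ i ≟ σ ] * E (toℕ i)) ⟨
          ∑ {q} (λ i → [ toℕ i ≟ ρ ] * E (toℕ i) + ([ toℕ i ≟ m ] * E (toℕ i) + [ toℕ i ≟ σ ] * E (toℕ i)))
            ≡⟨ ∑-cong (λ i → three (toℕ i) (Finₚ.toℕ<n i)) ⟨
          ∑ {q} (λ i → a (toℕ i) - b (toℕ i))
            ≡⟨ ∑-- (λ (i : Fin q) → a (toℕ i)) (λ i → b (toℕ i)) ⟩
          ∑ {q} (λ i → a (toℕ i)) - ∑ {q} (λ i → b (toℕ i))
            ≡⟨ cong (_- ∑ {q} (λ i → b (toℕ i))) ∑a≡∑b ⟩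
          ∑ {q} (λ i → b (toℕ i)) - ∑ {q} (λ i → b (toℕ i))
            ≡⟨ ℤₚ.+-inverseʳ (∑ {q} (λ i → b (toℕ i))) ⟩
          0ℤ ∎
          where open ≡-Reasoning

      -- The words agree outside ρ, m and σ; the sum of all letters is known, and so is the sum of
      -- the letters at ρ and σ.
      centre-letter : a m ≡ b m
      centre-letter = ≡-by-difference (conclude (a ρ) (b ρ) (a m) (b m) (a σ) (b σ) total-E mid-sum)
        where
        conclude : ∀ x x′ y y′ z z′ → (x - x′) + ((y - y′) + (z - z′)) ≡ 0ℤ → x + z ≡ x′ + z′ → y - y′ ≡ 0ℤ
        conclude x x′ y y′ z z′ e₁ e₂ = trans (shape x x′ y y′ z z′) (cong₂ _-_ e₁ (trans (cong (_- (x′ + z′)) e₂) (ℤₚ.+-inverseʳ (x′ + z′))))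
          where
          shape : ∀ x x′ y y′ z z′ → y - y′ ≡ ((x - x′) + ((y - y′) + (z - z′))) - ((x + z) - (x′ + z′))
          shape = solve-∀

    private
      -- If κ = 0, one letter is hidden and its double is known. Otherwise F ≤ 2: for F = 1 all
      -- letters are 1, and for F = 2 the gap κ is 1 or 2, so that at most one further letter lies
      -- between ρ and σ.
      finish-at : ∀ ρ κ → q ≡ suc (ρ ℕ.+ κ ℕ.+ ρ) → (∀ {c} → c ℕ.< ρ → Low c) → Fits (3 ℕ.+ F ℕ.+ ρ) →
                  κ ℕ.+ 2 ℕ.* F ℕ.≤ 6 → Conclusion a b b*
      finish-at ρ zero q≡ below mid _ = inj₁ (equal-unless-middle (λ i ρ≤i i≤σ → at-middle i (ℕₚ.≤-antisym ρ≤i (subst (i ℕ.≤_) (ℕₚ.+-identityʳ ρ) i≤σ))))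
        where
        open Middle A low-eq ρ zero q≡ below mid
        at-middle : ∀ i → ρ ≡ i → a i ≡ b i
        at-middle i refl = double-inj (subst (λ s → a ρ + a s ≡ b ρ + b s) (ℕₚ.+-identityʳ ρ) mid-sum)
      finish-at ρ (suc κ) q≡ below mid κ+2F≤6 with F ℕ.≟ 1 | F ℕ.≟ 2
      ... | yes F≡1 | _ = inj₁ (λ i i<q → trans (one a-letters i<q) (sym (one b-letters i<q)))
        where
        one : ∀ {w w*} → Letters w w* → ∀ {i} → i ℕ.< q → w i ≡ 1ℤ
        one l i<q = ℤₚ.≤-antisym (subst (λ F → _ ≤ + F) F≡1 (≤F l i<q)) (≥1 l i<q)
      ... | no F≢1 | no F≢2 = contradiction κ+2F≤6 (ℕₚ.<⇒≱ (s≤s (ℕₚ.≤-trans (ℕₚ.*-monoʳ-≤ 2 3≤F) (ℕₚ.m≤n+m (2 ℕ.* F) κ))))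
        where
        3≤F : 3 ℕ.≤ F
        3≤F = ℕₚ.≤∧≢⇒< (ℕₚ.≤∧≢⇒< 1≤F (F≢1 ∘ sym)) (F≢2 ∘ sym)
      ... | no _ | yes F≡2 = two κ q≡ (ℕₚ.+-cancelʳ-≤ 5 κ 1 (subst (ℕ._≤ 6) (trans (cong (λ F → suc κ ℕ.+ 2 ℕ.* F) F≡2) (sym (ℕₚ.+-suc κ 4))) κ+2F≤6))
        where
        between : ∀ κ {i} → κ ℕ.≤ 1 → ρ ℕ.< i → i ℕ.< ρ ℕ.+ suc κ → κ ≡ 1 × i ≡ suc ρ
        between zero _ ρ<i i<σ = contradiction (ℕₚ.≤-trans i<σ (ℕₚ.≤-reflexive (ℕₚ.+-comm ρ 1))) (ℕₚ.<⇒≱ (s≤s ρ<i))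
        between (suc zero) {i} _ ρ<i i<σ = refl , ℕₚ.≤-antisym (ℕₚ.≤-pred (subst (i ℕ.<_) (ℕₚ.+-comm ρ 2) i<σ)) ρ<i
        between (suc (suc _)) (s≤s ()) _ _
        two : ∀ κ → q ≡ suc (ρ ℕ.+ suc κ ℕ.+ ρ) → κ ℕ.≤ 1 → Conclusion a b b*
        two κ q≡ κ≤1 = decide (a ρ ℤ.≟ b ρ)
          where
          open Close A low-eq ρ (suc κ) q≡ below mid
          ρ<σ : ρ ℕ.< ρ ℕ.+ suc κ
          ρ<σ = ℕₚ.m<m+n ρ (s≤s z≤n)
          centre : ∀ i → ρ ℕ.< i → i ℕ.< ρ ℕ.+ suc κ → a i ≡ b i
          centre i ρ<i i<σ with between κ κ≤1 ρ<i i<σ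
          ... | refl , refl = Centre.centre-letter ρ q≡ below mid
          centre-mirror : ∀ i → ρ ℕ.< i → i ℕ.< ρ ℕ.+ suc κ → q ℕ.∸ suc i ≡ i
          centre-mirror i ρ<i i<σ with between κ κ≤1 ρ<i i<σ
          ... | refl , refl = trans (cong (ℕ._∸ suc (suc ρ)) (trans q≡ (rearrange ρ))) (ℕₚ.m+n∸m≡n (suc (suc ρ)) (suc ρ))
            where
            rearrange : ∀ ρ → suc (ρ ℕ.+ 2 ℕ.+ ρ) ≡ suc (suc ρ) ℕ.+ suc ρ
            rearrange = solveℕ-∀
          open TwoLetters F≡2 ρ<σ centre centre-mirror
          decide : Dec (a ρ ≡ b ρ) → Conclusion a b b*
          decide (yes eq) = inj₁ (equal-if eq)
          decide (no neq) = inj₂ (finish neq κ refl κ≤1)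

    private
      hidden? : ∀ (i : Fin q) → Dec ((¬ Low (toℕ i)) × (¬ Low (q ℕ.∸ suc (toℕ i))))
      hidden? i = ¬? (low? (toℕ i)) ×-dec ¬? (low? (q ℕ.∸ suc (toℕ i)))

      low-0 : Low 0
      low-0 = subst Fits (sym (ℕₚ.+-identityʳ (4 ℕ.+ F))) enough

      -- Position k is the last low one, so ρ = k + 1 is within reach of the sums but not of the
      -- products. That 4 + F + ρ vertices are too many, combined with q = 2ρ + κ + 1 and q + 4F ≤ n
      -- + 2, yields κ + 2F ≤ 6.
      from-crossing : ∀ i → i ℕ.< q → ¬ Low (q ℕ.∸ suc i) → (∃ λ k → k ℕ.< i × Low k × ¬ Low (suc k)) → Conclusion a b b*
      from-crossing i i<q ¬low* (k , k<i , low-k , ¬low-ρ) = finish-at ρ κ q≡ (λ { (s≤s c≤k) → low-≤ c≤k low-k })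
        (subst Fits (sym (ℕₚ.+-suc (3 ℕ.+ F) k)) low-k) bound
        where
        ρ = suc k
        i* = q ℕ.∸ suc i
        ρ≤i* : ρ ℕ.≤ i*
        ρ≤i* = ℕₚ.≰⇒> (λ i*≤k → ¬low* (low-≤ i*≤k low-k))
        κ = (i ℕ.+ i*) ℕ.∸ (ρ ℕ.+ ρ)
        q≡ : q ≡ suc (ρ ℕ.+ κ ℕ.+ ρ)
        q≡ = trans (sym (ℕₚ.m+[n∸m]≡n i<q)) (cong suc (trans (sym (ℕₚ.m+[n∸m]≡n (ℕₚ.+-mono-≤ k<i ρ≤i*))) (rearrange ρ κ)))
          where
          rearrange : ∀ ρ κ → ρ ℕ.+ ρ ℕ.+ κ ≡ ρ ℕ.+ κ ℕ.+ ρ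
          rearrange = solveℕ-∀
        bound : κ ℕ.+ 2 ℕ.* F ℕ.≤ 6
        bound = ℕₚ.+-cancelʳ-≤ (2 ℕ.* ρ ℕ.+ 2 ℕ.* F ℕ.+ n ℕ.+ 4) _ _ (subst₂ ℕ._≤_ (lhs ρ κ F n) (rhs ρ F n)
          (ℕₚ.+-mono-≤ (subst (λ q → q ℕ.+ 4 ℕ.* F ℕ.≤ n ℕ.+ 2) q≡ q+4F≤) (ℕₚ.≰⇒> ¬low-ρ)))
          where
          lhs : ∀ ρ κ F n → suc (ρ ℕ.+ κ ℕ.+ ρ) ℕ.+ 4 ℕ.* F ℕ.+ suc (n ℕ.+ 2) ≡ κ ℕ.+ 2 ℕ.* F ℕ.+ (2 ℕ.* ρ ℕ.+ 2 ℕ.* F ℕ.+ n ℕ.+ 4)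
          lhs = solveℕ-∀
          rhs : ∀ ρ F n → n ℕ.+ 2 ℕ.+ (4 ℕ.+ F ℕ.+ ρ) ℕ.* 2 ≡ 6 ℕ.+ (2 ℕ.* ρ ℕ.+ 2 ℕ.* F ℕ.+ n ℕ.+ 4)
          rhs = solveℕ-∀

    words-oriented : Conclusion a b b*
    words-oriented with Finₚ.any? hidden?
    ... | yes (i , ¬low , ¬low*) = from-crossing (toℕ i) (Finₚ.toℕ<n i) ¬low* (crossing low? low-0 (toℕ i) ¬low)
    ... | no none = inj₁ visible
      where
      visible : ∀ i → i ℕ.< q → a i ≡ b i
      visible i i<q with low? i | low? (q ℕ.∸ suc i)
      ... | yes low | _ = proj₁ (low-eq i i<q low)
      ... | no _ | yes low* = trans (back a*-letters) (trans (proj₂ (low-eq (q ℕ.∸ suc i) (∸-suc-< i<q) low*)) (sym (back b*-letters)))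
        where
        back : ∀ {w w*} → Letters w* w → w i ≡ w* (q ℕ.∸ suc i)
        back l = Letters.mirror l i<q
      ... | no ¬low | no ¬low* = contradiction
        (fromℕ< i<q , subst (λ i → (¬ Low i) × (¬ Low (q ℕ.∸ suc i))) (sym (Finₚ.toℕ-fromℕ< i<q)) (¬low , ¬low*)) none

  words-agree : ∀ {a a* b b*} → Agree a a* b b* → Conclusion a b b*
  words-agree A with oriented A
  ... | inj₁ low-eq = words-oriented A low-eq
  ... | inj₂ low-eq with words-oriented (swap A) low-eq
  ...   | inj₁ eq = inj₂ eq
  ...   | inj₂ eq = inj₁ eq

-- Caterpillars with the same word

𝟙-iff : ∀ {P Q : Set} (P? : Dec P) (Q? : Dec Q) → (P → Q) → (Q → P) → 𝟙 (does P?) ≡ 𝟙 (does Q?)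
𝟙-iff (yes p) Q? to from = cong 𝟙 (sym (dec-true Q? (to p)))
𝟙-iff (no ¬p) Q? to from = cong 𝟙 (sym (dec-false Q? (¬p ∘ from)))

Bool-iff : ∀ {x y : Bool} → (x ≡ true → y ≡ true) → (y ≡ true → x ≡ true) → x ≡ y
Bool-iff {true}  {true}  _ _ = refl
Bool-iff {false} {false} _ _ = refl
Bool-iff {true}  {false} to _ = sym (to refl)
Bool-iff {false} {true}  _ from = from refl

module _ {L : Set} (_≟_ : ∀ (x y : L) → Dec (x ≡ y)) where
  count : ∀ {n} → (Fin n → L) → L → ℤ
  count a ℓ = ∑ (λ v → 𝟙 (does (a v ≟ ℓ)))

  count-hit : ∀ {n} (a : Fin n → L) ℓ → 0ℤ < count a ℓ → ∃ λ v → a v ≡ ℓ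
  count-hit a ℓ 0<c with v , 0<v ← ∑-pos (λ v → 𝟙 (does (a v ≟ ℓ))) 0<c = v , hit (a v ≟ ℓ) 0<v
    where
    hit : ∀ {x : L} (d : Dec (x ≡ ℓ)) → 0ℤ < 𝟙 (does d) → x ≡ ℓ
    hit (yes eq) _ = eq
    hit (no _) (+<+ ())

  count-self : ∀ {n} (a : Fin n → L) v → 0ℤ < count a (a v)
  count-self a v = ℤₚ.<-≤-trans 0<1 (subst (_≤ count a (a v)) (cong 𝟙 (dec-true (a v ≟ a v) refl))
    (≤-∑ (λ u → 𝟙 (does (a u ≟ a v))) (λ u → 𝟙-nonneg (does (a u ≟ a v))) v))

  -- Induction on m: vertex 0 is sent to any vertex with the same label, which exists because the
  -- count is positive, and removing both lowers the counts alike.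
  matching : ∀ {m n} (a : Fin m → L) (b : Fin n → L) → (∀ ℓ → count a ℓ ≡ count b ℓ) →
             Σ (Perm.Permutation m n) λ π → ∀ v → b (π Perm.⟨$⟩ʳ v) ≡ a v
  matching {zero} {zero} a b _ = Perm.id , λ ()
  matching {zero} {suc n} a b eq = contradiction (subst (0ℤ <_) (trans (sym (eq (b Fin.zero))) (∑-[] _)) (count-self b Fin.zero)) (ℤₚ.<-irrefl refl)
  matching {suc m} {n} a b eq = extend b eq (count-hit b (a Fin.zero) (subst (0ℤ <_) (eq (a Fin.zero)) (count-self a Fin.zero)))
    where
    extend : ∀ {n} (b : Fin n → L) → (∀ ℓ → count a ℓ ≡ count b ℓ) → (∃ λ j → b j ≡ a Fin.zero) →
             Σ (Perm.Permutation (suc m) n) λ π → ∀ v → b (π Perm.⟨$⟩ʳ v) ≡ a v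
    extend {suc n} b eq (j , bj≡) = Perm.insert Fin.zero j π , maps
      where
      smaller : ∀ ℓ → count (a ∘ Fin.suc) ℓ ≡ count (b ∘ Fin.punchIn j) ℓ
      smaller ℓ = +-cancelˡ (𝟙 (does (a Fin.zero ≟ ℓ))) _ _ (trans (sym (∑-∷ (λ v → 𝟙 (does (a v ≟ ℓ))))) (trans (eq ℓ)
        (trans (∑-remove j (λ v → 𝟙 (does (b v ≟ ℓ)))) (cong (λ x → 𝟙 (does (x ≟ ℓ)) + count (b ∘ Fin.punchIn j) ℓ) bj≡))))
      rec = matching (a ∘ Fin.suc) (b ∘ Fin.punchIn j) smaller
      π = proj₁ rec
      maps : ∀ v → b (Perm.insert Fin.zero j π Perm.⟨$⟩ʳ v) ≡ a v
      maps Fin.zero = bj≡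
      maps (Fin.suc v) = trans (cong b (Perm.insert-punchIn Fin.zero j π v)) (proj₂ rec v)

Label : Set
Label = Bool × ℕ

_≟ᴸ_ : (x y : Label) → Dec (x ≡ y)
_≟ᴸ_ = Productₚ.≡-dec Bool._≟_ ℕ._≟_

-- (true , i) labels the i-th spine vertex, (false , i) the leaves attached to it.
Joined : Label → Label → Set
Joined (true  , i) (true  , j) = j ≡ suc i ⊎ i ≡ suc j
Joined (true  , i) (false , j) = i ≡ j
Joined (false , i) (true  , j) = i ≡ j
Joined (false , i) (false , j) = ⊥

module Labelling {n q F : ℕ} (G : Graph n) (pruned : Pruned F G) (S : Spine G q) where
  open Pruned pruned
  open Spine S

  private
    Attached : Fin n → Bool → ℕ → Set
    Attached v true  i = ê i ≡ v
    Attached v false i = adj G v (ê i) ≡ true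

    attach : ∀ v → ∃ λ i → i ℕ.< q × Attached v (isNonLeaf G v) i
    attach v with isNonLeaf G v in eq
    ... | true = nonleaf⇒ê v eq
    ... | false = via (∑-pos (λ u → 𝟙 (adj G v u)) (subst (0ℤ <_) (deg≡dg G v) (+<+ (DegreesWithin.deg≥1 within v))))
      where
      via : (∃ λ u → 0ℤ < 𝟙 (adj G v u)) → ∃ λ i → i ℕ.< q × adj G v (ê i) ≡ true
      via (u , 0<vu) =
        let vu = 𝟙-pos (adj G v u) 0<vu
            i , i<q , eq′ = nonleaf⇒ê u (noLeafEdge v u vu eq)
        in i , i<q , trans (cong (adj G v) eq′) vu

    index : Fin n → ℕ
    index v = proj₁ (attach v)

    index<q : ∀ v → index v ℕ.< q
    index<q v = proj₁ (proj₂ (attach v))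

    on-spine : ∀ v → isNonLeaf G v ≡ true → ê (index v) ≡ v
    on-spine v eq = subst (λ b → Attached v b (index v)) eq (proj₂ (proj₂ (attach v)))

    on-leaf : ∀ v → isNonLeaf G v ≡ false → adj G v (ê (index v)) ≡ true
    on-leaf v eq = subst (λ b → Attached v b (index v)) eq (proj₂ (proj₂ (attach v)))

    leaf-at : ∀ {v} → isNonLeaf G v ≡ false → ∀ {i} → i ℕ.< q → adj G v (ê i) ≡ true → index v ≡ i
    leaf-at {v} leaf i<q a = ê-inj (index<q v) i<q (leaf-nbr G leaf a (on-leaf v leaf))

    index-ê : ∀ {i} → i ℕ.< q → index (ê i) ≡ i
    index-ê i<q = ê-inj (index<q _) i<q (on-spine _ (ê-nonleaf i<q))

  label : Fin n → Label
  label v = isNonLeaf G v , index v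

  private
    joined : ∀ u v b c → isNonLeaf G u ≡ b → isNonLeaf G v ≡ c → adj G u v ≡ true → Joined (b , index u) (c , index v)
    joined u v true  true  nl-u nl-v uv = consec⁻ (index<q u) (index<q v) (trans (cong₂ (adj G) (on-spine u nl-u) (on-spine v nl-v)) uv)
    joined u v true  false nl-u nl-v uv = sym (leaf-at nl-v (index<q u) (trans (cong (adj G v) (on-spine u nl-u)) (trans (adj-sym G v u) uv)))
    joined u v false true  nl-u nl-v uv = leaf-at nl-u (index<q v) (trans (cong (adj G u) (on-spine v nl-v)) uv)
    joined u v false false nl-u nl-v uv with () ← trans (sym (noLeafEdge u v uv nl-u)) nl-v

    adjacent : ∀ u v b c → isNonLeaf G u ≡ b → isNonLeaf G v ≡ c → Joined (b , index u) (c , index v) → adj G u v ≡ true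
    adjacent u v true true nl-u nl-v (inj₁ eq) = trans (sym (cong₂ (adj G) (on-spine u nl-u) (trans (cong ê (sym eq)) (on-spine v nl-v))))
      (consec (subst (ℕ._< q) eq (index<q v)))
    adjacent u v true true nl-u nl-v (inj₂ eq) = trans (adj-sym G u v) (trans
      (sym (cong₂ (adj G) (on-spine v nl-v) (trans (cong ê (sym eq)) (on-spine u nl-u)))) (consec (subst (ℕ._< q) eq (index<q u))))
    adjacent u v true false nl-u nl-v eq = trans (adj-sym G u v) (trans (cong (adj G v) (trans (sym (on-spine u nl-u)) (cong ê eq))) (on-leaf v nl-v))
    adjacent u v false true nl-u nl-v eq = trans (cong (adj G u) (trans (sym (on-spine v nl-v)) (cong ê (sym eq)))) (on-leaf u nl-u)
    adjacent u v false false _ _ ()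

  adj⇒joined : ∀ u v → adj G u v ≡ true → Joined (label u) (label v)
  adj⇒joined u v = joined u v (isNonLeaf G u) (isNonLeaf G v) refl refl

  joined⇒adj : ∀ u v → Joined (label u) (label v) → adj G u v ≡ true
  joined⇒adj u v = adjacent u v (isNonLeaf G u) (isNonLeaf G v) refl refl

  count-beyond : ∀ b i → ¬ i ℕ.< q → count _≟ᴸ_ label (b , i) ≡ 0ℤ
  count-beyond b i i≮q = ∑-zero (λ v → cong 𝟙 (dec-false (label v ≟ᴸ (b , i)) (λ eq → i≮q (subst (ℕ._< q) (cong proj₂ eq) (index<q v)))))

  count-spine : ∀ i → i ℕ.< q → count _≟ᴸ_ label (true , i) ≡ 1ℤ
  count-spine i i<q = trans (∑-cong (λ v → trans
      (𝟙-iff (label v ≟ᴸ (true , i)) (v Fin.≟ ê i)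
        (λ eq → trans (sym (on-spine v (cong proj₁ eq))) (cong ê (cong proj₂ eq)))
        (λ { refl → cong₂ _,_ (ê-nonleaf i<q) (index-ê i<q) }))
      (sym (ℤₚ.*-identityʳ (𝟙 (v == ê i))))))
    (∑-δ (ê i) (λ _ → 1ℤ))

  -- The number of spine neighbours of position i. It depends on q alone and is therefore the same
  -- in both graphs.
  ends : ℕ → ℤ
  ends i = zeroExtend q (λ _ → 1ℤ) (suc i) + zeroExtend q (λ _ → 1ℤ) (suc (q ℕ.∸ suc i))

  count-leaves : ∀ i → i ℕ.< q → count _≟ᴸ_ label (false , i) ≡ word S i + 1ℤ - ends i
  count-leaves i i<q = begin
    count _≟ᴸ_ label (false , i)
      ≡⟨ ∑-cong term ⟩
    ∑ (λ v → 𝟙 (adj G (ê i) v) - 𝟙 (adj G (ê i) v) * nl G v)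
      ≡⟨ ∑-- (λ v → 𝟙 (adj G (ê i) v)) (λ v → 𝟙 (adj G (ê i) v) * nl G v) ⟩
    dg G (ê i) - innerDeg G (ê i)
      ≡⟨ cong₂ _-_ (trans (back (dg G (ê i))) (cong (_+ 1ℤ) (sym (zeroExtend-< (λ i → f G (ê i)) i<q))))
           (trans (∑-nbrs S (nl G) (λ w _ → nl-vanishes {q = q} {G} w) i<q)
             (cong₂ _+_ (zeroExtend-cong {q} {λ i → nl G (ê i)} {λ _ → 1ℤ} (suc i) (λ lt → cong 𝟙 (ê-nonleaf lt)))
                        (zeroExtend-cong {q} {λ i → nl G (ê (q ℕ.∸ suc i))} {λ _ → 1ℤ} (suc (q ℕ.∸ suc i)) (λ lt → cong 𝟙 (ê-nonleaf (∸-suc-< lt)))))) ⟩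
    word S i + 1ℤ - ends i ∎
    where
    open ≡-Reasoning
    back : ∀ x → x ≡ x - 1ℤ + 1ℤ
    back = solve-∀
    term : ∀ v → 𝟙 (does (label v ≟ᴸ (false , i))) ≡ 𝟙 (adj G (ê i) v) - 𝟙 (adj G (ê i) v) * nl G v
    term v = cases (isNonLeaf G v) refl
      where
      cancel : ∀ x → 0ℤ ≡ x - x * 1ℤ
      cancel = solve-∀
      keep : ∀ x → x ≡ x - x * 0ℤ
      keep = solve-∀
      cases : ∀ b → isNonLeaf G v ≡ b → 𝟙 (does (label v ≟ᴸ (false , i))) ≡ 𝟙 (adj G (ê i) v) - 𝟙 (adj G (ê i) v) * nl G v
      cases true eq = trans (cong 𝟙 (dec-false (label v ≟ᴸ (false , i)) (λ eq′ → case trans (sym eq) (cong proj₁ eq′) of λ ())))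
        (trans (cancel (𝟙 (adj G (ê i) v))) (cong (λ b → 𝟙 (adj G (ê i) v) - 𝟙 (adj G (ê i) v) * 𝟙 b) (sym eq)))
      cases false eq = trans (adjacency (adj G (ê i) v) refl)
        (trans (keep (𝟙 (adj G (ê i) v))) (cong (λ b → 𝟙 (adj G (ê i) v) - 𝟙 (adj G (ê i) v) * 𝟙 b) (sym eq)))
        where
        adjacency : ∀ b → adj G (ê i) v ≡ b → 𝟙 (does (label v ≟ᴸ (false , i))) ≡ 𝟙 (adj G (ê i) v)
        adjacency true a = cong 𝟙 (trans (dec-true (label v ≟ᴸ (false , i)) (cong₂ _,_ eq (leaf-at eq i<q (trans (adj-sym G v (ê i)) a)))) (sym a))
        adjacency false a = cong 𝟙 (trans (dec-false (label v ≟ᴸ (false , i)) (λ eq′ →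
          case trans (sym a) (trans (adj-sym G (ê i) v) (subst (λ j → adj G v (ê j) ≡ true) (cong proj₂ eq′) (on-leaf v eq))) of λ ())) (sym a))

-- Adjacency is a function of the labels, so any label-preserving bijection is an isomorphism. The
-- word tells how many vertices carry each label.
same-word⇒≅ : ∀ {m n q F} (H : Graph m) (G : Graph n) → Pruned F H → Pruned F G → (T : Spine H q) (S : Spine G q) →
              (∀ i → i ℕ.< q → word T i ≡ word S i) → H ≅ G
same-word⇒≅ {q = q} H G prunedH prunedG T S same = π , preserves
  where
  module LH = Labelling H prunedH T
  module LG = Labelling G prunedG S
  counts : ∀ ℓ → count _≟ᴸ_ LH.label ℓ ≡ count _≟ᴸ_ LG.label ℓ
  counts (b , i) with i ℕ.<? q
  counts (b , i) | no i≮q = trans (LH.count-beyond b i i≮q) (sym (LG.count-beyond b i i≮q))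
  counts (true , i) | yes i<q = trans (LH.count-spine i i<q) (sym (LG.count-spine i i<q))
  counts (false , i) | yes i<q = trans (LH.count-leaves i i<q) (trans (cong (λ x → x + 1ℤ - LH.ends i) (same i i<q)) (sym (LG.count-leaves i i<q)))
  matched = matching _≟ᴸ_ LH.label LG.label counts
  π = proj₁ matched
  preserves : ∀ u v → adj H u v ≡ adj G (Inverse.to π u) (Inverse.to π v)
  preserves u v = Bool-iff
    (λ uv → LG.joined⇒adj _ _ (subst₂ Joined (sym (proj₂ matched u)) (sym (proj₂ matched v)) (LH.adj⇒joined u v uv)))
    (λ uv → LH.joined⇒adj u v (subst₂ Joined (proj₂ matched u) (proj₂ matched v) (LG.adj⇒joined _ _ uv)))

-- Equations between the words of the two graphs

rank-prefix : ∀ c ks e → rank (zeros c List.++ ks) e ≡ c ℕ.+ rank ks e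
rank-prefix zero    ks e = refl
rank-prefix (suc c) ks e = cong suc (rank-prefix c ks e)

window-prefix : ∀ w c ks e i → window w (zeros c List.++ ks) e i ≡ window w ks e (i ℕ.+ c)
window-prefix w zero    ks e i = cong (window w ks e) (sym (ℕₚ.+-identityʳ i))
window-prefix w (suc c) ks e i = trans (ℤₚ.*-identityˡ (window w (zeros c List.++ ks) e (suc i)))
  (trans (window-prefix w c ks e (suc i)) (cong (window w ks e) (sym (ℕₚ.+-suc i c))))

word-mirror : ∀ {n q} {G : Graph n} (S : Spine G q) {i} → i ℕ.< q → word (reverse S) i ≡ word S (q ℕ.∸ suc i)
word-mirror {q = q} {G} S {i} i<q = trans (zeroExtend-< (λ j → f G (Spine.ê S (q ℕ.∸ suc j))) i<q)
  (sym (zeroExtend-< (λ j → f G (Spine.ê S j)) (∸-suc-< i<q)))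

word-mirror′ : ∀ {n q} {G : Graph n} (S : Spine G q) {i} → i ℕ.< q → word S i ≡ word (reverse S) (q ℕ.∸ suc i)
word-mirror′ S i<q = trans (cong (word S) (sym (mirror-mirror i<q))) (sym (word-mirror S (∸-suc-< i<q)))

module Compare {n : ℕ} (48≤n : 48 ℕ.≤ n) (H G : Graph n) (same : SameDeck H G) (C : Caterpillar G)
               (spineH : Spine H (Caterpillar.q C)) where
  open Caterpillar C
  open Recognition 48≤n H G same C using (prunedH; start-walks-≡; start-≡; correlation-≡)
  open Rebuild 48≤n H G same C using (fits-F+4)
  open WordsTheorem n q F 1≤F q+4F≤ (subst (λ r → r ℕ.* 2 ℕ.≤ n ℕ.+ 2) (cong (2 ℕ.+_) (ℕₚ.+-comm F 2)) fits-F+4)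

  private
    withinH = Pruned.within prunedH
    withinG = Pruned.within pruned

    letters : ∀ {K : Graph n} → DegreesWithin F K → (S : Spine K q) → ∀ {w*} → (∀ {i} → i ℕ.< q → w* i ≡ word S (q ℕ.∸ suc i)) → Letters (word S) w*
    letters within S mirror = record
      { ≥1 = word-≥1 within S ; ≤F = word-≤F within S ; beyond = λ {i} → word-beyond within S i ; mirror = mirror }

    anchored-≡ : ∀ ks e → Fits (2 ℕ.+ (F ℕ.+ rank ks e)) →
      window (word spine) ks e 0 + window (word (reverse spine)) ks e 0 ≡ window (word spineH) ks e 0 + window (word (reverse spineH)) ks e 0
    anchored-≡ ks e fits = trans (sym (anchored withinG spine ks e)) (trans (sym (start-walks-≡ ks e fits)) (anchored withinH spineH ks e))

    transport : ∀ {ks e} {φ : (ℕ → ℤ) → ℤ} → (∀ w → window w ks e 0 ≡ φ w) → Fits (2 ℕ.+ (F ℕ.+ rank ks e)) →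
      φ (word spine) + φ (word (reverse spine)) ≡ φ (word spineH) + φ (word (reverse spineH))
    transport {ks} {e} value fits = trans (sym (cong₂ _+_ (value (word spine)) (value (word (reverse spine)))))
      (trans (anchored-≡ ks e fits) (cong₂ _+_ (value (word spineH)) (value (word (reverse spineH)))))

    sums : ∀ c → Fits (3 ℕ.+ F ℕ.+ c) → word spine c + word (reverse spine) c ≡ word spineH c + word (reverse spineH) c
    sums c fits = transport {zeros c} {0} {λ w → w c} (λ w → window-zeros w c 0) (subst Fits eq fits)
      where
      eq : 3 ℕ.+ F ℕ.+ c ≡ 2 ℕ.+ (F ℕ.+ rank (zeros c) 0)
      eq = cong (2 ℕ.+_) (trans (sym (ℕₚ.+-suc F c)) (cong (F ℕ.+_) (sym (rank-zeros c))))

    square : ∀ c → Fits (4 ℕ.+ F ℕ.+ c) →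
      word spine c * word spine c + word (reverse spine) c * word (reverse spine) c ≡
      word spineH c * word spineH c + word (reverse spineH) c * word (reverse spineH) c
    square c fits = transport {zeros c List.++ []} {1} {λ w → w c * w c}
      (λ w → trans (window-prefix w c [] 1 0) (cong (_*_ (w c)) (ℤₚ.*-identityʳ (w c)))) (subst Fits eq fits)
      where
      arith : ∀ F c → 2 ℕ.+ F ℕ.+ c ≡ F ℕ.+ (c ℕ.+ 2)
      arith = solveℕ-∀
      eq : 4 ℕ.+ F ℕ.+ c ≡ 2 ℕ.+ (F ℕ.+ rank (zeros c List.++ []) 1)
      eq = cong (2 ℕ.+_) (trans (arith F c) (cong (F ℕ.+_) (sym (rank-prefix c [] 1))))

    -- The letters before the first and between the two are walked over with exponent 0, which costs
    -- one vertex each; the two letters that are read carry exponent 1. The total is the same as for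
    -- a square at the further position.
    pair : ∀ c k → Fits (4 ℕ.+ F ℕ.+ (suc c ℕ.+ k)) →
      word spine c * word spine (suc c ℕ.+ k) + word (reverse spine) c * word (reverse spine) (suc c ℕ.+ k) ≡
      word spineH c * word spineH (suc c ℕ.+ k) + word (reverse spineH) c * word (reverse spineH) (suc c ℕ.+ k)
    pair c k fits = transport {zeros c List.++ (1 ∷ zeros k)} {0} {λ w → w c * w (suc c ℕ.+ k)}
      (λ w → trans (window-prefix w c (1 ∷ zeros k) 0 0) (cong₂ _*_ (ℤₚ.*-identityʳ (w c)) (window-zeros w k (suc c)))) (subst Fits eq fits)
      where
      arith : ∀ F c k → 2 ℕ.+ F ℕ.+ (suc c ℕ.+ k) ≡ F ℕ.+ (c ℕ.+ suc (suc (suc k)))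
      arith = solveℕ-∀
      eq : 4 ℕ.+ F ℕ.+ (suc c ℕ.+ k) ≡ 2 ℕ.+ (F ℕ.+ rank (zeros c List.++ (1 ∷ zeros k)) 0)
      eq = cong (2 ℕ.+_) (trans (arith F c k) (cong (F ℕ.+_)
        (trans (cong (λ r → c ℕ.+ suc (suc r)) (sym (rank-zeros k))) (sym (rank-prefix c (1 ∷ zeros k) 0)))))

    products : ∀ c d → c ℕ.≤ d → Fits (4 ℕ.+ F ℕ.+ d) →
      word spine c * word spine d + word (reverse spine) c * word (reverse spine) d ≡
      word spineH c * word spineH d + word (reverse spineH) c * word (reverse spineH) d
    products c d c≤d fits with ℕₚ.m≤n⇒m<n∨m≡n c≤d
    ... | inj₂ refl = square c fits
    ... | inj₁ c<d with k , refl ← ℕₚ.m≤n⇒∃[o]m+o≡n c<d = pair c k fits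

    total-letters : ∀ {K : Graph n} (within : DegreesWithin F K) (S : Spine K q) → total within S [] 0 ≡ ∑ {q} (λ i → word S (toℕ i))
    total-letters within S = ∑-cong (λ i → ℤₚ.*-identityʳ (word S (toℕ i)))

    totals : ∑ {q} (λ i → word spine (toℕ i)) + ∑ {q} (λ i → word (reverse spine) (toℕ i)) ≡
             ∑ {q} (λ i → word spineH (toℕ i)) + ∑ {q} (λ i → word (reverse spineH) (toℕ i))
    totals = trans (sym (side withinG spine)) (trans (sym (start-≡ [] 0 fits)) (side withinH spineH))
      where
      side : ∀ {K : Graph n} → DegreesWithin F K → (S : Spine K q) →
        start K [] 0 ≡ ∑ {q} (λ i → word S (toℕ i)) + ∑ {q} (λ i → word (reverse S) (toℕ i))
      side within S = trans (start-spine within S [] 0) (cong₂ _+_ (total-letters within S) (total-letters within (reverse S)))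
      fits : Fits (2 ℕ.+ (F ℕ.+ 1))
      fits = ℕₚ.≤-trans (ℕₚ.*-monoˡ-≤ 2 {2 ℕ.+ (F ℕ.+ 1)} {2 ℕ.+ (F ℕ.+ 2)} (s≤s (s≤s (ℕₚ.+-monoʳ-≤ F (s≤s z≤n))))) fits-F+4

    correlated : ∀ L → Fits (4 ℕ.+ L) →
      autocorrelation q (word spine) (suc L) + autocorrelation q (word (reverse spine)) (suc L) ≡
      autocorrelation q (word spineH) (suc L) + autocorrelation q (word (reverse spineH)) (suc L)
    correlated L fits = trans (sym (side withinG spine)) (trans (sym (correlation-≡ (zeros L) (subst (λ r → Fits (3 ℕ.+ r)) (sym (rank-zeros L)) fits))) (side withinH spineH))
      where
      one-way : ∀ {K : Graph n} (within : DegreesWithin F K) (S : Spine K q) → total within S (1 ∷ zeros L) 0 ≡ autocorrelation q (word S) (suc L)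
      one-way within S = ∑-cong (λ i → cong₂ _*_ (ℤₚ.*-identityʳ (word S (toℕ i)))
        (trans (window-zeros (word S) L (suc (toℕ i))) (cong (word S) (sym (ℕₚ.+-suc (toℕ i) L)))))
      side : ∀ {K : Graph n} (within : DegreesWithin F K) (S : Spine K q) →
        correlation K (zeros L) ≡ autocorrelation q (word S) (suc L) + autocorrelation q (word (reverse S)) (suc L)
      side within S = trans (correlation-spine within S (zeros L)) (cong₂ _+_ (one-way within S) (one-way within (reverse S)))

    agree : Agree (word spine) (word (reverse spine)) (word spineH) (word (reverse spineH))
    agree = record
      { a-letters  = letters withinG spine (word-mirror spine)
      ; a*-letters = letters withinG (reverse spine) (word-mirror′ spine)
      ; b-letters  = letters withinH spineH (word-mirror spineH)
      ; b*-letters = letters withinH (reverse spineH) (word-mirror′ spineH)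
      ; sums = sums ; products = products ; totals = totals ; correlated = correlated
      }

  isomorphic : H ≅ G
  isomorphic = conclude (words-agree agree)
    where
    conclude : Conclusion (word spine) (word spineH) (word (reverse spineH)) → H ≅ G
    conclude (inj₁ eq) = same-word⇒≅ H G prunedH pruned spineH spine (λ i i<q → sym (eq i i<q))
    conclude (inj₂ eq) = same-word⇒≅ H G prunedH pruned (reverse spineH) spine (λ i i<q → sym (eq i i<q))

theorem5p6 : (n : ℕ) → 48 ℕ.≤ n → (G : Graph n) → IsCaterpillar G
    → Σ (Fin 4 → Fin n) (λ f → Injective _≡_ _≡_ f × (∀ i → HasMaxDegree G (f i)))
    → (m : ℕ) (H : Graph m) → SameDeck H G → H ≅ G
theorem5p6 n 48≤n G cat big m H same = sameSize (Deck.sameOrder H G same) H same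
  where
  C : Caterpillar G
  C = FromDefs.caterpillar 48≤n G cat big

  sameSize : ∀ {m} → m ≡ n → (H : Graph m) → SameDeck H G → H ≅ G
  sameSize refl H same = Compare.isomorphic 48≤n H G same C (Rebuild.spineH 48≤n H G same C)
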